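{- Let $W$ be an irreducible $T$-module with endpoint $r$ and diameter $d=D-2r$. Let $u\in E_rW$, $u^*\in E_r^*W$, $u^{\varepsilon}\in E_r^{\varepsilon}W$ be nonzero vectors. Consider the $(d+1)\times(d+1)$ tridiagonal matrix $$B=\mathbf{i}\begin{pmatrix}0&d&&&&0\\-1&0&d-1&&&\\&-2&\cdot&\cdot&&\\&&\cdot&\cdot&\cdot&\\&&&\cdot&\cdot&1\\0&&&&-d&0\end{pmatrix},$$ i.e. $B_{i,i-1}=-\mathbf{i}\,i$ for $1\le i\le d$, $B_{i,i+1}=\mathbf{i}(d-i)$ for $0\le i\le d-1$, and all other entries are $0$. Then the following hold. (i) $B$ represents $A$ with respect to the basis $E^{\varepsilon}_ru^*,\ldots,E^{\varepsilon}_{r+d}u^*$ of $W$. (ii) $B$ represents $A^*$ with respect to the basis $E_ru^{\varepsilon},\ldots,E_{r+d}u^{\varepsilon}$ of $W$. (iii) $B$ represents $A^{\varepsilon}$ with respect to the basis $E^*_ru,\ldots,E^*_{r+d}u$ of $W$.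
   Context: Let $D$ be a positive integer and let $Q_D$ be the $D$-cube: the graph with vertex set $X=\{0,1\}^D$, two vertices being adjacent iff they differ in exactly one coordinate; $\partial$ denotes path-length distance. $\mathrm{Mat}_X(\mathbb{C})$ is the algebra of complex matrices with rows and columns indexed by $X$, acting on $V=\mathbb{C}^X$ (column vectors) by left multiplication. Write $\mathbf{i}^2=-1$ (the bold $\mathbf{i}$ is the imaginary unit; the plain $i$ is an index). Let $A$ be the adjacency matrix of $Q_D$. Fix $x=(0,0,\ldots,0)\in X$. Let $A^*$ be the diagonal matrix in $\mathrm{Mat}_X(\mathbb{C})$ with $(y,y)$-entry $D-2\partial(x,y)$ for $y\in X$, and let $A^{\varepsilon}=-\mathbf{i}(AA^*-A^*A)/2$. Let $T$ be the subalgebra of $\mathrm{Mat}_X(\mathbb{C})$ generated by $A$ and $A^*$. The eigenvalues of $A$ are $\theta_i=D-2i$ $(0\le i\le D)$. For $0\le i\le D$: $E_i=\prod_{0\le j\le D,\,j\ne i}\frac{A-\theta_jI}{\theta_i-\theta_j}$ is the primitive idempotent of $A$ for $\theta_i$ (the orthogonal projection onto the $\theta_i$-eigenspace of $A$); $E_i^*$ is the diagonal matrix with $(y,y)$-entry $1$ if $\partial(x,y)=i$ and $0$ otherwise; and $E_i^{\varepsilon}=P^{ -1}E_iP$, where $P=P_1^{\otimes D}$ (Kronecker power, $P_{yz}=\prod_{k=1}^D(P_1)_{y_kz_k}$, invertible) with $P_1=\begin{pmatrix}1&1\\-\mathbf{i}&\mathbf{i}\end{pmatrix}$, rows and columns indexed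 by $0,1$ in that order. ($E_i^*$ and $E_i^{\varepsilon}$ are the primitive idempotents of $A^*$ and $A^{\varepsilon}$ for the eigenvalue $D-2i$.) A $T$-module is a subspace $W\subseteq V$ with $BW\subseteq W$ for all $B\in T$; it is irreducible if $W\ne0$ and it contains no $T$-modules other than $0$ and $W$. The endpoint of an irreducible $T$-module $W$ is $r=\min\{i\mid 0\le i\le D,\ E_i^*W\neq0\}$ (it is known that also $r=\min\{i\mid E_iW\ne0\}$), and its diameter is $d=|\{i\mid 0\le i\le D,\ E_i^*W\ne0\}|-1$; it is known that $d=D-2r$ and $0\le r\le D/2$. For nonzero $u\in E_rW$, $u^*\in E^*_rW$, $u^{\varepsilon}\in E^{\varepsilon}_rW$, each of the six sequences $(E^*_{r+i}u)_{i=0}^d$, $(E^{\varepsilon}_{r+i}u)_{i=0}^d$, $(E^{\varepsilon}_{r+i}u^*)_{i=0}^d$, $(E_{r+i}u^*)_{i=0}^d$, $(E_{r+i}u^{\varepsilon})_{i=0}^d$, $(E^*_{r+i}u^{\varepsilon})_{i=0}^d$ is a basis of $W$. Convention: a $(d+1)\times(d+1)$ matrix $B$ (rows and columns indexed $0,\ldots,d$) represents $Y\in T$ with respect to a basis $v_0,\ldots,v_d$ of $W$ if $Yv_j=\sum_{i=0}^dB_{ij}v_i$ for $0\le j\le d$. -}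

module Defs where

open import Algebra.Bundles using (AbelianGroup; CommutativeRing)
import Algebra.Properties.CommutativeMonoid.Sum as MonoidSum
open import Algebra.Properties.Group using (x∙y⁻¹≈ε⇒x≈y; ∙-cancelˡ)
open import Data.Bool.Base using (if_then_else_)
open import Data.Fin.Base using (Fin; toℕ) renaming (zero to fzero; suc to fsuc)
open import Data.Fin.Properties using () renaming (_≟_ to _≟ᶠ_)
open import Data.Fin.Subset using (Subset; ∣_∣) renaming (_∈_ to _∈ˢ_)
import Data.Integer.Base as ℤ
import Data.Integer.Properties as ℤ
open import Data.List.Base using (foldr; map; upTo)
open import Data.Nat.Base as ℕ using (ℕ; zero; suc; z≤n; s≤s; _⊔_; _∸_)
import Data.Nat.Properties as ℕ
open import Data.Product.Base using (Σ; ∃; _×_; _,_; proj₁)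
open import Data.Rational.Base as ℚ using (ℚ; 0ℚ; 1ℚ; ½)
import Data.Rational.Base
import Data.Rational.Properties as ℚ
open import Data.Rational.Literals using (fromℤ)
import Data.Rational.Solver as ℚ
open import Data.Vec.Base using (Vec; []; _∷_; replicate; zip; count)
open import Data.Vec.Properties using (≡-dec)
open import Function.Base using (_∘_; case_of_)
open import Function.Bundles using (_⇔_)
open import Level using (0ℓ)
open import Relation.Binary.PropositionalEquality using (_≡_; _≢_; refl; sym; trans; cong; subst; subst₂)
open import Relation.Nullary using (¬_; Dec; yes; no; ⌊_⌋; ¬?; contradiction)
open import Relation.Unary using (Pred; _⊆_; _∈_)

open ℚ.+-*-Solver using (solve; _:=_; _:+_; _:*_; :-_; _:-_; con)

-- Real numbers are Cauchy sequences of rationals, identified when their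
-- difference tends to 0 (the setoid equality _≃_); ℂ is built as pairs.

Tends0 : (ℕ → ℕ → ℚ) → Set
Tends0 f = ∀ ε → 0ℚ ℚ.< ε → ∃ λ N → ∀ m n → N ℕ.≤ m → N ℕ.≤ n → ℚ.∣ f m n ∣ ℚ.< ε

record ℝ : Set where
  no-eta-equality
  field
    seq    : ℕ → ℚ
    cauchy : Tends0 (λ m n → seq m ℚ.- seq n)

open ℝ public

infix 4 _≃_

record _≃_ (x y : ℝ) : Set where
  constructor eq
  field
    gap : ∀ ε → 0ℚ ℚ.< ε → ∃ λ N → ∀ n → N ℕ.≤ n → ℚ.∣ seq x n ℚ.- seq y n ∣ ℚ.< ε

open _≃_ public

Bounded : (ℕ → ℕ → ℚ) → Set
Bounded g = Σ ℚ λ B → ℚ.Positive B ×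
  ∃ λ N → ∀ m n → N ℕ.≤ m → N ℕ.≤ n → ℚ.∣ g m n ∣ ℚ.≤ B

⊔ˡ : ∀ {M N k} → M ⊔ N ℕ.≤ k → M ℕ.≤ k
⊔ˡ {M} {N} = ℕ.≤-trans (ℕ.m≤m⊔n M N)

⊔ʳ : ∀ {M N k} → M ⊔ N ℕ.≤ k → N ℕ.≤ k
⊔ʳ {M} {N} = ℕ.≤-trans (ℕ.m≤n⊔m M N)

halve : ∀ ε → ½ ℚ.* ε ℚ.+ ½ ℚ.* ε ≡ ε
halve = solve 1 (λ e → con ½ :* e :+ con ½ :* e := e) refl

half>0 : ∀ {ε} → 0ℚ ℚ.< ε → 0ℚ ℚ.< ½ ℚ.* ε
half>0 {ε} ε>0 = ℚ.positive⁻¹ (½ ℚ.* ε) {{ℚ.pos*pos⇒pos ½ ε {{ℚ.positive ε>0}}}}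

resp0 : ∀ {f g} → (∀ m n → f m n ≡ g m n) → Tends0 f → Tends0 g
resp0 f≡g f→0 ε ε>0 with f→0 ε ε>0
... | N , h = N , λ m n p q → subst (λ z → ℚ.∣ z ∣ ℚ.< ε) (f≡g m n) (h m n p q)

neg0 : ∀ {f} → Tends0 f → Tends0 (λ m n → ℚ.- f m n)
neg0 {f} f→0 ε ε>0 with f→0 ε ε>0
... | N , h = N , λ m n p q → subst (ℚ._< ε) (sym (ℚ.∣-p∣≡∣p∣ (f m n))) (h m n p q)

add0 : ∀ {f g} → Tends0 f → Tends0 g → Tends0 (λ m n → f m n ℚ.+ g m n)
add0 {f} {g} f→0 g→0 ε ε>0 with f→0 (½ ℚ.* ε) (half>0 ε>0) | g→0 (½ ℚ.* ε) (half>0 ε>0)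
... | M , h | N , k = M ⊔ N , λ m n p q → subst (ℚ.∣ f m n ℚ.+ g m n ∣ ℚ.<_) (halve ε)
  (ℚ.≤-<-trans (ℚ.∣p+q∣≤∣p∣+∣q∣ (f m n) (g m n))
    (ℚ.+-mono-< (h m n (⊔ˡ p) (⊔ˡ q)) (k m n (⊔ʳ {M} p) (⊔ʳ {M} q))))

mul0 : ∀ {f g} → Bounded g → Tends0 f → Tends0 (λ m n → g m n ℚ.* f m n)
mul0 {f} {g} (B , B>0 , M , h) f→0 ε ε>0 with f→0 ((ℚ.1/ B) {{B≢0}} ℚ.* ε) δ>0
  where
  instance
    _ = B>0
    B≢0 : ℚ.NonZero B
    B≢0 = ℚ.pos⇒nonZero B
  δ>0 : 0ℚ ℚ.< ℚ.1/ B ℚ.* ε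
  δ>0 = ℚ.positive⁻¹ (ℚ.1/ B ℚ.* ε)
    {{ℚ.pos*pos⇒pos (ℚ.1/ B) {{ℚ.1/pos⇒pos B}} ε {{ℚ.positive ε>0}}}}
... | N , k = M ⊔ N , λ m n p q → subst₂ ℚ._<_ (sym (ℚ.∣p*q∣≡∣p∣*∣q∣ (g m n) (f m n))) cancel
  (ℚ.≤-<-trans
    (ℚ.*-monoʳ-≤-nonNeg ℚ.∣ f m n ∣ {{ℚ.∣-∣-nonNeg (f m n)}} (h m n (⊔ˡ p) (⊔ˡ q)))
    (ℚ.*-monoʳ-<-pos B {{B>0}} (k m n (⊔ʳ {M} p) (⊔ʳ {M} q))))
  where
  instance
    B≢0 : ℚ.NonZero B
    B≢0 = ℚ.pos⇒nonZero B {{B>0}}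
  cancel : B ℚ.* (ℚ.1/ B ℚ.* ε) ≡ ε
  cancel = trans (sym (ℚ.*-assoc B (ℚ.1/ B) ε))
    (trans (cong (ℚ._* ε) (ℚ.*-inverseʳ B)) (ℚ.*-identityˡ ε))

bounded : ∀ x → Bounded (λ m _ → seq x m)
bounded x with cauchy x 1ℚ (ℚ.positive⁻¹ 1ℚ)
... | N , h = 1ℚ ℚ.+ ℚ.∣ a ∣ , ℚ.pos+nonNeg⇒pos 1ℚ ℚ.∣ a ∣ {{ℚ.∣-∣-nonNeg a}} , N ,
  λ m _ p _ → subst (λ z → ℚ.∣ z ∣ ℚ.≤ 1ℚ ℚ.+ ℚ.∣ a ∣) (split (seq x m) a)
    (ℚ.≤-trans (ℚ.∣p+q∣≤∣p∣+∣q∣ (seq x m ℚ.- a) a)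
      (ℚ.+-monoˡ-≤ ℚ.∣ a ∣ (ℚ.<⇒≤ (h m N p ℕ.≤-refl))))
  where
  a = seq x N
  split : ∀ p q → (p ℚ.- q) ℚ.+ q ≡ p
  split = solve 2 (λ p q → (p :- q) :+ q := p) refl

swap-bounded : ∀ {g} → Bounded g → Bounded (λ m n → g n m)
swap-bounded (B , B>0 , N , h) = B , B>0 , N , λ m n p q → h n m q p

fromTends0 : ∀ {x y} → Tends0 (λ m _ → seq x m ℚ.- seq y m) → x ≃ y
fromTends0 t = eq λ ε ε>0 → case t ε ε>0 of λ { (N , h) → N , λ n p → h n n p p }

toTends0 : ∀ {x y} → x ≃ y → Tends0 (λ m _ → seq x m ℚ.- seq y m)
toTends0 e ε ε>0 with gap e ε ε>0
... | N , h = N , λ m _ p _ → h m p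

diag-zero : ∀ p → ℚ.∣ p ℚ.- p ∣ ≡ 0ℚ
diag-zero p = cong ℚ.∣_∣ (ℚ.+-inverseʳ p)

constᴿ : ℚ → ℝ
seq (constᴿ q) _ = q
cauchy (constᴿ q) ε ε>0 = 0 , λ _ _ _ _ → subst (ℚ._< ε) (sym (diag-zero q)) ε>0

infixl 6 _+ᴿ_
infixl 7 _*ᴿ_
infix  8 -ᴿ_

_+ᴿ_ : ℝ → ℝ → ℝ
seq (x +ᴿ y) n = seq x n ℚ.+ seq y n
cauchy (x +ᴿ y) =
  resp0 (λ m n → rearr (seq x m) (seq x n) (seq y m) (seq y n)) (add0 (cauchy x) (cauchy y))
  where
  rearr : ∀ a b c d → (a ℚ.- b) ℚ.+ (c ℚ.- d) ≡ (a ℚ.+ c) ℚ.- (b ℚ.+ d)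
  rearr = solve 4 (λ a b c d → (a :- b) :+ (c :- d) := (a :+ c) :- (b :+ d)) refl

-ᴿ_ : ℝ → ℝ
seq (-ᴿ x) n = ℚ.- seq x n
cauchy (-ᴿ x) =
  resp0 (λ m n → rearr (seq x m) (seq x n)) (neg0 (cauchy x))
  where
  rearr : ∀ a b → ℚ.- (a ℚ.- b) ≡ (ℚ.- a) ℚ.- (ℚ.- b)
  rearr = solve 2 (λ a b → :- (a :- b) := (:- a) :- (:- b)) refl

_*ᴿ_ : ℝ → ℝ → ℝ
seq (x *ᴿ y) n = seq x n ℚ.* seq y n
cauchy (x *ᴿ y) =
  resp0 (λ m n → rearr (seq x m) (seq x n) (seq y m) (seq y n))
    (add0 (mul0 (bounded x) (cauchy y)) (mul0 (swap-bounded (bounded y)) (cauchy x)))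
  where
  rearr : ∀ a b c d → a ℚ.* (c ℚ.- d) ℚ.+ d ℚ.* (a ℚ.- b) ≡ a ℚ.* c ℚ.- b ℚ.* d
  rearr = solve 4 (λ a b c d → a :* (c :- d) :+ d :* (a :- b) := a :* c :- b :* d) refl

pointwise : ∀ {x y} → (∀ n → seq x n ≡ seq y n) → x ≃ y
pointwise {x} {y} h = eq λ ε ε>0 → 0 , λ n _ →
  subst (λ z → ℚ.∣ seq x n ℚ.- z ∣ ℚ.< ε) (h n) (subst (ℚ._< ε) (sym (diag-zero (seq x n))) ε>0)

≃-sym : ∀ {x y} → x ≃ y → y ≃ x
≃-sym {x} {y} e = fromTends0 (resp0 (λ m _ → rearr (seq x m) (seq y m)) (neg0 (toTends0 e)))
  where
  rearr : ∀ a b → ℚ.- (a ℚ.- b) ≡ b ℚ.- a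
  rearr = solve 2 (λ a b → :- (a :- b) := b :- a) refl

≃-trans : ∀ {x y z} → x ≃ y → y ≃ z → x ≃ z
≃-trans {x} {y} {z} e f = fromTends0
  (resp0 (λ m _ → rearr (seq x m) (seq y m) (seq z m)) (add0 (toTends0 e) (toTends0 f)))
  where
  rearr : ∀ a b c → (a ℚ.- b) ℚ.+ (b ℚ.- c) ≡ a ℚ.- c
  rearr = solve 3 (λ a b c → (a :- b) :+ (b :- c) := a :- c) refl

+ᴿ-cong : ∀ {x x′ y y′} → x ≃ x′ → y ≃ y′ → x +ᴿ y ≃ x′ +ᴿ y′
+ᴿ-cong {x} {x′} {y} {y′} e f = fromTends0
  (resp0 (λ m _ → rearr (seq x m) (seq x′ m) (seq y m) (seq y′ m)) (add0 (toTends0 e) (toTends0 f)))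
  where
  rearr : ∀ a b c d → (a ℚ.- b) ℚ.+ (c ℚ.- d) ≡ (a ℚ.+ c) ℚ.- (b ℚ.+ d)
  rearr = solve 4 (λ a b c d → (a :- b) :+ (c :- d) := (a :+ c) :- (b :+ d)) refl

-ᴿ-cong : ∀ {x x′} → x ≃ x′ → -ᴿ x ≃ -ᴿ x′
-ᴿ-cong {x} {x′} e = fromTends0 (resp0 (λ m _ → rearr (seq x m) (seq x′ m)) (neg0 (toTends0 e)))
  where
  rearr : ∀ a b → ℚ.- (a ℚ.- b) ≡ (ℚ.- a) ℚ.- (ℚ.- b)
  rearr = solve 2 (λ a b → :- (a :- b) := (:- a) :- (:- b)) refl

*ᴿ-cong : ∀ {x x′ y y′} → x ≃ x′ → y ≃ y′ → x *ᴿ y ≃ x′ *ᴿ y′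
*ᴿ-cong {x} {x′} {y} {y′} e f = fromTends0
  (resp0 (λ m _ → rearr (seq x m) (seq x′ m) (seq y m) (seq y′ m))
    (add0 (mul0 (bounded x) (toTends0 f)) (mul0 (bounded y′) (toTends0 e))))
  where
  rearr : ∀ a b c d → a ℚ.* (c ℚ.- d) ℚ.+ d ℚ.* (a ℚ.- b) ≡ a ℚ.* c ℚ.- b ℚ.* d
  rearr = solve 4 (λ a b c d → a :* (c :- d) :+ d :* (a :- b) := a :* c :- b :* d) refl

infix 4 _≈ᶜ_

record ℂ : Set where
  no-eta-equality
  field
    re im : ℝ

open ℂ public

record _≈ᶜ_ (z w : ℂ) : Set where
  constructor _,_
  field
    re-≃ : re z ≃ re w
    im-≃ : im z ≃ im w

open _≈ᶜ_ public

pointwiseᶜ : ∀ {z w} → (∀ n → seq (re z) n ≡ seq (re w) n) →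
             (∀ n → seq (im z) n ≡ seq (im w) n) → z ≈ᶜ w
pointwiseᶜ h k = pointwise h , pointwise k

infixl 6 _+ᶜ_ _-ᶜ_
infixl 7 _*ᶜ_
infix  8 -ᶜ_

0ᶜ 1ᶜ : ℂ
re 0ᶜ = constᴿ 0ℚ
im 0ᶜ = constᴿ 0ℚ
re 1ᶜ = constᴿ 1ℚ
im 1ᶜ = constᴿ 0ℚ

_+ᶜ_ _*ᶜ_ : ℂ → ℂ → ℂ
re (z +ᶜ w) = re z +ᴿ re w
im (z +ᶜ w) = im z +ᴿ im w
re (z *ᶜ w) = (re z *ᴿ re w) +ᴿ (-ᴿ (im z *ᴿ im w))
im (z *ᶜ w) = (re z *ᴿ im w) +ᴿ (im z *ᴿ re w)

-ᶜ_ : ℂ → ℂ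
re (-ᶜ z) = -ᴿ re z
im (-ᶜ z) = -ᴿ im z

_-ᶜ_ : ℂ → ℂ → ℂ
z -ᶜ w = z +ᶜ (-ᶜ w)

module ℚ-identities where
  open Data.Rational.Base using (_+_; _*_; -_)

  assoc-re : ∀ a b c d e f → (a * c + - (b * d)) * e + - ((a * d + b * c) * f) ≡ a * (c * e + - (d * f)) + - (b * (c * f + d * e))
  assoc-re = solve 6 (λ a b c d e f → (a :* c :+ :- (b :* d)) :* e :+ :- ((a :* d :+ b :* c) :* f) := a :* (c :* e :+ :- (d :* f)) :+ :- (b :* (c :* f :+ d :* e))) refl
  assoc-im : ∀ a b c d e f → (a * c + - (b * d)) * f + (a * d + b * c) * e ≡ a * (c * f + d * e) + b * (c * e + - (d * f))
  assoc-im = solve 6 (λ a b c d e f → (a :* c :+ :- (b :* d)) :* f :+ (a :* d :+ b :* c) :* e := a :* (c :* f :+ d :* e) :+ b :* (c :* e :+ :- (d :* f))) refl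
  idˡ-re : ∀ a b → 1ℚ * a + - (0ℚ * b) ≡ a
  idˡ-re = solve 2 (λ a b → con 1ℚ :* a :+ :- (con 0ℚ :* b) := a) refl
  idˡ-im : ∀ a b → 1ℚ * b + 0ℚ * a ≡ b
  idˡ-im = solve 2 (λ a b → con 1ℚ :* b :+ con 0ℚ :* a := b) refl
  idʳ-re : ∀ a b → a * 1ℚ + - (b * 0ℚ) ≡ a
  idʳ-re = solve 2 (λ a b → a :* con 1ℚ :+ :- (b :* con 0ℚ) := a) refl
  idʳ-im : ∀ a b → a * 0ℚ + b * 1ℚ ≡ b
  idʳ-im = solve 2 (λ a b → a :* con 0ℚ :+ b :* con 1ℚ := b) refl
  dˡ-re : ∀ a b c d e f → a * (c + e) + - (b * (d + f)) ≡ (a * c + - (b * d)) + (a * e + - (b * f))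
  dˡ-re = solve 6 (λ a b c d e f → a :* (c :+ e) :+ :- (b :* (d :+ f)) := (a :* c :+ :- (b :* d)) :+ (a :* e :+ :- (b :* f))) refl
  dˡ-im : ∀ a b c d e f → a * (d + f) + b * (c + e) ≡ (a * d + b * c) + (a * f + b * e)
  dˡ-im = solve 6 (λ a b c d e f → a :* (d :+ f) :+ b :* (c :+ e) := (a :* d :+ b :* c) :+ (a :* f :+ b :* e)) refl
  dʳ-re : ∀ a b c d e f → (c + e) * a + - ((d + f) * b) ≡ (c * a + - (d * b)) + (e * a + - (f * b))
  dʳ-re = solve 6 (λ a b c d e f → (c :+ e) :* a :+ :- ((d :+ f) :* b) := (c :* a :+ :- (d :* b)) :+ (e :* a :+ :- (f :* b))) refl
  dʳ-im : ∀ a b c d e f → (c + e) * b + (d + f) * a ≡ (c * b + d * a) + (e * b + f * a)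
  dʳ-im = solve 6 (λ a b c d e f → (c :+ e) :* b :+ (d :+ f) :* a := (c :* b :+ d :* a) :+ (e :* b :+ f :* a)) refl
  comm-re : ∀ a b c d → a * c + - (b * d) ≡ c * a + - (d * b)
  comm-re = solve 4 (λ a b c d → a :* c :+ :- (b :* d) := c :* a :+ :- (d :* b)) refl
  comm-im : ∀ a b c d → a * d + b * c ≡ c * b + d * a
  comm-im = solve 4 (λ a b c d → a :* d :+ b :* c := c :* b :+ d :* a) refl

open ℚ-identities

≈ᶜ-refl : ∀ {z} → z ≈ᶜ z
≈ᶜ-refl = pointwiseᶜ (λ _ → refl) (λ _ → refl)

+ᶜ-cong : ∀ {z z′ w w′} → z ≈ᶜ z′ → w ≈ᶜ w′ → z +ᶜ w ≈ᶜ z′ +ᶜ w′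
+ᶜ-cong e f = +ᴿ-cong (re-≃ e) (re-≃ f) , +ᴿ-cong (im-≃ e) (im-≃ f)

*ᶜ-cong : ∀ {z z′ w w′} → z ≈ᶜ z′ → w ≈ᶜ w′ → z *ᶜ w ≈ᶜ z′ *ᶜ w′
*ᶜ-cong e f =
    +ᴿ-cong (*ᴿ-cong (re-≃ e) (re-≃ f)) (-ᴿ-cong (*ᴿ-cong (im-≃ e) (im-≃ f)))
  , +ᴿ-cong (*ᴿ-cong (re-≃ e) (im-≃ f)) (*ᴿ-cong (im-≃ e) (re-≃ f))

+ᶜ-assoc : ∀ z w v → (z +ᶜ w) +ᶜ v ≈ᶜ z +ᶜ (w +ᶜ v)
+ᶜ-assoc z w v = pointwiseᶜ (λ n → ℚ.+-assoc (seq (re z) n) (seq (re w) n) (seq (re v) n)) (λ n → ℚ.+-assoc (seq (im z) n) (seq (im w) n) (seq (im v) n))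

+ᶜ-comm : ∀ z w → z +ᶜ w ≈ᶜ w +ᶜ z
+ᶜ-comm z w = pointwiseᶜ (λ n → ℚ.+-comm (seq (re z) n) (seq (re w) n)) (λ n → ℚ.+-comm (seq (im z) n) (seq (im w) n))

+ᶜ-identityˡ : ∀ z → 0ᶜ +ᶜ z ≈ᶜ z
+ᶜ-identityˡ z = pointwiseᶜ (λ n → ℚ.+-identityˡ (seq (re z) n)) (λ n → ℚ.+-identityˡ (seq (im z) n))

+ᶜ-identityʳ : ∀ z → z +ᶜ 0ᶜ ≈ᶜ z
+ᶜ-identityʳ z = pointwiseᶜ (λ n → ℚ.+-identityʳ (seq (re z) n)) (λ n → ℚ.+-identityʳ (seq (im z) n))

+ᶜ-inverseˡ : ∀ z → (-ᶜ z) +ᶜ z ≈ᶜ 0ᶜ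
+ᶜ-inverseˡ z = pointwiseᶜ (λ n → ℚ.+-inverseˡ (seq (re z) n)) (λ n → ℚ.+-inverseˡ (seq (im z) n))

+ᶜ-inverseʳ : ∀ z → z +ᶜ (-ᶜ z) ≈ᶜ 0ᶜ
+ᶜ-inverseʳ z = pointwiseᶜ (λ n → ℚ.+-inverseʳ (seq (re z) n)) (λ n → ℚ.+-inverseʳ (seq (im z) n))

*ᶜ-assoc : ∀ z w v → (z *ᶜ w) *ᶜ v ≈ᶜ z *ᶜ (w *ᶜ v)
*ᶜ-assoc z w v = pointwiseᶜ
  (λ n → assoc-re (seq (re z) n) (seq (im z) n) (seq (re w) n) (seq (im w) n) (seq (re v) n) (seq (im v) n))
  (λ n → assoc-im (seq (re z) n) (seq (im z) n) (seq (re w) n) (seq (im w) n) (seq (re v) n) (seq (im v) n))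

*ᶜ-identityˡ : ∀ z → 1ᶜ *ᶜ z ≈ᶜ z
*ᶜ-identityˡ z = pointwiseᶜ
  (λ n → idˡ-re (seq (re z) n) (seq (im z) n))
  (λ n → idˡ-im (seq (re z) n) (seq (im z) n))

*ᶜ-identityʳ : ∀ z → z *ᶜ 1ᶜ ≈ᶜ z
*ᶜ-identityʳ z = pointwiseᶜ
  (λ n → idʳ-re (seq (re z) n) (seq (im z) n))
  (λ n → idʳ-im (seq (re z) n) (seq (im z) n))

*ᶜ-distribˡ : ∀ z w v → z *ᶜ (w +ᶜ v) ≈ᶜ (z *ᶜ w) +ᶜ (z *ᶜ v)
*ᶜ-distribˡ z w v = pointwiseᶜ
  (λ n → dˡ-re (seq (re z) n) (seq (im z) n) (seq (re w) n) (seq (im w) n) (seq (re v) n) (seq (im v) n))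
  (λ n → dˡ-im (seq (re z) n) (seq (im z) n) (seq (re w) n) (seq (im w) n) (seq (re v) n) (seq (im v) n))

*ᶜ-distribʳ : ∀ z w v → (w +ᶜ v) *ᶜ z ≈ᶜ (w *ᶜ z) +ᶜ (v *ᶜ z)
*ᶜ-distribʳ z w v = pointwiseᶜ
  (λ n → dʳ-re (seq (re z) n) (seq (im z) n) (seq (re w) n) (seq (im w) n) (seq (re v) n) (seq (im v) n))
  (λ n → dʳ-im (seq (re z) n) (seq (im z) n) (seq (re w) n) (seq (im w) n) (seq (re v) n) (seq (im v) n))

*ᶜ-comm : ∀ z w → z *ᶜ w ≈ᶜ w *ᶜ z
*ᶜ-comm z w = pointwiseᶜ
  (λ n → comm-re (seq (re z) n) (seq (im z) n) (seq (re w) n) (seq (im w) n))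
  (λ n → comm-im (seq (re z) n) (seq (im z) n) (seq (re w) n) (seq (im w) n))

ℂ-commutativeRing : CommutativeRing 0ℓ 0ℓ
ℂ-commutativeRing = record
  { Carrier = ℂ
  ; _≈_ = _≈ᶜ_
  ; _+_ = _+ᶜ_
  ; _*_ = _*ᶜ_
  ; -_ = -ᶜ_
  ; 0# = 0ᶜ
  ; 1# = 1ᶜ
  ; isCommutativeRing = record
    { isRing = record
      { +-isAbelianGroup = record
        { isGroup = record
          { isMonoid = record
            { isSemigroup = record
              { isMagma = record
                { isEquivalence = record
                  { refl = ≈ᶜ-refl
                  ; sym = λ e → ≃-sym (re-≃ e) , ≃-sym (im-≃ e)
                  ; trans = λ e f → ≃-trans (re-≃ e) (re-≃ f) , ≃-trans (im-≃ e) (im-≃ f)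
                  }
                ; ∙-cong = +ᶜ-cong
                }
              ; assoc = +ᶜ-assoc
              }
            ; identity = +ᶜ-identityˡ , +ᶜ-identityʳ
            }
          ; inverse = +ᶜ-inverseˡ , +ᶜ-inverseʳ
          ; ⁻¹-cong = λ e → -ᴿ-cong (re-≃ e) , -ᴿ-cong (im-≃ e)
          }
        ; comm = +ᶜ-comm
        }
      ; *-cong = *ᶜ-cong
      ; *-assoc = *ᶜ-assoc
      ; *-identity = *ᶜ-identityˡ , *ᶜ-identityʳ
      ; distrib = *ᶜ-distribˡ , *ᶜ-distribʳ
      }
    ; *-comm = *ᶜ-comm
    }
  }

module ℂ-ring = CommutativeRing ℂ-commutativeRing

open MonoidSum ℂ-ring.+-commutativeMonoid using (sum)

fromℚ : ℚ → ℂ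
re (fromℚ q) = constᴿ q
im (fromℚ q) = constᴿ 0ℚ

fromℕ : ℕ → ℂ
fromℕ n = fromℚ (fromℤ (ℤ.+ n))

𝐢 : ℂ
re 𝐢 = constᴿ 0ℚ
im 𝐢 = constᴿ 1ℚ

X : ℕ → Set
X D = Vec (Fin 2) D

differences : ∀ {D} → X D → X D → ℕ
differences y z = count (λ (a , b) → ¬? (a ≟ᶠ b)) (zip y z)

Adjacent : ∀ {D} → X D → X D → Set
Adjacent y z = differences y z ≡ 1

adjacent? : ∀ {D} (y z : X D) → Dec (Adjacent y z)
adjacent? y z = differences y z ℕ.≟ 1

data Walk {D} : X D → X D → ℕ → Set where
  nil  : ∀ {y} → Walk y y 0
  step : ∀ {y z w n} → Adjacent y z → Walk z w n → Walk y w (suc n)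

IsDistance : ∀ {D} → X D → X D → ℕ → Set
IsDistance y z n = Walk y z n × (∀ m → Walk y z m → n ℕ.≤ m)

differences-∷ : ∀ {D} a (y z : X D) → differences (a ∷ y) (a ∷ z) ≡ differences y z
differences-∷ a y z with a ≟ᶠ a
... | yes _  = refl
... | no a≢a = contradiction refl a≢a

differences-refl : ∀ {D} (y : X D) → differences y y ≡ 0
differences-refl []      = refl
differences-refl (a ∷ y) = trans (differences-∷ a y y) (differences-refl y)

differences-triangle : ∀ {D} (x y z : X D) →
  differences x z ℕ.≤ differences x y ℕ.+ differences y z
differences-triangle [] [] [] = z≤n
differences-triangle (a ∷ x) (b ∷ y) (c ∷ z) with a ≟ᶠ c | a ≟ᶠ b | b ≟ᶠ c
... | yes _   | yes _    | yes _   = differences-triangle x y z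
... | yes _   | yes _    | no _    = ℕ.≤-trans (differences-triangle x y z) (ℕ.+-monoʳ-≤ (differences x y) (ℕ.n≤1+n _))
... | yes _   | no _     | yes _   = ℕ.m≤n⇒m≤1+n (differences-triangle x y z)
... | yes _   | no _     | no _    = ℕ.m≤n⇒m≤1+n (ℕ.≤-trans (differences-triangle x y z) (ℕ.+-monoʳ-≤ (differences x y) (ℕ.n≤1+n _)))
... | no a≢c  | yes refl | yes b≡c = contradiction b≡c a≢c
... | no _    | yes _    | no _    = subst (suc (differences x z) ℕ.≤_) (sym (ℕ.+-suc (differences x y) (differences y z))) (s≤s (differences-triangle x y z))
... | no _    | no _     | yes _   = s≤s (differences-triangle x y z)
... | no _    | no _     | no _    = s≤s (ℕ.≤-trans (differences-triangle x y z) (ℕ.+-monoʳ-≤ (differences x y) (ℕ.n≤1+n _)))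

walk-∷ : ∀ {D n} a {y z : X D} → Walk y z n → Walk (a ∷ y) (a ∷ z) n
walk-∷ a nil              = nil
walk-∷ a (step {y} {z} e w) = step (trans (differences-∷ a y z) e) (walk-∷ a w)

geodesic : ∀ {D} (y z : X D) → Walk y z (differences y z)
geodesic []      []      = nil
geodesic (a ∷ y) (b ∷ z) with a ≟ᶠ b
... | yes refl = walk-∷ a (geodesic y z)
... | no a≢b   = step adjacent (walk-∷ b (geodesic y z))
  where
  adjacent : Adjacent (a ∷ y) (b ∷ y)
  adjacent with a ≟ᶠ b
  ... | yes a≡b = contradiction a≡b a≢b
  ... | no _    = cong suc (differences-refl y)

differences-minimal : ∀ {D} {y z : X D} m → Walk y z m → differences y z ℕ.≤ m
differences-minimal {y = y} .0 nil = ℕ.≤-reflexive (differences-refl y)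
differences-minimal {z = z} (suc m) (step {y} {v} e w) =
  ℕ.≤-trans (differences-triangle y v z)
    (subst (λ k → k ℕ.+ differences v z ℕ.≤ suc m) (sym e) (s≤s (differences-minimal m w)))

distance : ∀ {D} (y z : X D) → ∃ (IsDistance y z)
distance y z = differences y z , geodesic y z , differences-minimal

-- Path-length distance; that counting differing coordinates computes it is
-- what distance proves.
∂ : ∀ {D} → X D → X D → ℕ
∂ y z = proj₁ (distance y z)

ΣX : ∀ {D} → (X D → ℂ) → ℂ
ΣX {zero}  f = f []
ΣX {suc D} f = ΣX (λ y → f (fzero ∷ y)) +ᶜ ΣX (λ y → f (fsuc fzero ∷ y))

V : ℕ → Set
V D = X D → ℂ

Mat : ℕ → Set
Mat D = X D → X D → ℂ

infix  4 _≈ⱽ_ _≈ᴹ_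
infixl 6 _+ⱽ_ _+ᴹ_ _-ᴹ_
infixr 7 _•ⱽ_ _•ᴹ_ _∙_
infixl 7 _*ᴹ_

_≈ⱽ_ : ∀ {D} → V D → V D → Set
v ≈ⱽ w = ∀ y → v y ≈ᶜ w y

0ⱽ : ∀ {D} → V D
0ⱽ y = 0ᶜ

_+ⱽ_ : ∀ {D} → V D → V D → V D
(v +ⱽ w) y = v y +ᶜ w y

_•ⱽ_ : ∀ {D} → ℂ → V D → V D
(c •ⱽ v) y = c *ᶜ v y

lincomb : ∀ {D n} → (Fin n → ℂ) → (Fin n → V D) → V D
lincomb c v y = sum (λ i → c i *ᶜ v i y)

_≈ᴹ_ : ∀ {D} → Mat D → Mat D → Set
M ≈ᴹ N = ∀ y z → M y z ≈ᶜ N y z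

diagonal : ∀ {D} → (X D → ℂ) → Mat D
diagonal f y z = if ⌊ ≡-dec _≟ᶠ_ y z ⌋ then f y else 0ᶜ

Id : ∀ {D} → Mat D
Id = diagonal (λ _ → 1ᶜ)

_+ᴹ_ _-ᴹ_ _*ᴹ_ : ∀ {D} → Mat D → Mat D → Mat D
(M +ᴹ N) y z = M y z +ᶜ N y z
(M -ᴹ N) y z = M y z -ᶜ N y z
(M *ᴹ N) y z = ΣX (λ w → M y w *ᶜ N w z)

_•ᴹ_ : ∀ {D} → ℂ → Mat D → Mat D
(c •ᴹ M) y z = c *ᶜ M y z

_∙_ : ∀ {D} → Mat D → V D → V D
(M ∙ v) y = ΣX (λ z → M y z *ᶜ v z)

kronecker : ∀ {D} → (Fin 2 → Fin 2 → ℂ) → Mat D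
kronecker M []      []      = 1ᶜ
kronecker M (a ∷ y) (b ∷ z) = M a b *ᶜ kronecker M y z

x₀ : ∀ {D} → X D
x₀ = replicate _ fzero

θ : ℕ → ℕ → ℚ
θ D i = fromℤ (ℤ.+ D ℤ.- ℤ.+ (2 ℕ.* i))

A : ∀ {D} → Mat D
A y z = if ⌊ adjacent? y z ⌋ then 1ᶜ else 0ᶜ

A* : ∀ {D} → Mat D
A* {D} = diagonal (λ y → fromℚ (θ D (∂ x₀ y)))

Aᵋ : ∀ {D} → Mat D
Aᵋ = (-ᶜ 𝐢 *ᶜ fromℚ ½) •ᴹ (A *ᴹ A* -ᴹ A* *ᴹ A)

data T {D} : Mat D → Set where
  A∈T   : T A
  A*∈T  : T A*
  Id∈T  : T Id
  +∈T   : ∀ {M N} → T M → T N → T (M +ᴹ N)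
  •∈T   : ∀ c {M} → T M → T (c •ᴹ M)
  *∈T   : ∀ {M N} → T M → T N → T (M *ᴹ N)
  ≈∈T   : ∀ {M N} → M ≈ᴹ N → T M → T N

θ-distinct : ∀ D {i j} → i ≢ j → ℚ.NonZero (θ D i ℚ.- θ D j)
θ-distinct D {i} {j} i≢j = ℚ.≢-nonZero λ θᵢ-θⱼ≡0 → i≢j
  (ℕ.*-cancelˡ-≡ i j 2 (ℤ.+-injective (ℤ.neg-injective (∙-cancelˡ (AbelianGroup.group ℤ.+-0-abelianGroup) (ℤ.+ D) _ _
    (cong ℚ.numerator (x∙y⁻¹≈ε⇒x≈y ℚ.+-0-group (θ D i) (θ D j) θᵢ-θⱼ≡0))))))

E-factor : ∀ {D} → ℕ → ℕ → Mat D
E-factor {D} i j with i ℕ.≟ j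
... | yes _  = Id
... | no i≢j = fromℚ ((ℚ.1/ (θ D i ℚ.- θ D j)) {{θ-distinct D i≢j}}) •ᴹ (A -ᴹ fromℚ (θ D j) •ᴹ Id)

-- The Lagrange product over 0 ≤ j ≤ D.  Only i ≤ D is meaningful: for i > D
-- the matrix E i, like E* i and Eᵋ i, is a junk value (equal to 0).
E : ∀ {D} → ℕ → Mat D
E {D} i = foldr _*ᴹ_ Id (map (E-factor i) (upTo (suc D)))

E* : ∀ {D} → ℕ → Mat D
E* i = diagonal (λ y → if ⌊ ∂ x₀ y ℕ.≟ i ⌋ then 1ᶜ else 0ᶜ)

P₁ P₁⁻¹ : Fin 2 → Fin 2 → ℂ
P₁ fzero        _            = 1ᶜ
P₁ (fsuc fzero) fzero        = -ᶜ 𝐢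
P₁ (fsuc fzero) (fsuc fzero) = 𝐢
P₁⁻¹ _            fzero        = fromℚ ½
P₁⁻¹ fzero        (fsuc fzero) = fromℚ ½ *ᶜ 𝐢
P₁⁻¹ (fsuc fzero) (fsuc fzero) = -ᶜ (fromℚ ½ *ᶜ 𝐢)

P P⁻¹ : ∀ {D} → Mat D
P   = kronecker P₁
P⁻¹ = kronecker P₁⁻¹

Eᵋ : ∀ {D} → ℕ → Mat D
Eᵋ i = P⁻¹ *ᴹ E i *ᴹ P

module Inverse where
  open ℂ-ring using (+-cong; *-cong; *-congˡ; *-congʳ; zeroˡ; zeroʳ; distribˡ; *-identityˡ)
  open import Relation.Binary.Reasoning.Setoid ℂ-ring.setoid
  open import Algebra.Properties.CommutativeSemigroup ℂ-ring.*-commutativeSemigroup using (interchange)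

  ΣX-cong : ∀ {D} {f g : X D → ℂ} → (∀ y → f y ≈ᶜ g y) → ΣX f ≈ᶜ ΣX g
  ΣX-cong {zero}  e = e []
  ΣX-cong {suc D} e = +-cong (ΣX-cong λ y → e (fzero ∷ y)) (ΣX-cong λ y → e (fsuc fzero ∷ y))

  ΣX-scale : ∀ {D} c (f : X D → ℂ) → ΣX (λ y → c *ᶜ f y) ≈ᶜ c *ᶜ ΣX f
  ΣX-scale {zero}  c f = ℂ-ring.refl
  ΣX-scale {suc D} c f = ℂ-ring.trans
    (+-cong (ΣX-scale c (λ y → f (fzero ∷ y))) (ΣX-scale c (λ y → f (fsuc fzero ∷ y))))
    (ℂ-ring.sym (distribˡ c _ _))

  mul₂ : (M N : Fin 2 → Fin 2 → ℂ) → Fin 2 → Fin 2 → ℂ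
  mul₂ M N a b = M a fzero *ᶜ N fzero b +ᶜ M a (fsuc fzero) *ᶜ N (fsuc fzero) b

  kronecker-* : ∀ {D} M N → kronecker {D} M *ᴹ kronecker N ≈ᴹ kronecker (mul₂ M N)
  kronecker-* M N []      []      = *-identityˡ 1ᶜ
  kronecker-* M N (a ∷ y) (b ∷ z) = ℂ-ring.trans (+-cong (block fzero) (block (fsuc fzero)))
    (ℂ-ring.sym (ℂ-ring.distribʳ _ _ _))
    where
    block : ∀ c → ΣX (λ w → (M a c *ᶜ kronecker M y w) *ᶜ (N c b *ᶜ kronecker N w z))
                ≈ᶜ (M a c *ᶜ N c b) *ᶜ kronecker (mul₂ M N) y z
    block c = begin
      ΣX (λ w → (M a c *ᶜ kronecker M y w) *ᶜ (N c b *ᶜ kronecker N w z))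
        ≈⟨ ΣX-cong (λ w → interchange (M a c) (kronecker M y w) (N c b) (kronecker N w z)) ⟩
      ΣX (λ w → (M a c *ᶜ N c b) *ᶜ (kronecker M y w *ᶜ kronecker N w z))
        ≈⟨ ΣX-scale (M a c *ᶜ N c b) (λ w → kronecker M y w *ᶜ kronecker N w z) ⟩
      (M a c *ᶜ N c b) *ᶜ (kronecker M *ᴹ kronecker N) y z
        ≈⟨ *-congˡ (kronecker-* M N y z) ⟩
      (M a c *ᶜ N c b) *ᶜ kronecker (mul₂ M N) y z ∎

  δ : Fin 2 → Fin 2 → ℂ
  δ a b = if ⌊ a ≟ᶠ b ⌋ then 1ᶜ else 0ᶜ

  kronecker-δ : ∀ {D M} → (∀ a b → M a b ≈ᶜ δ a b) → kronecker {D} M ≈ᴹ Id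
  kronecker-δ M≈δ []      []      = ℂ-ring.refl
  kronecker-δ M≈δ (a ∷ y) (b ∷ z) =
    ℂ-ring.trans (*-cong (M≈δ a b) (kronecker-δ M≈δ y z)) step-δ
    where
    step-δ : δ a b *ᶜ Id y z ≈ᶜ Id (a ∷ y) (b ∷ z)
    step-δ with a ≟ᶠ b
    ... | no _ = zeroˡ _
    ... | yes _ with ≡-dec _≟ᶠ_ y z
    ...   | yes _ = *-identityˡ 1ᶜ
    ...   | no _  = zeroʳ 1ᶜ

open Inverse

P*P⁻¹≈Id : ∀ {D} → P *ᴹ P⁻¹ ≈ᴹ Id {D}
P*P⁻¹≈Id y z = ℂ-ring.trans (kronecker-* P₁ P₁⁻¹ y z) (kronecker-δ P₁*P₁⁻¹ y z)
  where
  P₁*P₁⁻¹ : ∀ a b → mul₂ P₁ P₁⁻¹ a b ≈ᶜ δ a b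
  P₁*P₁⁻¹ fzero        fzero        = pointwiseᶜ (λ _ → refl) (λ _ → refl)
  P₁*P₁⁻¹ fzero        (fsuc fzero) = pointwiseᶜ (λ _ → refl) (λ _ → refl)
  P₁*P₁⁻¹ (fsuc fzero) fzero        = pointwiseᶜ (λ _ → refl) (λ _ → refl)
  P₁*P₁⁻¹ (fsuc fzero) (fsuc fzero) = pointwiseᶜ (λ _ → refl) (λ _ → refl)

P⁻¹*P≈Id : ∀ {D} → P⁻¹ *ᴹ P ≈ᴹ Id {D}
P⁻¹*P≈Id y z = ℂ-ring.trans (kronecker-* P₁⁻¹ P₁ y z) (kronecker-δ P₁⁻¹*P₁ y z)
  where
  P₁⁻¹*P₁ : ∀ a b → mul₂ P₁⁻¹ P₁ a b ≈ᶜ δ a b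
  P₁⁻¹*P₁ fzero        fzero        = pointwiseᶜ (λ _ → refl) (λ _ → refl)
  P₁⁻¹*P₁ fzero        (fsuc fzero) = pointwiseᶜ (λ _ → refl) (λ _ → refl)
  P₁⁻¹*P₁ (fsuc fzero) fzero        = pointwiseᶜ (λ _ → refl) (λ _ → refl)
  P₁⁻¹*P₁ (fsuc fzero) (fsuc fzero) = pointwiseᶜ (λ _ → refl) (λ _ → refl)

record IsSubspace {D} (W : Pred (V D) 0ℓ) : Set where
  field
    ≈-closed : ∀ {v w} → v ≈ⱽ w → v ∈ W → w ∈ W
    0-closed : 0ⱽ ∈ W
    +-closed : ∀ {v w} → v ∈ W → w ∈ W → v +ⱽ w ∈ W
    •-closed : ∀ c {v} → v ∈ W → c •ⱽ v ∈ W

IsTModule : ∀ {D} → Pred (V D) 0ℓ → Set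
IsTModule W = IsSubspace W × (∀ B → T B → ∀ {v} → v ∈ W → B ∙ v ∈ W)

IsNonzero : ∀ {D} → Pred (V D) 0ℓ → Set
IsNonzero W = ∃ λ v → v ∈ W × ¬ v ≈ⱽ 0ⱽ

-- "No T-modules inside W other than 0 and W" is read as "every nonzero
-- T-module inside W is all of W": classically the same, whereas asking for
-- a decision between U = 0 and U = W would presuppose excluded middle.
IsIrreducible : ∀ {D} → Pred (V D) 0ℓ → Set₁
IsIrreducible W = IsTModule W × IsNonzero W ×
  (∀ U → IsTModule U → U ⊆ W → IsNonzero U → W ⊆ U)

infix 9 _⟨_⟩

_⟨_⟩ : ∀ {D} → Mat D → Pred (V D) 0ℓ → Pred (V D) 0ℓ
(M ⟨ W ⟩) v = ∃ λ w → w ∈ W × v ≈ⱽ M ∙ w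

IsEndpoint : ∀ {D} → Pred (V D) 0ℓ → ℕ → Set
IsEndpoint {D} W r = r ℕ.≤ D × IsNonzero (E* r ⟨ W ⟩) ×
  (∀ i → i ℕ.≤ D → IsNonzero (E* i ⟨ W ⟩) → r ℕ.≤ i)

-- S is the set of all i ≤ D with E*ᵢW ≠ 0, and d = |S| - 1.
IsDiameter : ∀ {D} → Pred (V D) 0ℓ → ℕ → Set
IsDiameter {D} W d = Σ (Subset (suc D)) λ S →
  (∀ i → i ∈ˢ S ⇔ IsNonzero (E* (toℕ i) ⟨ W ⟩)) × ∣ S ∣ ≡ suc d

record IsBasis {D n} (W : Pred (V D) 0ℓ) (v : Fin n → V D) : Set where
  field
    members     : ∀ i → v i ∈ W
    independent : ∀ c → lincomb c v ≈ⱽ 0ⱽ → ∀ i → c i ≈ᶜ 0ᶜ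
    spanning    : ∀ {w} → w ∈ W → ∃ λ c → w ≈ⱽ lincomb c v

-- The matrix B represents Y with respect to the basis v of W; that v is a
-- basis of W is part of the assertion.
Represents : ∀ {D d} → (Fin (suc d) → Fin (suc d) → ℂ) → Mat D →
             Pred (V D) 0ℓ → (Fin (suc d) → V D) → Set
Represents B Y W v = IsBasis W v × (∀ j → Y ∙ v j ≈ⱽ lincomb (λ i → B i j) v)

tridiagonal : ∀ d → Fin (suc d) → Fin (suc d) → ℂ
tridiagonal d i j =
  if ⌊ toℕ i ℕ.≟ suc (toℕ j) ⌋ then -ᶜ (𝐢 *ᶜ fromℕ (toℕ i)) else
  if ⌊ suc (toℕ i) ℕ.≟ toℕ j ⌋ then 𝐢 *ᶜ fromℕ (d ∸ toℕ i) else
  0ᶜ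

{-# OPTIONS --safe #-}

-- Up to sign, A, A* and Aᵋ are the sums over the D tensor factors of V = (ℂ²)^⊗D
-- of the Pauli matrices acting in that factor, and
-- conjugation by P permutes them cyclically.  Let (X, Y, Z) be a cyclic
-- rotation of (A, A*, Aᵋ), let F k be the idempotents of Z, and let v be a
-- highest weight vector of weight θ_r for Y: Yv = θ_r v and (Z + 𝐢X)v = 0.
-- Put s = D − r.  Applying F k to Xv = 𝐢Zv and to Yv, and using that X ± 𝐢Y
-- shifts the index of F by one, gives for w k = F k v
--   (X + 𝐢Y) w (k+1) = 𝐢(θ_k − θ_s) w k,   (X − 𝐢Y) w k = 𝐢(θ_{k+1} − θ_r) w (k+1).
-- These recursions force w k = 0 outside r ≤ k ≤ s and w k ≠ 0 inside, they are
-- the columns of the tridiagonal matrix, and they show that the w k span a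
-- T-module, which is W by irreducibility; in particular F k W = 0 for k < r.
-- The definition of the endpoint makes u* a highest weight vector for A*.
-- Hence Eᵋₖ W = 0 for k < r and uᵋ is one for Aᵋ; hence Eₖ W = 0 for k < r
-- and u is one for A.  Finally E*ₖ W ≠ 0 exactly for r ≤ k ≤ s, so d = s − r.

module Submission where

open import Algebra.Bundles using (RawRing)
import Algebra.Properties.Semiring.Sum as SemiringSum
import Algebra.Solver.Ring
open import Algebra.Solver.Ring.AlmostCommutativeRing
  using (_-Raw-AlmostCommutative⟶_; fromCommutativeRing)
open import Data.Bool.Base using (if_then_else_)
open import Data.Fin.Base using (Fin; toℕ; fromℕ<) renaming (zero to fzero; suc to fsuc)
import Data.Fin.Properties as Fin
open import Data.Fin.Subset using (Subset; ∣_∣; inside; outside) renaming (_∈_ to _∈ˢ_)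
import Data.Integer.Base as ℤ
import Data.Integer.Properties as ℤ
import Data.Integer.Solver as ℤ
open import Data.List.Base using (List; []; _∷_; foldr; map; upTo)
open import Data.List.Membership.Propositional using () renaming (_∈_ to _∈ˡ_)
open import Data.List.Membership.Propositional.Properties using (∈-upTo⁺)
open import Data.List.Relation.Unary.Any using (here; there)
open import Data.Maybe.Base using (Maybe; just; nothing)
open import Data.Nat.Base as ℕ using (ℕ; zero; suc; NonZero; z≤n; s≤s; _+_; _∸_; _⊔_)
import Data.Nat.Properties as ℕ
open import Data.Product.Base using (∃; _×_; _,_; proj₁; proj₂)
open import Data.Rational.Base as ℚ using (ℚ; 0ℚ; 1ℚ; ½)
open import Data.Rational.Literals using (fromℤ)
import Data.Rational.Properties as ℚ
import Data.Rational.Solver as ℚ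
import Data.Rational.Unnormalised.Base as ℚᵘ
import Data.Rational.Unnormalised.Properties as ℚᵘ
open import Data.Sum.Base using (_⊎_; inj₁; inj₂)
open import Data.Vec.Base using ([]; _∷_; here; there)
open import Data.Vec.Properties using (≡-dec)
open import Function.Base using (_∘_)
open import Function.Bundles using (_⇔_; mk⇔; module Equivalence)
open import Level using (0ℓ)
open import Relation.Binary.PropositionalEquality
  using (_≡_; _≢_; refl; sym; trans; cong; cong₂; subst; subst₂)
open import Relation.Nullary using (¬_; Dec; yes; no; contradiction; ⌊_⌋)
open import Relation.Unary using (Pred; _⊆_; _∈_)
open import Defs
open Inverse using (ΣX-cong; ΣX-scale; mul₂)
open SemiringSum ℂ-ring.semiring using (sum; sum-cong-≋; ∑-distrib-+; *-distribˡ-sum)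
open import Relation.Binary.Reasoning.Setoid ℂ-ring.setoid

-- Zero, apartness and cancellation in ℝ and ℂ.

EventuallySmall ApartFrom0 : ℝ → Set
EventuallySmall x = ∀ ε → 0ℚ ℚ.< ε → ∃ λ N → ∀ n → N ℕ.≤ n → ℚ.∣ seq x n ∣ ℚ.< ε
ApartFrom0 x = ∃ λ η → 0ℚ ℚ.< η × ∃ λ N → ∀ n → N ℕ.≤ n → η ℚ.≤ ℚ.∣ seq x n ∣

0ᴿ : ℝ
0ᴿ = constᴿ 0ℚ

-0ℚ : ∀ p → p ℚ.- 0ℚ ≡ p
-0ℚ p = ℚ.+-identityʳ p

≃0⇒small : ∀ {x} → x ≃ 0ᴿ → EventuallySmall x
≃0⇒small {x} e ε ε>0 with gap e ε ε>0
... | N , h = N , λ n p → subst (λ z → ℚ.∣ z ∣ ℚ.< ε) (-0ℚ (seq x n)) (h n p)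

small⇒≃0 : ∀ {x} → EventuallySmall x → x ≃ 0ᴿ
small⇒≃0 {x} s = eq λ ε ε>0 → let N , h = s ε ε>0 in
  N , λ n p → subst (λ z → ℚ.∣ z ∣ ℚ.< ε) (sym (-0ℚ (seq x n))) (h n p)

apart⇒≄0 : ∀ {x} → ApartFrom0 x → ¬ x ≃ 0ᴿ
apart⇒≄0 {x} (η , η>0 , N , h) e with ≃0⇒small e η η>0
... | M , k = ℚ.<-irrefl refl (ℚ.≤-<-trans (h (M ⊔ N) (ℕ.m≤n⊔m M N)) (k (M ⊔ N) (ℕ.m≤m⊔n M N)))

-- Past the index `N` all terms lie within ε/4 of the rational `seq x N`, so the decidable
-- comparison of its absolute value with ε/2 settles the matter; the apartness bound is ε/4. This
-- dichotomy replaces excluded middle for reals.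
small-or-apart : ∀ x ε → 0ℚ ℚ.< ε →
  (∃ λ N → ∀ n → N ℕ.≤ n → ℚ.∣ seq x n ∣ ℚ.< ε) ⊎ ApartFrom0 x
small-or-apart x ε ε>0 with cauchy x δ (half>0 (half>0 ε>0))
  where δ = ½ ℚ.* (½ ℚ.* ε)
... | N , h with ℚ.∣ seq x N ∣ ℚ.<? ½ ℚ.* ε
...   | yes xN<½ε = inj₁ (N , λ n p → subst (ℚ.∣ seq x n ∣ ℚ.<_) (halve ε)
  (ℚ.≤-<-trans (subst (λ z → ℚ.∣ z ∣ ℚ.≤ ℚ.∣ seq x n ℚ.- seq x N ∣ ℚ.+ ℚ.∣ seq x N ∣)
      (telescope (seq x n) (seq x N)) (ℚ.∣p+q∣≤∣p∣+∣q∣ (seq x n ℚ.- seq x N) (seq x N)))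
    (ℚ.+-mono-< (ℚ.<-trans (h n N p ℕ.≤-refl) ½δ<δ) xN<½ε)))
  where
  open ℚ.+-*-Solver
  telescope : ∀ p q → (p ℚ.- q) ℚ.+ q ≡ p
  telescope = solve 2 (λ p q → (p :- q) :+ q := p) refl
  ½δ<δ : ½ ℚ.* (½ ℚ.* ε) ℚ.< ½ ℚ.* ε
  ½δ<δ = subst₂ ℚ._<_ (ℚ.+-identityʳ (½ ℚ.* (½ ℚ.* ε))) (halve (½ ℚ.* ε))
      (ℚ.+-monoʳ-< (½ ℚ.* (½ ℚ.* ε)) (half>0 (half>0 ε>0)))
...   | no xN≮½ε = inj₂ (δ , half>0 (half>0 ε>0) , N , λ n p → ℚ.≮⇒≥ λ xn<δ →
  xN≮½ε (subst₂ ℚ._<_ (cong ℚ.∣_∣ (telescope (seq x N) (seq x n))) (halve (½ ℚ.* ε))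
    (ℚ.≤-<-trans (ℚ.∣p+q∣≤∣p∣+∣q∣ (seq x N ℚ.- seq x n) (seq x n)) (ℚ.+-mono-< (h N n ℕ.≤-refl p) xn<δ))))
  where
  open ℚ.+-*-Solver
  δ = ½ ℚ.* (½ ℚ.* ε)
  telescope : ∀ p q → (p ℚ.- q) ℚ.+ q ≡ p
  telescope = solve 2 (λ p q → (p :- q) :+ q := p) refl

-- Apartness would refute `x ≃ 0ᴿ` outright, so `small-or-apart` leaves smallness at every ε.
≃0-stable : ∀ {x} → ¬ ¬ x ≃ 0ᴿ → x ≃ 0ᴿ
≃0-stable {x} ¬¬e = small⇒≃0 λ ε ε>0 → case-split ε ε>0 (small-or-apart x ε ε>0)
  where
  case-split : ∀ ε → 0ℚ ℚ.< ε → _ ⊎ ApartFrom0 x → _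
  case-split ε ε>0 (inj₁ s) = s
  case-split ε ε>0 (inj₂ a) = contradiction (apart⇒≄0 {x} a) ¬¬e

-- The hypothesis on `x` yields no positive lower bound for its terms. But if `y` were nonzero, `x`
-- could not be apart from 0, since apartness forces `y ≃ 0ᴿ`; so `x` would be small at every ε,
-- against the hypothesis.
*ᴿ-cancelˡ : ∀ {x y} → ¬ x ≃ 0ᴿ → x *ᴿ y ≃ 0ᴿ → y ≃ 0ᴿ
*ᴿ-cancelˡ {x} {y} x≄0 xy≃0 = ≃0-stable λ y≄0 → x≄0
    (small⇒≃0 λ ε ε>0 → case-split y≄0 (small-or-apart x ε ε>0))
  where
  apart⇒y≃0 : ApartFrom0 x → y ≃ 0ᴿ
  apart⇒y≃0 (η , η>0 , N , h) = small⇒≃0 λ ε ε>0 →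
    let M , k = ≃0⇒small xy≃0 (η ℚ.* ε) (ℚ.positive⁻¹ _ {{ℚ.pos*pos⇒pos η {{ℚ.positive η>0}} ε {{ℚ.positive ε>0}}}})
    in M ⊔ N , λ n p → ℚ.*-cancelˡ-<-nonNeg η {{ℚ.nonNegative (ℚ.<⇒≤ η>0)}}
      (ℚ.≤-<-trans
        (ℚ.*-monoʳ-≤-nonNeg ℚ.∣ seq y n ∣ {{ℚ.∣-∣-nonNeg (seq y n)}} (h n (ℕ.≤-trans (ℕ.m≤n⊔m M N) p)))
        (subst (ℚ._< η ℚ.* ε) (ℚ.∣p*q∣≡∣p∣*∣q∣ (seq x n) (seq y n)) (k n (ℕ.≤-trans (ℕ.m≤m⊔n M N) p))))
  case-split : ∀ {A : Set} → ¬ y ≃ 0ᴿ → A ⊎ ApartFrom0 x → A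
  case-split y≄0 (inj₁ s) = s
  case-split y≄0 (inj₂ a) = contradiction (apart⇒y≃0 a) y≄0

x²≃0⇒x≃0 : ∀ {x} → x *ᴿ x ≃ 0ᴿ → x ≃ 0ᴿ
x²≃0⇒x≃0 {x} e = ≃0-stable λ x≄0 → x≄0 (*ᴿ-cancelˡ x≄0 e)

x²+y²≃0⇒x≃0 : ∀ x y → x *ᴿ x +ᴿ y *ᴿ y ≃ 0ᴿ → x ≃ 0ᴿ
x²+y²≃0⇒x≃0 x y e = x²≃0⇒x≃0 (small⇒≃0 λ ε ε>0 → let N , h = ≃0⇒small e ε ε>0 in
  N , λ n p → ℚ.≤-<-trans (dominated (seq x n) (seq y n)) (h n p))
  where
  square : ∀ p → 0ℚ ℚ.≤ p ℚ.* p
  square p = subst (0ℚ ℚ.≤_) (∣p∣² p) (ℚ.nonNegative⁻¹ _ {{ℚ.nonNeg*nonNeg⇒nonNeg ℚ.∣ p ∣ {{ℚ.∣-∣-nonNeg p}} ℚ.∣ p ∣ {{ℚ.∣-∣-nonNeg p}}}})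
    where
    open ℚ.+-*-Solver
    ∣p∣² : ∀ p → ℚ.∣ p ∣ ℚ.* ℚ.∣ p ∣ ≡ p ℚ.* p
    ∣p∣² p with ℚ.∣p∣≡p∨∣p∣≡-p p
    ... | inj₁ ∣p∣≡p  = cong₂ ℚ._*_ ∣p∣≡p ∣p∣≡p
    ... | inj₂ ∣p∣≡-p = trans (cong₂ ℚ._*_ ∣p∣≡-p ∣p∣≡-p) (solve 1 (λ p → :- p :* :- p := p :* p) refl p)
  dominated : ∀ p q → ℚ.∣ p ℚ.* p ∣ ℚ.≤ ℚ.∣ p ℚ.* p ℚ.+ q ℚ.* q ∣
  dominated p q = subst₂ ℚ._≤_ (sym (ℚ.0≤p⇒∣p∣≡p (square p)))
    (sym (ℚ.0≤p⇒∣p∣≡p (ℚ.+-mono-≤ (square p) (square q))))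
    (subst (ℚ._≤ p ℚ.* p ℚ.+ q ℚ.* q) (ℚ.+-identityʳ (p ℚ.* p)) (ℚ.+-monoʳ-≤ (p ℚ.* p) (square q)))

≈0-stable : ∀ {z} → ¬ ¬ z ≈ᶜ 0ᶜ → z ≈ᶜ 0ᶜ
≈0-stable ¬¬e = ≃0-stable (λ ¬re → ¬¬e (¬re ∘ re-≃)) , ≃0-stable (λ ¬im → ¬¬e (¬im ∘ im-≃))

-- Multiplying by the conjugate of `z` turns the hypothesis into |z|² w = 0, and the real number
-- |z|² is nonzero, so it cancels from both components.
*ᶜ-cancelˡ : ∀ {z w} → ¬ z ≈ᶜ 0ᶜ → z *ᶜ w ≈ᶜ 0ᶜ → w ≈ᶜ 0ᶜ
*ᶜ-cancelˡ {z} {w} z≉0 (re≃0 , im≃0) =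
    *ᴿ-cancelˡ norm≄0 (≃-trans (pointwise λ n → norm-re (seq a n) (seq b n) (seq c n) (seq d n))
      (≃-trans (+ᴿ-cong (*ᴿ-cong a≃a re≃0) (*ᴿ-cong b≃b im≃0)) (pointwise λ n → zeros₊ (seq a n) (seq b n))))
  , *ᴿ-cancelˡ norm≄0 (≃-trans (pointwise λ n → norm-im (seq a n) (seq b n) (seq c n) (seq d n))
      (≃-trans (+ᴿ-cong (*ᴿ-cong a≃a im≃0) (-ᴿ-cong (*ᴿ-cong b≃b re≃0)))
          (pointwise λ n → zeros₋ (seq a n) (seq b n))))
  where
  open ℚ.+-*-Solver
  a = re z; b = im z; c = re w; d = im w
  a≃a : a ≃ a
  a≃a = pointwise λ _ → refl
  b≃b : b ≃ b
  b≃b = pointwise λ _ → refl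
  norm≄0 : ¬ a *ᴿ a +ᴿ b *ᴿ b ≃ 0ᴿ
  norm≄0 e = z≉0 (x²+y²≃0⇒x≃0 a b e , x²+y²≃0⇒x≃0 b a
    (≃-trans (pointwise λ n → ℚ.+-comm (seq b n ℚ.* seq b n) (seq a n ℚ.* seq a n)) e))
  norm-re : ∀ a b c d → (a ℚ.* a ℚ.+ b ℚ.* b) ℚ.* c ≡
    a ℚ.* (a ℚ.* c ℚ.+ ℚ.- (b ℚ.* d)) ℚ.+ b ℚ.* (a ℚ.* d ℚ.+ b ℚ.* c)
  norm-re = solve 4 (λ a b c d → (a :* a :+ b :* b) :* c :=
    a :* (a :* c :+ :- (b :* d)) :+ b :* (a :* d :+ b :* c)) refl
  norm-im : ∀ a b c d → (a ℚ.* a ℚ.+ b ℚ.* b) ℚ.* d ≡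
    a ℚ.* (a ℚ.* d ℚ.+ b ℚ.* c) ℚ.+ ℚ.- (b ℚ.* (a ℚ.* c ℚ.+ ℚ.- (b ℚ.* d)))
  norm-im = solve 4 (λ a b c d → (a :* a :+ b :* b) :* d :=
    a :* (a :* d :+ b :* c) :+ :- (b :* (a :* c :+ :- (b :* d)))) refl
  zeros₊ : ∀ a b → a ℚ.* 0ℚ ℚ.+ b ℚ.* 0ℚ ≡ 0ℚ
  zeros₊ = solve 2 (λ a b → a :* con 0ℚ :+ b :* con 0ℚ := con 0ℚ) refl
  zeros₋ : ∀ a b → a ℚ.* 0ℚ ℚ.+ ℚ.- (b ℚ.* 0ℚ) ≡ 0ℚ
  zeros₋ = solve 2 (λ a b → a :* con 0ℚ :+ :- (b :* con 0ℚ) := con 0ℚ) refl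

-- The eigenvalues D - 2i and exact arithmetic in ℂ.

fromℤ-+ : ∀ a b → fromℤ a ℚ.+ fromℤ b ≡ fromℤ (a ℤ.+ b)
fromℤ-+ a b = ℚ.toℚᵘ-injective (ℚᵘ.≃-trans (ℚ.toℚᵘ-homo-+ (fromℤ a) (fromℤ b))
  (ℚᵘ.*≡* (cong (ℤ._* ℤ.+ 1) (cong₂ ℤ._+_ (ℤ.*-identityʳ a) (ℤ.*-identityʳ b)))))

fromℚ-+ : ∀ p q → fromℚ (p ℚ.+ q) ≈ᶜ fromℚ p +ᶜ fromℚ q
fromℚ-+ p q = pointwiseᶜ (λ _ → refl) (λ _ → refl)

fromℤᶜ : ℤ.ℤ → ℂ
fromℤᶜ a = fromℚ (fromℤ a)

fromℤᶜ-+ : ∀ a b → fromℤᶜ (a ℤ.+ b) ≈ᶜ fromℤᶜ a +ᶜ fromℤᶜ b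
fromℤᶜ-+ a b = ℂ-ring.trans (ℂ-ring.reflexive (cong fromℚ (sym (fromℤ-+ a b)))) (fromℚ-+ (fromℤ a) (fromℤ b))

θᶜ : ℕ → ℕ → ℂ
θᶜ D i = fromℚ (θ D i)

θ-suc-D : ∀ D i → θᶜ (suc D) i ≈ᶜ 1ᶜ +ᶜ θᶜ D i
θ-suc-D D i = ℂ-ring.trans (ℂ-ring.reflexive (cong fromℤᶜ (ℤ.+-assoc (ℤ.+ 1) (ℤ.+ D) (ℤ.- (ℤ.+ (2 ℕ.* i))))))
  (ℂ-ring.trans (fromℤᶜ-+ (ℤ.+ 1) _) (ℂ-ring.+-congʳ (pointwiseᶜ (λ _ → refl) (λ _ → refl))))

-- The gap 2k is written as k + k so that the factor ½ in the decomposition of `X` into `raise` and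
-- `lower` cancels by ring arithmetic.
θ-+ : ∀ D i k → θᶜ D i ≈ᶜ θᶜ D (i ℕ.+ k) +ᶜ (fromℕ k +ᶜ fromℕ k)
θ-+ D i k = ℂ-ring.trans (ℂ-ring.reflexive (cong fromℤᶜ identity))
  (ℂ-ring.trans (fromℤᶜ-+ _ (ℤ.+ k ℤ.+ ℤ.+ k)) (ℂ-ring.+-congˡ (fromℤᶜ-+ (ℤ.+ k) (ℤ.+ k))))
  where
  open ℤ.+-*-Solver
  identity : ℤ.+ D ℤ.- ℤ.+ (2 ℕ.* i) ≡ (ℤ.+ D ℤ.- ℤ.+ (2 ℕ.* (i ℕ.+ k))) ℤ.+ (ℤ.+ k ℤ.+ ℤ.+ k)
  identity rewrite ℤ.pos-* 2 i | ℤ.pos-* 2 (i ℕ.+ k) | ℤ.pos-+ i k =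
    solve 3 (λ D i k → D :- con (ℤ.+ 2) :* i := (D :- con (ℤ.+ 2) :* (i :+ k)) :+ (k :+ k)) refl (ℤ.+ D)
        (ℤ.+ i) (ℤ.+ k)

-- For D = r + s the indices `r` and `s` are mirror images in a spectrum symmetric about 0; the two
-- eigenvalues are s - r and r - s.
θ-antisymmetric : ∀ r s → θᶜ (r ℕ.+ s) r ≈ᶜ -ᶜ θᶜ (r ℕ.+ s) s
θ-antisymmetric r s = ℂ-ring.trans (ℂ-ring.reflexive (cong fromℤᶜ identity))
    (pointwiseᶜ (λ _ → fromℤ-neg _) (λ _ → refl))
  where
  open ℤ.+-*-Solver
  fromℤ-neg : ∀ a → fromℤ (ℤ.- a) ≡ ℚ.- fromℤ a
  fromℤ-neg (ℤ.+ zero)   = refl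
  fromℤ-neg (ℤ.+ suc n)  = refl
  fromℤ-neg (ℤ.-[1+ n ]) = refl
  identity : ℤ.+ (r ℕ.+ s) ℤ.- ℤ.+ (2 ℕ.* r) ≡ ℤ.- (ℤ.+ (r ℕ.+ s) ℤ.- ℤ.+ (2 ℕ.* s))
  identity rewrite ℤ.pos-* 2 r | ℤ.pos-* 2 s | ℤ.pos-+ r s =
    solve 2 (λ r s → (r :+ s) :- con (ℤ.+ 2) :* r := :- ((r :+ s) :- con (ℤ.+ 2) :* s)) refl (ℤ.+ r) (ℤ.+ s)

-- The ring solver for ℂ takes its coefficients in ℚ[𝐢]; `embed` is chosen so
-- that the constants 0ᶜ, 1ᶜ, 𝐢 and fromℚ q are definitionally in its image.
private
  Gaussian : RawRing 0ℓ 0ℓ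
  Gaussian = record
    { Carrier = ℚ × ℚ
    ; _≈_ = _≡_
    ; _+_ = λ (a , b) (c , d) → a ℚ.+ c , b ℚ.+ d
    ; _*_ = λ (a , b) (c , d) → a ℚ.* c ℚ.+ ℚ.- (b ℚ.* d) , a ℚ.* d ℚ.+ b ℚ.* c
    ; -_ = λ (a , b) → ℚ.- a , ℚ.- b
    ; 0# = 0ℚ , 0ℚ
    ; 1# = 1ℚ , 0ℚ
    }

  gaussian : ℚ → ℚ → ℂ
  re (gaussian a b) = constᴿ a
  im (gaussian a b) = constᴿ b

embed : ℚ × ℚ → ℂ
embed (a , b) with b ℚ.≟ 0ℚ | a ℚ.≟ 0ℚ | a ℚ.≟ 1ℚ | b ℚ.≟ 1ℚ
... | yes _ | yes _ | _     | _     = 0ᶜ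
... | yes _ | no _  | yes _ | _     = 1ᶜ
... | yes _ | no _  | no _  | _     = fromℚ a
... | no _  | yes _ | _     | yes _ = 𝐢
... | no _  | yes _ | _     | no _  = gaussian a b
... | no _  | no _  | _     | _     = gaussian a b

embed≈ : ∀ z → embed z ≈ᶜ gaussian (proj₁ z) (proj₂ z)
embed≈ (a , b) with b ℚ.≟ 0ℚ | a ℚ.≟ 0ℚ | a ℚ.≟ 1ℚ | b ℚ.≟ 1ℚ
... | yes refl | yes refl | _        | _        = pointwiseᶜ (λ _ → refl) (λ _ → refl)
... | yes refl | no _     | yes refl | _        = pointwiseᶜ (λ _ → refl) (λ _ → refl)
... | yes refl | no _     | no _     | _        = pointwiseᶜ (λ _ → refl) (λ _ → refl)
... | no _     | yes refl | _        | yes refl = pointwiseᶜ (λ _ → refl) (λ _ → refl)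
... | no _     | yes _    | _        | no _     = pointwiseᶜ (λ _ → refl) (λ _ → refl)
... | no _     | no _     | _        | _        = pointwiseᶜ (λ _ → refl) (λ _ → refl)

private
  embed-morphism : Gaussian -Raw-AlmostCommutative⟶ fromCommutativeRing ℂ-commutativeRing
  embed-morphism = record
    { ⟦_⟧ = embed
    ; +-homo = λ z w → ℂ-ring.trans (embed≈ _) (ℂ-ring.trans (pointwiseᶜ (λ _ → refl) (λ _ → refl))
        (ℂ-ring.sym (+ᶜ-cong (embed≈ z) (embed≈ w))))
    ; *-homo = λ z w → ℂ-ring.trans (embed≈ _) (ℂ-ring.trans (pointwiseᶜ (λ _ → refl) (λ _ → refl))
        (ℂ-ring.sym (*ᶜ-cong (embed≈ z) (embed≈ w))))
    ; -‿homo = λ z → ℂ-ring.trans (embed≈ _) (ℂ-ring.trans (pointwiseᶜ (λ _ → refl) (λ _ → refl))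
        (ℂ-ring.sym (ℂ-ring.-‿cong (embed≈ z))))
    ; 0-homo = ≈ᶜ-refl
    ; 1-homo = ≈ᶜ-refl
    }

  embed-≟ : ∀ z w → Maybe (embed z ≈ᶜ embed w)
  embed-≟ (a , b) (c , d) with a ℚ.≟ c | b ℚ.≟ d
  ... | yes refl | yes refl = just ≈ᶜ-refl
  ... | _        | _        = nothing

module ℂ-solver = Algebra.Solver.Ring Gaussian (fromCommutativeRing ℂ-commutativeRing) embed-morphism embed-≟
open ℂ-solver using (solve; _:=_; _:+_; _:*_; :-_; _:-_; con)

:𝐢 :½ :0 :1 : ∀ {n} → ℂ-solver.Polynomial n
:𝐢 = con (0ℚ , 1ℚ)
:½ = con (½ , 0ℚ)
:0 = con (0ℚ , 0ℚ)
:1 = con (1ℚ , 0ℚ)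

-- Sums over the cube and the action of matrices on vectors.

if-⇔ : ∀ {P Q A : Set} (P? : Dec P) (Q? : Dec Q) {a b : A} → (P → Q) → (Q → P) →
       (if ⌊ P? ⌋ then a else b) ≡ (if ⌊ Q? ⌋ then a else b)
if-⇔ (yes _) (yes _)  _   _   = refl
if-⇔ (no _)  (no _)   _   _   = refl
if-⇔ (yes p) (no ¬q)  p⇒q _   = contradiction (p⇒q p) ¬q
if-⇔ (no ¬p) (yes q)  _   q⇒p = contradiction (q⇒p q) ¬p

ΣX-+ : ∀ {D} (f g : X D → ℂ) → ΣX (λ y → f y +ᶜ g y) ≈ᶜ ΣX f +ᶜ ΣX g
ΣX-+ {zero}  f g = ≈ᶜ-refl
ΣX-+ {suc D} f g = ℂ-ring.trans (ℂ-ring.+-cong (ΣX-+ (f ∘ (fzero ∷_)) (g ∘ (fzero ∷_)))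
    (ΣX-+ (f ∘ (fsuc fzero ∷_)) (g ∘ (fsuc fzero ∷_))))
  (solve 4 (λ a b c d → (a :+ b) :+ (c :+ d) := (a :+ c) :+ (b :+ d)) ≈ᶜ-refl _ _ _ _)

ΣX-0 : ∀ {D} → ΣX {D} (λ _ → 0ᶜ) ≈ᶜ 0ᶜ
ΣX-0 {zero}  = ≈ᶜ-refl
ΣX-0 {suc D} = ℂ-ring.trans (ℂ-ring.+-cong (ΣX-0 {D}) (ΣX-0 {D})) (+ᶜ-identityˡ 0ᶜ)

ΣX-swap : ∀ {D D′} (f : X D → X D′ → ℂ) → ΣX (λ y → ΣX (f y)) ≈ᶜ ΣX (λ z → ΣX (λ y → f y z))
ΣX-swap {zero}  f = ≈ᶜ-refl
ΣX-swap {suc D} f = ℂ-ring.trans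
  (ℂ-ring.+-cong (ΣX-swap (f ∘ (fzero ∷_))) (ΣX-swap (f ∘ (fsuc fzero ∷_))))
  (ℂ-ring.sym (ΣX-+ (λ z → ΣX (λ y → f (fzero ∷ y) z)) (λ z → ΣX (λ y → f (fsuc fzero ∷ y) z))))

module _ {D : ℕ} where
  ≈ⱽ-refl : {v : V D} → v ≈ⱽ v
  ≈ⱽ-refl y = ≈ᶜ-refl

  ≈ⱽ-sym : {v w : V D} → v ≈ⱽ w → w ≈ⱽ v
  ≈ⱽ-sym e y = ℂ-ring.sym (e y)

  ≈ⱽ-trans : {u v w : V D} → u ≈ⱽ v → v ≈ⱽ w → u ≈ⱽ w
  ≈ⱽ-trans e f y = ℂ-ring.trans (e y) (f y)

  +ⱽ-cong : {v v′ w w′ : V D} → v ≈ⱽ v′ → w ≈ⱽ w′ → v +ⱽ w ≈ⱽ v′ +ⱽ w′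
  +ⱽ-cong e f y = ℂ-ring.+-cong (e y) (f y)

  •ⱽ-congʳ : ∀ c {v w : V D} → v ≈ⱽ w → c •ⱽ v ≈ⱽ c •ⱽ w
  •ⱽ-congʳ c e y = ℂ-ring.*-congˡ (e y)

  •ⱽ-congˡ : ∀ {b c} {v : V D} → b ≈ᶜ c → b •ⱽ v ≈ⱽ c •ⱽ v
  •ⱽ-congˡ e y = ℂ-ring.*-congʳ e

  •ⱽ-0 : ∀ c → c •ⱽ 0ⱽ {D} ≈ⱽ 0ⱽ
  •ⱽ-0 c y = ℂ-ring.zeroʳ c

  ∙-congʳ : (M : Mat D) {v w : V D} → v ≈ⱽ w → M ∙ v ≈ⱽ M ∙ w
  ∙-congʳ M e y = ΣX-cong λ z → ℂ-ring.*-congˡ (e z)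

  ∙-congˡ : {M N : Mat D} → M ≈ᴹ N → (v : V D) → M ∙ v ≈ⱽ N ∙ v
  ∙-congˡ e v y = ΣX-cong λ z → ℂ-ring.*-congʳ (e y z)

  ∙-+ : (M : Mat D) (v w : V D) → M ∙ (v +ⱽ w) ≈ⱽ M ∙ v +ⱽ M ∙ w
  ∙-+ M v w y = ℂ-ring.trans (ΣX-cong λ z → ℂ-ring.distribˡ (M y z) (v z) (w z))
      (ΣX-+ (λ z → M y z *ᶜ v z) (λ z → M y z *ᶜ w z))

  ∙-• : (M : Mat D) (c : ℂ) (v : V D) → M ∙ (c •ⱽ v) ≈ⱽ c •ⱽ (M ∙ v)
  ∙-• M c v y = ℂ-ring.trans
    (ΣX-cong λ z → solve 3 (λ m c v → m :* (c :* v) := c :* (m :* v)) ≈ᶜ-refl (M y z) c (v z))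
    (ΣX-scale c (λ z → M y z *ᶜ v z))

  ∙-0 : (M : Mat D) → M ∙ 0ⱽ ≈ⱽ 0ⱽ
  ∙-0 M y = ℂ-ring.trans (ΣX-cong λ z → ℂ-ring.zeroʳ (M y z)) (ΣX-0 {D})

  ∙-≈0 : (M : Mat D) {v : V D} → v ≈ⱽ 0ⱽ → M ∙ v ≈ⱽ 0ⱽ
  ∙-≈0 M e = ≈ⱽ-trans (∙-congʳ M e) (∙-0 M)

  *ᴹ-∙ : (M N : Mat D) (v : V D) → (M *ᴹ N) ∙ v ≈ⱽ M ∙ (N ∙ v)
  *ᴹ-∙ M N v y = begin
    ΣX (λ z → ΣX (λ w → M y w *ᶜ N w z) *ᶜ v z)
      ≈⟨ ΣX-cong (λ z → ℂ-ring.trans (ℂ-ring.*-comm _ _) (ℂ-ring.trans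
           (ℂ-ring.sym (ΣX-scale (v z) (λ w → M y w *ᶜ N w z)))
           (ΣX-cong λ w → solve 3 (λ m n v → v :* (m :* n) := m :* (n :* v)) ≈ᶜ-refl (M y w) (N w z)
               (v z)))) ⟩
    ΣX (λ z → ΣX (λ w → M y w *ᶜ (N w z *ᶜ v z)))
      ≈⟨ ΣX-swap (λ z w → M y w *ᶜ (N w z *ᶜ v z)) ⟩
    ΣX (λ w → ΣX (λ z → M y w *ᶜ (N w z *ᶜ v z)))
      ≈⟨ ΣX-cong (λ w → ΣX-scale (M y w) (λ z → N w z *ᶜ v z)) ⟩
    ΣX (λ w → M y w *ᶜ ΣX (λ z → N w z *ᶜ v z)) ∎

  +ᴹ-∙ : (M N : Mat D) (v : V D) → (M +ᴹ N) ∙ v ≈ⱽ M ∙ v +ⱽ N ∙ v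
  +ᴹ-∙ M N v y = ℂ-ring.trans (ΣX-cong λ z → ℂ-ring.distribʳ (v z) (M y z) (N y z))
      (ΣX-+ (λ z → M y z *ᶜ v z) (λ z → N y z *ᶜ v z))

  •ᴹ-∙ : (c : ℂ) (M : Mat D) (v : V D) → (c •ᴹ M) ∙ v ≈ⱽ c •ⱽ (M ∙ v)
  •ᴹ-∙ c M v y = ℂ-ring.trans (ΣX-cong λ z → ℂ-ring.*-assoc c (M y z) (v z)) (ΣX-scale c (λ z → M y z *ᶜ v z))

  -ᴹ-∙ : (M N : Mat D) (v : V D) → (M -ᴹ N) ∙ v ≈ⱽ M ∙ v +ⱽ (-ᶜ 1ᶜ) •ⱽ (N ∙ v)
  -ᴹ-∙ M N v y = begin
    ΣX (λ z → (M y z -ᶜ N y z) *ᶜ v z)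
      ≈⟨ ΣX-cong (λ z → solve 3 (λ m n v → (m :- n) :* v := m :* v :+ :- :1 :* (n :* v)) ≈ᶜ-refl (M y z)
          (N y z) (v z)) ⟩
    ΣX (λ z → M y z *ᶜ v z +ᶜ (-ᶜ 1ᶜ) *ᶜ (N y z *ᶜ v z))
      ≈⟨ ΣX-+ (λ z → M y z *ᶜ v z) (λ z → (-ᶜ 1ᶜ) *ᶜ (N y z *ᶜ v z)) ⟩
    (M ∙ v) y +ᶜ ΣX (λ z → (-ᶜ 1ᶜ) *ᶜ (N y z *ᶜ v z))
      ≈⟨ ℂ-ring.+-congˡ (ΣX-scale (-ᶜ 1ᶜ) (λ z → N y z *ᶜ v z)) ⟩
    (M ∙ v) y +ᶜ (-ᶜ 1ᶜ) *ᶜ (N ∙ v) y ∎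

-- Equality may come as any decidable relation equivalent to it: diagonal matrices test `≡-dec`,
-- while an off-diagonal block of `A` tests `suc (differences y z) ℕ.≟ 1`.
ΣX-δ : ∀ {D} {P : X D → X D → Set} (P? : ∀ y z → Dec (P y z)) →
       (∀ {y z} → P y z → y ≡ z) → (∀ y → P y y) → ∀ (c : ℂ) (v : V D) y →
       ΣX (λ z → (if ⌊ P? y z ⌋ then c else 0ᶜ) *ᶜ v z) ≈ᶜ c *ᶜ v y
ΣX-δ P? P⇒≡ P-refl c v y = ℂ-ring.trans (ΣX-cong entry) (at y v)
  where
  entry : ∀ z → _ ≈ᶜ (if ⌊ ≡-dec Fin._≟_ y z ⌋ then c else 0ᶜ) *ᶜ v z
  entry z = ℂ-ring.reflexive (cong (_*ᶜ v z) (if-⇔ (P? y z) (≡-dec Fin._≟_ y z) P⇒≡ (λ { refl → P-refl y })))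
  none : ∀ {D} (v : V D) → ΣX (λ z → 0ᶜ *ᶜ v z) ≈ᶜ 0ᶜ
  none {D} v = ℂ-ring.trans (ΣX-cong λ z → ℂ-ring.zeroˡ (v z)) (ΣX-0 {D})
  cons : ∀ {D} a (y : X D) (v : V D) →
    ΣX (λ z → (if ⌊ ≡-dec Fin._≟_ (a ∷ y) (a ∷ z) ⌋ then c else 0ᶜ) *ᶜ v z) ≈ᶜ
    ΣX (λ z → (if ⌊ ≡-dec Fin._≟_ y z ⌋ then c else 0ᶜ) *ᶜ v z)
  cons a y v = ΣX-cong λ z → ℂ-ring.reflexive (cong (_*ᶜ v z)
    (if-⇔ (≡-dec Fin._≟_ (a ∷ y) (a ∷ z)) (≡-dec Fin._≟_ y z) (λ { refl → refl }) (λ { refl → refl })))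
  at : ∀ {D} (y : X D) (v : V D) → ΣX (λ z → (if ⌊ ≡-dec Fin._≟_ y z ⌋ then c else 0ᶜ) *ᶜ v z) ≈ᶜ c *ᶜ v y
  at []                v = ≈ᶜ-refl
  at (fzero ∷ y)       v = ℂ-ring.trans (ℂ-ring.+-cong
      (ℂ-ring.trans (cons fzero y (v ∘ (fzero ∷_))) (at y (v ∘ (fzero ∷_)))) (none (v ∘ (fsuc fzero ∷_))))
      (+ᶜ-identityʳ _)
  at (fsuc fzero ∷ y)  v = ℂ-ring.trans (ℂ-ring.+-cong (none (v ∘ (fzero ∷_)))
      (ℂ-ring.trans (cons (fsuc fzero) y (v ∘ (fsuc fzero ∷_))) (at y (v ∘ (fsuc fzero ∷_)))))
      (+ᶜ-identityˡ _)

diagonal-∙ : ∀ {D} (f : X D → ℂ) (v : V D) y → (diagonal f ∙ v) y ≈ᶜ f y *ᶜ v y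
diagonal-∙ f v y = ΣX-δ (≡-dec Fin._≟_) (λ e → e) (λ _ → refl) (f y) v y

Id-∙ : ∀ {D} (v : V D) → Id ∙ v ≈ⱽ v
Id-∙ v y = ℂ-ring.trans (diagonal-∙ (λ _ → 1ᶜ) v y) (*ᶜ-identityˡ (v y))

-- Operators summed over the tensor factors; Pauli matrices.

Mat₂ : Set
Mat₂ = Fin 2 → Fin 2 → ℂ

mat₂ : ℂ → ℂ → ℂ → ℂ → Mat₂
mat₂ a b c d fzero        fzero        = a
mat₂ a b c d fzero        (fsuc fzero) = b
mat₂ a b c d (fsuc fzero) fzero        = c
mat₂ a b c d (fsuc fzero) (fsuc fzero) = d

-- The action of Σₖ 1 ⊗ ⋯ ⊗ M ⊗ ⋯ ⊗ 1 (M in position k) on V = (ℂ²)^⊗D.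
Δ : Mat₂ → ∀ {D} → V D → V D
Δ M {zero}  v []      = 0ᶜ
Δ M {suc D} v (a ∷ y) = Δ M (v ∘ (a ∷_)) y +ᶜ (M a fzero *ᶜ v (fzero ∷ y) +ᶜ M a (fsuc fzero) *ᶜ v
    (fsuc fzero ∷ y))

Δ-cong : ∀ {D M N} → (∀ a b → M a b ≈ᶜ N a b) → {v w : V D} → v ≈ⱽ w → Δ M v ≈ⱽ Δ N w
Δ-cong M≈N e []      = ≈ᶜ-refl
Δ-cong M≈N e (a ∷ y) = ℂ-ring.+-cong (Δ-cong M≈N (e ∘ (a ∷_)) y)
  (ℂ-ring.+-cong (ℂ-ring.*-cong (M≈N a fzero) (e (fzero ∷ y)))
      (ℂ-ring.*-cong (M≈N a (fsuc fzero)) (e (fsuc fzero ∷ y))))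

Δ-congʳ : ∀ {D} M {v w : V D} → v ≈ⱽ w → Δ M v ≈ⱽ Δ M w
Δ-congʳ M = Δ-cong (λ a b → ≈ᶜ-refl)

Δ-linear : ∀ {D} M b c (v w : V D) → Δ M (b •ⱽ v +ⱽ c •ⱽ w) ≈ⱽ b •ⱽ Δ M v +ⱽ c •ⱽ Δ M w
Δ-linear M b c v w []      = solve 2 (λ b c → :0 := b :* :0 :+ c :* :0) ≈ᶜ-refl b c
Δ-linear M b c v w (a ∷ y) = ℂ-ring.trans (ℂ-ring.+-congʳ (Δ-linear M b c (v ∘ (a ∷_)) (w ∘ (a ∷_)) y))
  (solve 10 (λ b c sv sw m n v₀ v₁ w₀ w₁ →
      b :* sv :+ c :* sw :+ (m :* (b :* v₀ :+ c :* w₀) :+ n :* (b :* v₁ :+ c :* w₁)) :=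
      b :* (sv :+ (m :* v₀ :+ n :* v₁)) :+ c :* (sw :+ (m :* w₀ :+ n :* w₁)))
    ≈ᶜ-refl b c _ _ (M a fzero) (M a (fsuc fzero)) (v (fzero ∷ y)) (v (fsuc fzero ∷ y)) (w (fzero ∷ y))
        (w (fsuc fzero ∷ y)))

Δ-linearˡ : ∀ {D} M N b c (v : V D) → Δ (λ i j → b *ᶜ M i j +ᶜ c *ᶜ N i j) v ≈ⱽ b •ⱽ Δ M v +ⱽ c •ⱽ Δ N v
Δ-linearˡ M N b c v []      = solve 2 (λ b c → :0 := b :* :0 :+ c :* :0) ≈ᶜ-refl b c
Δ-linearˡ M N b c v (a ∷ y) = ℂ-ring.trans (ℂ-ring.+-congʳ (Δ-linearˡ M N b c (v ∘ (a ∷_)) y))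
  (solve 10 (λ b c sv sw m n m′ n′ v₀ v₁ →
      b :* sv :+ c :* sw :+ ((b :* m :+ c :* m′) :* v₀ :+ (b :* n :+ c :* n′) :* v₁) :=
      b :* (sv :+ (m :* v₀ :+ n :* v₁)) :+ c :* (sw :+ (m′ :* v₀ :+ n′ :* v₁)))
    ≈ᶜ-refl b c _ _ (M a fzero) (M a (fsuc fzero)) (N a fzero) (N a (fsuc fzero)) (v (fzero ∷ y))
        (v (fsuc fzero ∷ y)))

commutator : Mat₂ → Mat₂ → Mat₂
commutator M N a b = mul₂ M N a b -ᶜ mul₂ N M a b

-- Actions in different tensor factors commute, so only the terms with both matrices in the same
-- factor survive; the mixed terms cancel in `collect`.
Δ-commutator : ∀ {D} M N (v : V D) → Δ M (Δ N v) +ⱽ (-ᶜ 1ᶜ) •ⱽ Δ N (Δ M v) ≈ⱽ Δ (commutator M N) v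
Δ-commutator M N v [] = solve 0 (:0 :+ :- :1 :* :0 := :0) ≈ᶜ-refl
Δ-commutator M N v (a ∷ y) = begin
  Δ M (Δ N v ∘ (a ∷_)) y +ᶜ (M a fzero *ᶜ (N₀ +ᶜ n₀) +ᶜ M a (fsuc fzero) *ᶜ (N₁ +ᶜ n₁))
  +ᶜ (-ᶜ 1ᶜ) *ᶜ (Δ N (Δ M v ∘ (a ∷_)) y +ᶜ (N a fzero *ᶜ (M₀ +ᶜ m₀) +ᶜ N a (fsuc fzero) *ᶜ (M₁ +ᶜ m₁)))
    ≈⟨ ℂ-ring.+-cong (ℂ-ring.+-congʳ (expand M N)) (ℂ-ring.*-congˡ (ℂ-ring.+-congʳ (expand N M))) ⟩
  (MN +ᶜ (N a fzero *ᶜ M₀ +ᶜ N a (fsuc fzero) *ᶜ M₁)) +ᶜ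
      (M a fzero *ᶜ (N₀ +ᶜ n₀) +ᶜ M a (fsuc fzero) *ᶜ (N₁ +ᶜ n₁))
  +ᶜ (-ᶜ 1ᶜ) *ᶜ ((NM +ᶜ (M a fzero *ᶜ N₀ +ᶜ M a (fsuc fzero) *ᶜ N₁)) +ᶜ
      (N a fzero *ᶜ (M₀ +ᶜ m₀) +ᶜ N a (fsuc fzero) *ᶜ (M₁ +ᶜ m₁)))
    ≈⟨ collect ⟩
  (MN +ᶜ (-ᶜ 1ᶜ) *ᶜ NM) +ᶜ (commutator M N a fzero *ᶜ v₀ +ᶜ commutator M N a (fsuc fzero) *ᶜ v₁)
    ≈⟨ ℂ-ring.+-congʳ (Δ-commutator M N (v ∘ (a ∷_)) y) ⟩
  Δ (commutator M N) v (a ∷ y) ∎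
  where
  v₀ = v (fzero ∷ y)
  v₁ = v (fsuc fzero ∷ y)
  M₀ = Δ M (v ∘ (fzero ∷_)) y
  M₁ = Δ M (v ∘ (fsuc fzero ∷_)) y
  N₀ = Δ N (v ∘ (fzero ∷_)) y
  N₁ = Δ N (v ∘ (fsuc fzero ∷_)) y
  m₀ = M fzero fzero *ᶜ v₀ +ᶜ M fzero (fsuc fzero) *ᶜ v₁
  m₁ = M (fsuc fzero) fzero *ᶜ v₀ +ᶜ M (fsuc fzero) (fsuc fzero) *ᶜ v₁
  n₀ = N fzero fzero *ᶜ v₀ +ᶜ N fzero (fsuc fzero) *ᶜ v₁
  n₁ = N (fsuc fzero) fzero *ᶜ v₀ +ᶜ N (fsuc fzero) (fsuc fzero) *ᶜ v₁
  MN = Δ M (Δ N (v ∘ (a ∷_))) y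
  NM = Δ N (Δ M (v ∘ (a ∷_))) y
  expand : ∀ M N → Δ M (Δ N v ∘ (a ∷_)) y ≈ᶜ Δ M (Δ N (v ∘ (a ∷_))) y +ᶜ
    (N a fzero *ᶜ Δ M (v ∘ (fzero ∷_)) y +ᶜ N a (fsuc fzero) *ᶜ Δ M (v ∘ (fsuc fzero ∷_)) y)
  expand M N = begin
    Δ M (Δ N v ∘ (a ∷_)) y
      ≈⟨ Δ-congʳ M (λ z → solve 2 (λ p q → p :+ q := :1 :* p :+ :1 :* q) ≈ᶜ-refl _ _) y ⟩
    Δ M (1ᶜ •ⱽ Δ N (v ∘ (a ∷_)) +ⱽ 1ᶜ •ⱽ (N a fzero •ⱽ (v ∘ (fzero ∷_)) +ⱽ N a (fsuc fzero) •ⱽ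
        (v ∘ (fsuc fzero ∷_)))) y
      ≈⟨ Δ-linear M 1ᶜ 1ᶜ (Δ N (v ∘ (a ∷_))) _ y ⟩
    1ᶜ *ᶜ Δ M (Δ N (v ∘ (a ∷_))) y +ᶜ 1ᶜ *ᶜ Δ M
        (N a fzero •ⱽ (v ∘ (fzero ∷_)) +ⱽ N a (fsuc fzero) •ⱽ (v ∘ (fsuc fzero ∷_))) y
      ≈⟨ ℂ-ring.+-cong (*ᶜ-identityˡ _) (ℂ-ring.trans (*ᶜ-identityˡ _)
          (Δ-linear M _ _ (v ∘ (fzero ∷_)) (v ∘ (fsuc fzero ∷_)) y)) ⟩
    Δ M (Δ N (v ∘ (a ∷_))) y +ᶜ (N a fzero *ᶜ Δ M (v ∘ (fzero ∷_)) y +ᶜ N a (fsuc fzero) *ᶜ Δ M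
        (v ∘ (fsuc fzero ∷_)) y) ∎
  collect = solve 20 (λ MN NM M₀ M₁ N₀ N₁ ma₀ ma₁ na₀ na₁ m₀₀ m₀₁ m₁₀ m₁₁ n₀₀ n₀₁ n₁₀ n₁₁ v₀ v₁ →
      (MN :+ (na₀ :* M₀ :+ na₁ :* M₁)) :+ (ma₀ :* (N₀ :+ (n₀₀ :* v₀ :+ n₀₁ :* v₁)) :+ ma₁ :*
          (N₁ :+ (n₁₀ :* v₀ :+ n₁₁ :* v₁)))
      :+ (:- :1) :* ((NM :+ (ma₀ :* N₀ :+ ma₁ :* N₁)) :+
          (na₀ :* (M₀ :+ (m₀₀ :* v₀ :+ m₀₁ :* v₁)) :+ na₁ :* (M₁ :+ (m₁₀ :* v₀ :+ m₁₁ :* v₁))))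
      := (MN :+ (:- :1) :* NM) :+
         (((ma₀ :* n₀₀ :+ ma₁ :* n₁₀) :- (na₀ :* m₀₀ :+ na₁ :* m₁₀)) :* v₀ :+
          ((ma₀ :* n₀₁ :+ ma₁ :* n₁₁) :- (na₀ :* m₀₁ :+ na₁ :* m₁₁)) :* v₁))
    ≈ᶜ-refl MN NM M₀ M₁ N₀ N₁ (M a fzero) (M a (fsuc fzero)) (N a fzero) (N a (fsuc fzero))
      (M fzero fzero) (M fzero (fsuc fzero)) (M (fsuc fzero) fzero) (M (fsuc fzero) (fsuc fzero))
      (N fzero fzero) (N fzero (fsuc fzero)) (N (fsuc fzero) fzero) (N (fsuc fzero) (fsuc fzero)) v₀ v₁

-- Diagonal operators that depend on the distance alone. `A*`, the `E* k` and the Lagrange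
-- polynomials in `A*` all have this form, so their identities become identities of functions on 0,
-- ..., D.
weigh : ∀ {D} → (ℕ → ℂ) → V D → V D
weigh f v y = f (∂ x₀ y) *ᶜ v y

-- `σᵋ` is the negative of the usual Pauli matrix σ_y, since -(𝐢/2)[σx, σz] = -σ_y.
σx σz σᵋ : Mat₂
σx = mat₂ 0ᶜ 1ᶜ 1ᶜ 0ᶜ
σz = mat₂ 1ᶜ 0ᶜ 0ᶜ (-ᶜ 1ᶜ)
σᵋ = mat₂ 0ᶜ 𝐢 (-ᶜ 𝐢) 0ᶜ

differences≡0⇒≡ : ∀ {D} (y z : X D) → differences y z ≡ 0 → y ≡ z
differences≡0⇒≡ []      []      _ = refl
differences≡0⇒≡ (a ∷ y) (b ∷ z) e with a Fin.≟ b
... | yes refl = cong (a ∷_) (differences≡0⇒≡ y z e)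

-- By the first coordinate `A` falls into four blocks: the adjacency matrix of the smaller cube on
-- the diagonal and the identity off it. This is the recursion of `Δ σx`.
A-∙ : ∀ {D} (v : V D) → A ∙ v ≈ⱽ Δ σx v
A-∙ v []                = ℂ-ring.zeroˡ (v [])
A-∙ v (fzero ∷ y)       = ℂ-ring.trans
  (ℂ-ring.+-cong (A-∙ (v ∘ (fzero ∷_)) y)
    (ΣX-δ (λ y z → suc (differences y z) ℕ.≟ 1) (λ {y} {z} e → differences≡0⇒≡ y z (ℕ.suc-injective e))
        (λ y → cong suc (differences-refl y)) 1ᶜ (v ∘ (fsuc fzero ∷_)) y))
  (ℂ-ring.+-congˡ (solve 2 (λ v₀ v₁ → :1 :* v₁ := :0 :* v₀ :+ :1 :* v₁) ≈ᶜ-refl _ _))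
A-∙ v (fsuc fzero ∷ y)  = ℂ-ring.trans
  (ℂ-ring.+-cong
    (ΣX-δ (λ y z → suc (differences y z) ℕ.≟ 1) (λ {y} {z} e → differences≡0⇒≡ y z (ℕ.suc-injective e))
        (λ y → cong suc (differences-refl y)) 1ᶜ (v ∘ (fzero ∷_)) y)
    (A-∙ (v ∘ (fsuc fzero ∷_)) y))
  (solve 3 (λ s v₀ v₁ → :1 :* v₀ :+ s := s :+ (:1 :* v₀ :+ :0 :* v₁)) ≈ᶜ-refl _ (v (fzero ∷ y))
      (v (fsuc fzero ∷ y)))

A*-weigh : ∀ {D} (v : V D) → A* ∙ v ≈ⱽ weigh (θᶜ D) v
A*-weigh {D} v = diagonal-∙ (λ y → θᶜ D (∂ x₀ y)) v

-- A new coordinate 0 raises the eigenvalue by 1; with a new coordinate 1 the distance also grows by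
-- one, and the net change is -1. These are the diagonal entries of `σz`.
weigh-θ : ∀ {D} (v : V D) → weigh (θᶜ D) v ≈ⱽ Δ σz v
weigh-θ v []                       = ℂ-ring.trans (ℂ-ring.*-congʳ (pointwiseᶜ (λ _ → refl) (λ _ → refl)))
    (ℂ-ring.zeroˡ (v []))
weigh-θ {suc D} v (fzero ∷ y)      = begin
  θᶜ (suc D) n *ᶜ v₀      ≈⟨ ℂ-ring.*-congʳ (θ-suc-D D n) ⟩
  (1ᶜ +ᶜ θᶜ D n) *ᶜ v₀    ≈⟨ solve 3 (λ t v₀ v₁ → (:1 :+ t) :* v₀ := t :* v₀ :+
      (:1 :* v₀ :+ :0 :* v₁)) ≈ᶜ-refl _ _ v₁ ⟩
  θᶜ D n *ᶜ v₀ +ᶜ (1ᶜ *ᶜ v₀ +ᶜ 0ᶜ *ᶜ v₁) ≈⟨ ℂ-ring.+-congʳ (weigh-θ (v ∘ (fzero ∷_)) y) ⟩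
  Δ σz v (fzero ∷ y)      ∎
  where
  n = ∂ x₀ y
  v₀ = v (fzero ∷ y)
  v₁ = v (fsuc fzero ∷ y)
weigh-θ {suc D} v (fsuc fzero ∷ y) = begin
  θᶜ (suc D) (suc n) *ᶜ v₁   ≈⟨ ℂ-ring.*-congʳ (θ-suc-D D (suc n)) ⟩
  (1ᶜ +ᶜ θᶜ D (suc n)) *ᶜ v₁ ≈⟨ solve 3 (λ t v₀ v₁ → (:1 :+ t) :* v₁ := (t :+ (:1 :+ :1)) :* v₁ :+
      (:0 :* v₀ :+ :- :1 :* v₁)) ≈ᶜ-refl _ v₀ v₁ ⟩
  (θᶜ D (suc n) +ᶜ (1ᶜ +ᶜ 1ᶜ)) *ᶜ v₁ +ᶜ (0ᶜ *ᶜ v₀ +ᶜ -ᶜ 1ᶜ *ᶜ v₁) ≈⟨ ℂ-ring.+-congʳ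
      (ℂ-ring.*-congʳ (ℂ-ring.trans next (ℂ-ring.sym (θ-+ D n 1)))) ⟩
  θᶜ D n *ᶜ v₁ +ᶜ (0ᶜ *ᶜ v₀ +ᶜ -ᶜ 1ᶜ *ᶜ v₁) ≈⟨ ℂ-ring.+-congʳ (weigh-θ (v ∘ (fsuc fzero ∷_)) y) ⟩
  Δ σz v (fsuc fzero ∷ y)    ∎
  where
  n = ∂ x₀ y
  v₀ = v (fzero ∷ y)
  v₁ = v (fsuc fzero ∷ y)
  next : θᶜ D (suc n) +ᶜ (1ᶜ +ᶜ 1ᶜ) ≈ᶜ θᶜ D (n ℕ.+ 1) +ᶜ (fromℕ 1 +ᶜ fromℕ 1)
  next = ℂ-ring.+-cong (ℂ-ring.reflexive (cong (θᶜ D) (sym (ℕ.+-comm n 1))))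
      (pointwiseᶜ (λ _ → refl) (λ _ → refl))

A*-∙ : ∀ {D} (v : V D) → A* ∙ v ≈ⱽ Δ σz v
A*-∙ v = ≈ⱽ-trans (A*-weigh v) (weigh-θ v)

Aᵋ-∙ : ∀ {D} (v : V D) → Aᵋ ∙ v ≈ⱽ Δ σᵋ v
Aᵋ-∙ v y = begin
  (Aᵋ ∙ v) y                                                     ≈⟨ •ᴹ-∙ c (A *ᴹ A* -ᴹ A* *ᴹ A) v y ⟩
  c *ᶜ ((A *ᴹ A* -ᴹ A* *ᴹ A) ∙ v) y                              ≈⟨ ℂ-ring.*-congˡ
      (-ᴹ-∙ (A *ᴹ A*) (A* *ᴹ A) v y) ⟩
  c *ᶜ (((A *ᴹ A*) ∙ v) y +ᶜ (-ᶜ 1ᶜ) *ᶜ ((A* *ᴹ A) ∙ v) y)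
    ≈⟨ ℂ-ring.*-congˡ (ℂ-ring.+-cong
         (≈ⱽ-trans (*ᴹ-∙ A A* v) (≈ⱽ-trans (∙-congʳ A (A*-∙ v)) (A-∙ (Δ σz v))) y)
         (ℂ-ring.*-congˡ (≈ⱽ-trans (*ᴹ-∙ A* A v) (≈ⱽ-trans (∙-congʳ A* (A-∙ v)) (A*-∙ (Δ σx v))) y))) ⟩
  c *ᶜ (Δ σx (Δ σz v) y +ᶜ (-ᶜ 1ᶜ) *ᶜ Δ σz (Δ σx v) y)            ≈⟨ ℂ-ring.*-congˡ (Δ-commutator σx σz v y) ⟩
  -- The zero summand brings the multiple of `K` into the two-term shape of `Δ-linearˡ`.
  c *ᶜ Δ K v y                                                   ≈⟨ solve 2
      (λ c d → c :* d := c :* d :+ :0 :* d) ≈ᶜ-refl c _ ⟩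
  c *ᶜ Δ K v y +ᶜ 0ᶜ *ᶜ Δ K v y                                  ≈⟨ Δ-linearˡ K K c 0ᶜ v y ⟨
  Δ (λ a b → c *ᶜ K a b +ᶜ 0ᶜ *ᶜ K a b) v y                      ≈⟨ Δ-cong entries ≈ⱽ-refl y ⟩
  Δ σᵋ v y                                                       ∎
  where
  c = -ᶜ 𝐢 *ᶜ fromℚ ½
  K = commutator σx σz
  entries : ∀ a b → c *ᶜ K a b +ᶜ 0ᶜ *ᶜ K a b ≈ᶜ σᵋ a b
  entries fzero        fzero        = pointwiseᶜ (λ _ → refl) (λ _ → refl)
  entries fzero        (fsuc fzero) = pointwiseᶜ (λ _ → refl) (λ _ → refl)
  entries (fsuc fzero) fzero        = pointwiseᶜ (λ _ → refl) (λ _ → refl)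
  entries (fsuc fzero) (fsuc fzero) = pointwiseᶜ (λ _ → refl) (λ _ → refl)

-- The operator collects the values of `v` at neighbours one step farther from `x₀`, where the
-- weight is `f` at the successor. The weight is arbitrary because the induction replaces `f` by
-- `f ∘ suc` below a coordinate 1.
Δ-upper : ∀ {D} c f (v : V D) → Δ (mat₂ 0ᶜ c 0ᶜ 0ᶜ) (weigh f v) ≈ⱽ weigh (f ∘ suc) (Δ (mat₂ 0ᶜ c 0ᶜ 0ᶜ) v)
Δ-upper c f v []               = ℂ-ring.sym (ℂ-ring.zeroʳ _)
Δ-upper c f v (fzero ∷ y)      = ℂ-ring.trans (ℂ-ring.+-congʳ (Δ-upper c f (v ∘ (fzero ∷_)) y))
  (solve 6 (λ c s f₀ f₁ v₀ v₁ → f₁ :* s :+ (:0 :* (f₀ :* v₀) :+ c :* (f₁ :* v₁)) := f₁ :*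
      (s :+ (:0 :* v₀ :+ c :* v₁))) ≈ᶜ-refl c _ (f (∂ x₀ y)) (f (suc (∂ x₀ y))) _ _)
Δ-upper c f v (fsuc fzero ∷ y) = ℂ-ring.trans (ℂ-ring.+-congʳ (Δ-upper c (f ∘ suc) (v ∘ (fsuc fzero ∷_)) y))
  (solve 6 (λ s f₀ f₁ f₂ v₀ v₁ → f₂ :* s :+ (:0 :* (f₀ :* v₀) :+ :0 :* (f₁ :* v₁)) := f₂ :*
      (s :+ (:0 :* v₀ :+ :0 :* v₁))) ≈ᶜ-refl _ (f (∂ x₀ y)) (f (suc (∂ x₀ y))) (f (suc (suc (∂ x₀ y)))) _ _)

-- Here values come from neighbours one step nearer to `x₀`. Putting `suc` on the input weight
-- avoids a predecessor at distance 0.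
Δ-lower : ∀ {D} c f (v : V D) → Δ (mat₂ 0ᶜ 0ᶜ c 0ᶜ) (weigh (f ∘ suc) v) ≈ⱽ weigh f (Δ (mat₂ 0ᶜ 0ᶜ c 0ᶜ) v)
Δ-lower c f v []               = ℂ-ring.sym (ℂ-ring.zeroʳ _)
Δ-lower c f v (fzero ∷ y)      = ℂ-ring.trans (ℂ-ring.+-congʳ (Δ-lower c f (v ∘ (fzero ∷_)) y))
  (solve 6 (λ s f₀ f₁ f₂ v₀ v₁ → f₀ :* s :+ (:0 :* (f₁ :* v₀) :+ :0 :* (f₂ :* v₁)) := f₀ :*
      (s :+ (:0 :* v₀ :+ :0 :* v₁))) ≈ᶜ-refl _ (f (∂ x₀ y)) (f (suc (∂ x₀ y))) (f (suc (suc (∂ x₀ y)))) _ _)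
Δ-lower c f v (fsuc fzero ∷ y) = ℂ-ring.trans (ℂ-ring.+-congʳ (Δ-lower c (f ∘ suc) (v ∘ (fsuc fzero ∷_)) y))
  (solve 6 (λ c s f₁ f₂ v₀ v₁ → f₁ :* s :+ (c :* (f₁ :* v₀) :+ :0 :* (f₂ :* v₁)) := f₁ :*
      (s :+ (c :* v₀ :+ :0 :* v₁))) ≈ᶜ-refl c _ (f (suc (∂ x₀ y))) (f (suc (suc (∂ x₀ y)))) _ _)

kronecker-∷ : ∀ {D} K (v : V (suc D)) a y → (kronecker K ∙ v) (a ∷ y) ≈ᶜ
  K a fzero *ᶜ (kronecker K ∙ (v ∘ (fzero ∷_))) y +ᶜ K a (fsuc fzero) *ᶜ
      (kronecker K ∙ (v ∘ (fsuc fzero ∷_))) y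
kronecker-∷ K v a y = ℂ-ring.+-cong (half fzero) (half (fsuc fzero))
  where
  half : ∀ b → ΣX (λ z → (K a b *ᶜ kronecker K y z) *ᶜ v (b ∷ z)) ≈ᶜ K a b *ᶜ (kronecker K ∙ (v ∘ (b ∷_))) y
  half b = ℂ-ring.trans (ΣX-cong λ z → *ᶜ-assoc (K a b) (kronecker K y z) (v (b ∷ z)))
      (ΣX-scale (K a b) (λ z → kronecker K y z *ᶜ v (b ∷ z)))

-- A term acting in one factor meets `K` there and is turned by K M = N K. The first factor uses
-- this hypothesis, the others the induction.
kronecker-Δ : ∀ {D} K M N → (∀ a b → mul₂ K M a b ≈ᶜ mul₂ N K a b) →
  (v : V D) → kronecker K ∙ Δ M v ≈ⱽ Δ N (kronecker K ∙ v)
kronecker-Δ K M N KM≈NK v []      = ℂ-ring.zeroʳ 1ᶜ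
kronecker-Δ K M N KM≈NK v (a ∷ y) = begin
  (kronecker K ∙ Δ M v) (a ∷ y)
    ≈⟨ kronecker-∷ K (Δ M v) a y ⟩
  K a fzero *ᶜ (kronecker K ∙ (Δ M v ∘ (fzero ∷_))) y +ᶜ K a (fsuc fzero) *ᶜ
      (kronecker K ∙ (Δ M v ∘ (fsuc fzero ∷_))) y
    ≈⟨ ℂ-ring.+-cong (ℂ-ring.*-congˡ (block fzero)) (ℂ-ring.*-congˡ (block (fsuc fzero))) ⟩
  K a fzero *ᶜ (N₀ +ᶜ (M fzero fzero *ᶜ k₀ +ᶜ M fzero (fsuc fzero) *ᶜ k₁)) +ᶜ K a (fsuc fzero) *ᶜ
      (N₁ +ᶜ (M (fsuc fzero) fzero *ᶜ k₀ +ᶜ M (fsuc fzero) (fsuc fzero) *ᶜ k₁))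
    ≈⟨ solve 10 (λ p q n₀ n₁ a b c d k₀ k₁ →
         p :* (n₀ :+ (a :* k₀ :+ b :* k₁)) :+ q :* (n₁ :+ (c :* k₀ :+ d :* k₁)) :=
         (p :* n₀ :+ q :* n₁) :+ ((p :* a :+ q :* c) :* k₀ :+ (p :* b :+ q :* d) :* k₁))
         ≈ᶜ-refl (K a fzero) (K a (fsuc fzero)) N₀ N₁ (M fzero fzero) (M fzero (fsuc fzero))
             (M (fsuc fzero) fzero) (M (fsuc fzero) (fsuc fzero)) k₀ k₁ ⟩
  (K a fzero *ᶜ N₀ +ᶜ K a (fsuc fzero) *ᶜ N₁) +ᶜ (mul₂ K M a fzero *ᶜ k₀ +ᶜ mul₂ K M a (fsuc fzero) *ᶜ k₁)
    ≈⟨ ℂ-ring.+-cong (Δ-linear N _ _ _ _ y) (ℂ-ring.+-cong (ℂ-ring.*-congʳ (ℂ-ring.sym (KM≈NK a fzero)))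
        (ℂ-ring.*-congʳ (ℂ-ring.sym (KM≈NK a (fsuc fzero))))) ⟨
  Δ N (K a fzero •ⱽ (kronecker K ∙ (v ∘ (fzero ∷_))) +ⱽ K a (fsuc fzero) •ⱽ
      (kronecker K ∙ (v ∘ (fsuc fzero ∷_)))) y
    +ᶜ (mul₂ N K a fzero *ᶜ k₀ +ᶜ mul₂ N K a (fsuc fzero) *ᶜ k₁)
    ≈⟨ ℂ-ring.+-cong (Δ-congʳ N (λ z → ℂ-ring.sym (kronecker-∷ K v a z)) y)
         (solve 8 (λ p q a b c d k₀ k₁ →
           (p :* a :+ q :* c) :* k₀ :+ (p :* b :+ q :* d) :* k₁ :=
           p :* (a :* k₀ :+ b :* k₁) :+ q :* (c :* k₀ :+ d :* k₁))
           ≈ᶜ-refl (N a fzero) (N a (fsuc fzero)) (K fzero fzero) (K fzero (fsuc fzero))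
               (K (fsuc fzero) fzero) (K (fsuc fzero) (fsuc fzero)) k₀ k₁) ⟩
  Δ N ((kronecker K ∙ v) ∘ (a ∷_)) y +ᶜ
    (N a fzero *ᶜ (K fzero fzero *ᶜ k₀ +ᶜ K fzero (fsuc fzero) *ᶜ k₁) +ᶜ N a (fsuc fzero) *ᶜ
        (K (fsuc fzero) fzero *ᶜ k₀ +ᶜ K (fsuc fzero) (fsuc fzero) *ᶜ k₁))
    ≈⟨ ℂ-ring.+-congˡ (ℂ-ring.+-cong (ℂ-ring.*-congˡ (kronecker-∷ K v fzero y))
        (ℂ-ring.*-congˡ (kronecker-∷ K v (fsuc fzero) y))) ⟨
  Δ N (kronecker K ∙ v) (a ∷ y) ∎
  where
  k₀ = (kronecker K ∙ (v ∘ (fzero ∷_))) y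
  k₁ = (kronecker K ∙ (v ∘ (fsuc fzero ∷_))) y
  N₀ = Δ N (kronecker K ∙ (v ∘ (fzero ∷_))) y
  N₁ = Δ N (kronecker K ∙ (v ∘ (fsuc fzero ∷_))) y
  block : ∀ b → (kronecker K ∙ (Δ M v ∘ (b ∷_))) y ≈ᶜ Δ N (kronecker K ∙ (v ∘ (b ∷_))) y +ᶜ
      (M b fzero *ᶜ k₀ +ᶜ M b (fsuc fzero) *ᶜ k₁)
  block b = begin
    (kronecker K ∙ (Δ M (v ∘ (b ∷_)) +ⱽ (M b fzero •ⱽ (v ∘ (fzero ∷_)) +ⱽ M b (fsuc fzero) •ⱽ
        (v ∘ (fsuc fzero ∷_))))) y
      ≈⟨ ∙-+ (kronecker K) (Δ M (v ∘ (b ∷_))) _ y ⟩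
    (kronecker K ∙ Δ M (v ∘ (b ∷_))) y +ᶜ (kronecker K ∙
        (M b fzero •ⱽ (v ∘ (fzero ∷_)) +ⱽ M b (fsuc fzero) •ⱽ (v ∘ (fsuc fzero ∷_)))) y
      ≈⟨ ℂ-ring.+-cong (kronecker-Δ K M N KM≈NK (v ∘ (b ∷_)) y)
           (ℂ-ring.trans (∙-+ (kronecker K) (M b fzero •ⱽ (v ∘ (fzero ∷_))) _ y)
               (ℂ-ring.+-cong (∙-• (kronecker K) _ (v ∘ (fzero ∷_)) y)
               (∙-• (kronecker K) _ (v ∘ (fsuc fzero ∷_)) y))) ⟩
    Δ N (kronecker K ∙ (v ∘ (b ∷_))) y +ᶜ (M b fzero *ᶜ k₀ +ᶜ M b (fsuc fzero) *ᶜ k₁) ∎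

-- Ladder relations and their verification for `A*`.

raise lower : ∀ {D} → Mat D → Mat D → V D → V D
raise X Y v = X ∙ v +ⱽ 𝐢 •ⱽ (Y ∙ v)
lower X Y v = X ∙ v +ⱽ (-ᶜ 𝐢) •ⱽ (Y ∙ v)

-- `raise` raises the eigenvalue θᶜ D k = D − 2k of Z, so it lowers the index k.
record Ladder {D} (Z X Y : Mat D) (F : ℕ → Mat D) : Set where
  field
    eigenˡ    : ∀ k v → Z ∙ (F k ∙ v) ≈ⱽ θᶜ D k •ⱽ (F k ∙ v)
    eigenʳ    : ∀ k v → F k ∙ (Z ∙ v) ≈ⱽ θᶜ D k •ⱽ (F k ∙ v)
    raise-suc : ∀ k v → raise X Y (F (suc k) ∙ v) ≈ⱽ F k ∙ raise X Y v
    raise-0   : ∀ v → raise X Y (F 0 ∙ v) ≈ⱽ 0ⱽ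
    lower-suc : ∀ k v → lower X Y (F k ∙ v) ≈ⱽ F (suc k) ∙ lower X Y v
    lower-0   : ∀ v → F 0 ∙ lower X Y v ≈ⱽ 0ⱽ
    idem      : ∀ k v → F k ∙ (F k ∙ v) ≈ⱽ F k ∙ v
    orth      : ∀ {j k} → j ≢ k → ∀ v → F j ∙ (F k ∙ v) ≈ⱽ 0ⱽ
    vanish    : ∀ {k} → D ℕ.< k → ∀ v → F k ∙ v ≈ⱽ 0ⱽ
    resolve   : ∀ v → (∀ k → F k ∙ v ≈ⱽ 0ⱽ) → v ≈ⱽ 0ⱽ

-- Agreement up to `D` suffices since no distance exceeds `D`; `lagrange-upTo` and the vanishing of
-- `E* k` for k > D give no more than that.
weigh-cong : ∀ {D} {f g : ℕ → ℂ} → (∀ n → n ℕ.≤ D → f n ≈ᶜ g n) → {v w : V D} → v ≈ⱽ w →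
    weigh f v ≈ⱽ weigh g w
weigh-cong f≈g e y = ℂ-ring.*-cong (f≈g (∂ x₀ y) (∂≤D y)) (e y)
  where
  ∂≤D : ∀ {D} (y : X D) → ∂ x₀ y ℕ.≤ D
  ∂≤D []               = z≤n
  ∂≤D (fzero ∷ y)      = ℕ.m≤n⇒m≤1+n (∂≤D y)
  ∂≤D (fsuc fzero ∷ y) = s≤s (∂≤D y)

weigh-congʳ : ∀ {D} f {v w : V D} → v ≈ⱽ w → weigh f v ≈ⱽ weigh f w
weigh-congʳ f = weigh-cong {f = f} {f} (λ _ _ → ≈ᶜ-refl)

weigh-weigh : ∀ {D} f g (v : V D) → weigh f (weigh g v) ≈ⱽ weigh (λ n → f n *ᶜ g n) v
weigh-weigh f g v y = ℂ-ring.sym (*ᶜ-assoc _ _ _)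

weigh-• : ∀ {D} f c (v : V D) → weigh (λ n → c *ᶜ f n) v ≈ⱽ c •ⱽ weigh f v
weigh-• f c v y = *ᶜ-assoc _ _ _

weigh-0 : ∀ {D} {f} → (∀ n → n ℕ.≤ D → f n ≈ᶜ 0ᶜ) → (v : V D) → weigh f v ≈ⱽ 0ⱽ
weigh-0 f≈0 v y = ℂ-ring.trans (weigh-cong f≈0 (≈ⱽ-refl {v = v}) y) (ℂ-ring.zeroˡ (v y))

[_≟_] : ℕ → ℕ → ℂ
[ n ≟ k ] = if ⌊ n ℕ.≟ k ⌋ then 1ᶜ else 0ᶜ

[k≟k] : ∀ k → [ k ≟ k ] ≈ᶜ 1ᶜ
[k≟k] k with k ℕ.≟ k
... | yes _  = ≈ᶜ-refl
... | no k≢k = contradiction refl k≢k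

[n≟k]≈0 : ∀ {n k} → n ≢ k → [ n ≟ k ] ≈ᶜ 0ᶜ
[n≟k]≈0 {n} {k} n≢k with n ℕ.≟ k
... | yes n≡k = contradiction n≡k n≢k
... | no _    = ≈ᶜ-refl

E*-∙ : ∀ {D} k (v : V D) → E* k ∙ v ≈ⱽ weigh [_≟ k ] v
E*-∙ k v = diagonal-∙ (λ y → [ ∂ x₀ y ≟ k ]) v

[suc≟suc] : ∀ n k → [ suc n ≟ suc k ] ≈ᶜ [ n ≟ k ]
[suc≟suc] n k = ℂ-ring.reflexive (if-⇔ (suc n ℕ.≟ suc k) (n ℕ.≟ k) ℕ.suc-injective (cong suc))

-- In one factor the combination σᵋ + 𝐢σx is 2𝐢 times a matrix unit, which is what makes it shift
-- the distance by exactly one.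
raise-Δ : ∀ {D} (v : V D) → raise Aᵋ A v ≈ⱽ Δ (mat₂ 0ᶜ (𝐢 +ᶜ 𝐢) 0ᶜ 0ᶜ) v
raise-Δ v y = begin
  (Aᵋ ∙ v) y +ᶜ 𝐢 *ᶜ (A ∙ v) y              ≈⟨ ℂ-ring.+-cong
      (ℂ-ring.trans (Aᵋ-∙ v y) (ℂ-ring.sym (*ᶜ-identityˡ _))) (ℂ-ring.*-congˡ (A-∙ v y)) ⟩
  1ᶜ *ᶜ Δ σᵋ v y +ᶜ 𝐢 *ᶜ Δ σx v y           ≈⟨ Δ-linearˡ σᵋ σx 1ᶜ 𝐢 v y ⟨
  Δ (λ a b → 1ᶜ *ᶜ σᵋ a b +ᶜ 𝐢 *ᶜ σx a b) v y ≈⟨ Δ-cong entries ≈ⱽ-refl y ⟩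
  Δ (mat₂ 0ᶜ (𝐢 +ᶜ 𝐢) 0ᶜ 0ᶜ) v y            ∎
  where
  entries : ∀ a b → 1ᶜ *ᶜ σᵋ a b +ᶜ 𝐢 *ᶜ σx a b ≈ᶜ mat₂ 0ᶜ (𝐢 +ᶜ 𝐢) 0ᶜ 0ᶜ a b
  entries fzero        fzero        = pointwiseᶜ (λ _ → refl) (λ _ → refl)
  entries fzero        (fsuc fzero) = pointwiseᶜ (λ _ → refl) (λ _ → refl)
  entries (fsuc fzero) fzero        = pointwiseᶜ (λ _ → refl) (λ _ → refl)
  entries (fsuc fzero) (fsuc fzero) = pointwiseᶜ (λ _ → refl) (λ _ → refl)

lower-Δ : ∀ {D} (v : V D) → lower Aᵋ A v ≈ⱽ Δ (mat₂ 0ᶜ 0ᶜ (-ᶜ (𝐢 +ᶜ 𝐢)) 0ᶜ) v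
lower-Δ v y = begin
  (Aᵋ ∙ v) y +ᶜ (-ᶜ 𝐢) *ᶜ (A ∙ v) y              ≈⟨ ℂ-ring.+-cong
      (ℂ-ring.trans (Aᵋ-∙ v y) (ℂ-ring.sym (*ᶜ-identityˡ _))) (ℂ-ring.*-congˡ (A-∙ v y)) ⟩
  1ᶜ *ᶜ Δ σᵋ v y +ᶜ (-ᶜ 𝐢) *ᶜ Δ σx v y           ≈⟨ Δ-linearˡ σᵋ σx 1ᶜ (-ᶜ 𝐢) v y ⟨
  Δ (λ a b → 1ᶜ *ᶜ σᵋ a b +ᶜ (-ᶜ 𝐢) *ᶜ σx a b) v y ≈⟨ Δ-cong entries ≈ⱽ-refl y ⟩
  Δ (mat₂ 0ᶜ 0ᶜ (-ᶜ (𝐢 +ᶜ 𝐢)) 0ᶜ) v y            ∎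
  where
  entries : ∀ a b → 1ᶜ *ᶜ σᵋ a b +ᶜ (-ᶜ 𝐢) *ᶜ σx a b ≈ᶜ mat₂ 0ᶜ 0ᶜ (-ᶜ (𝐢 +ᶜ 𝐢)) 0ᶜ a b
  entries fzero        fzero        = pointwiseᶜ (λ _ → refl) (λ _ → refl)
  entries fzero        (fsuc fzero) = pointwiseᶜ (λ _ → refl) (λ _ → refl)
  entries (fsuc fzero) fzero        = pointwiseᶜ (λ _ → refl) (λ _ → refl)
  entries (fsuc fzero) (fsuc fzero) = pointwiseᶜ (λ _ → refl) (λ _ → refl)

ladder* : ∀ {D} → Ladder {D} A* Aᵋ A E*
ladder* {D} = record
  { eigenˡ = λ k v → ≈ⱽ-trans (A*-weigh (E* k ∙ v)) (≈ⱽ-trans (weigh-congʳ (θᶜ D) (E*-∙ k v))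
      (≈ⱽ-trans (weigh-weigh (θᶜ D) [_≟ k ] v) (eigenvalue k v)))
  ; eigenʳ = λ k v → ≈ⱽ-trans (E*-∙ k (A* ∙ v)) (≈ⱽ-trans (weigh-congʳ [_≟ k ] (A*-weigh v))
      (≈ⱽ-trans (weigh-weigh [_≟ k ] (θᶜ D) v)
      (≈ⱽ-trans (weigh-cong (λ n _ → *ᶜ-comm [ n ≟ k ] (θᶜ D n)) (≈ⱽ-refl {v = v})) (eigenvalue k v))))
  ; raise-suc = λ k v → ≈ⱽ-trans (raise-Δ (E* (suc k) ∙ v)) (≈ⱽ-trans (Δ-congʳ ρ (E*-∙ (suc k) v))
      (≈ⱽ-trans (Δ-upper (𝐢 +ᶜ 𝐢) [_≟ suc k ] v)
      (≈ⱽ-trans (weigh-cong (λ n _ → [suc≟suc] n k) (≈ⱽ-sym (raise-Δ v))) (≈ⱽ-sym (E*-∙ k (raise Aᵋ A v))))))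
  ; raise-0 = λ v → ≈ⱽ-trans (raise-Δ (E* 0 ∙ v)) (≈ⱽ-trans (Δ-congʳ ρ (E*-∙ 0 v))
      (≈ⱽ-trans (Δ-upper (𝐢 +ᶜ 𝐢) [_≟ 0 ] v) (weigh-0 {f = [_≟ 0 ] ∘ suc}
          (λ n _ → [n≟k]≈0 {suc n} {0} λ ()) (Δ ρ v))))
  ; lower-suc = λ k v → ≈ⱽ-trans (lower-Δ (E* k ∙ v)) (≈ⱽ-trans (Δ-congʳ ρ′ (E*-∙ k v))
      (≈ⱽ-trans (Δ-congʳ ρ′ (weigh-cong (λ n _ → ℂ-ring.sym ([suc≟suc] n k)) (≈ⱽ-refl {v = v})))
      (≈ⱽ-trans (Δ-lower (-ᶜ (𝐢 +ᶜ 𝐢)) [_≟ suc k ] v)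
      (≈ⱽ-trans (weigh-congʳ [_≟ suc k ] (≈ⱽ-sym (lower-Δ v))) (≈ⱽ-sym (E*-∙ (suc k) (lower Aᵋ A v)))))))
  ; lower-0 = λ v → ≈ⱽ-trans (E*-∙ 0 (lower Aᵋ A v)) (≈ⱽ-trans (weigh-congʳ [_≟ 0 ] (lower-Δ v))
      (≈ⱽ-trans (≈ⱽ-sym (Δ-lower (-ᶜ (𝐢 +ᶜ 𝐢)) [_≟ 0 ] v))
      (≈ⱽ-trans (Δ-congʳ ρ′ (weigh-0 {f = [_≟ 0 ] ∘ suc}
          (λ n _ → [n≟k]≈0 {suc n} {0} λ ()) v)) (≈ⱽ-trans (≈ⱽ-sym (lower-Δ 0ⱽ)) (lower-0ⱽ)))))
  ; idem = λ k v → ≈ⱽ-trans (product k k v) (≈ⱽ-trans (weigh-cong (λ n _ → square n k) (≈ⱽ-refl {v = v}))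
      (≈ⱽ-sym (E*-∙ k v)))
  ; orth = λ {j} {k} j≢k v → ≈ⱽ-trans (product j k v) (weigh-0 (λ n _ → disjoint n j≢k) v)
  ; vanish = λ {k} D<k v → ≈ⱽ-trans (E*-∙ k v)
      (weigh-0 {f = [_≟ k ]} (λ n n≤D → [n≟k]≈0 {n} {k} (λ { refl → ℕ.<⇒≱ D<k n≤D })) v)
  ; resolve = λ v h y → ℂ-ring.trans (ℂ-ring.sym (*ᶜ-identityˡ (v y)))
      (ℂ-ring.trans (ℂ-ring.*-congʳ (ℂ-ring.sym ([k≟k] (∂ x₀ y))))
          (ℂ-ring.trans (ℂ-ring.sym (E*-∙ (∂ x₀ y) v y)) (h (∂ x₀ y) y)))
  }
  where
  ρ ρ′ : Mat₂
  ρ  = mat₂ 0ᶜ (𝐢 +ᶜ 𝐢) 0ᶜ 0ᶜ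
  ρ′ = mat₂ 0ᶜ 0ᶜ (-ᶜ (𝐢 +ᶜ 𝐢)) 0ᶜ
  eigenvalue : ∀ k (v : V D) → weigh (λ n → θᶜ D n *ᶜ [ n ≟ k ]) v ≈ⱽ θᶜ D k •ⱽ (E* k ∙ v)
  eigenvalue k v = ≈ⱽ-trans (weigh-cong (λ n _ → pick n) (≈ⱽ-refl {v = v}))
    (≈ⱽ-trans (weigh-• [_≟ k ] (θᶜ D k) v) (•ⱽ-congʳ (θᶜ D k) (≈ⱽ-sym (E*-∙ k v))))
    where
    pick : ∀ n → θᶜ D n *ᶜ [ n ≟ k ] ≈ᶜ θᶜ D k *ᶜ [ n ≟ k ]
    pick n with n ℕ.≟ k
    ... | yes refl = ≈ᶜ-refl
    ... | no _     = ℂ-ring.trans (ℂ-ring.zeroʳ _) (ℂ-ring.sym (ℂ-ring.zeroʳ _))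
  lower-0ⱽ : lower {D} Aᵋ A 0ⱽ ≈ⱽ 0ⱽ
  lower-0ⱽ y = ℂ-ring.trans (ℂ-ring.+-cong (∙-0 {D} Aᵋ y) (ℂ-ring.*-congˡ (∙-0 {D} A y)))
      (solve 0 (:0 :+ :- :𝐢 :* :0 := :0) ≈ᶜ-refl)
  product : ∀ j k (v : V D) → E* j ∙ (E* k ∙ v) ≈ⱽ weigh (λ n → [ n ≟ j ] *ᶜ [ n ≟ k ]) v
  product j k v = ≈ⱽ-trans (E*-∙ j (E* k ∙ v))
      (≈ⱽ-trans (weigh-congʳ [_≟ j ] (E*-∙ k v)) (weigh-weigh [_≟ j ] [_≟ k ] v))
  square : ∀ n k → [ n ≟ k ] *ᶜ [ n ≟ k ] ≈ᶜ [ n ≟ k ]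
  square n k with n ℕ.≟ k
  ... | yes _ = *ᶜ-identityˡ 1ᶜ
  ... | no _  = ℂ-ring.zeroˡ 0ᶜ
  disjoint : ∀ n {j k} → j ≢ k → [ n ≟ j ] *ᶜ [ n ≟ k ] ≈ᶜ 0ᶜ
  disjoint n {j} {k} j≢k with n ℕ.≟ j
  ... | no _     = ℂ-ring.zeroˡ _
  ... | yes refl = ℂ-ring.trans (ℂ-ring.*-congˡ ([n≟k]≈0 j≢k)) (ℂ-ring.zeroʳ 1ᶜ)

-- Conjugation by `P`.

-- M ~ N means M = P⁻¹NP.
infix 4 _~_

_~_ : ∀ {D} → Mat D → Mat D → Set
M ~ N = ∀ v → P ∙ (M ∙ v) ≈ⱽ N ∙ (P ∙ v)

P⁻¹-P : ∀ {D} (v : V D) → P⁻¹ ∙ (P ∙ v) ≈ⱽ v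
P⁻¹-P v = ≈ⱽ-trans (≈ⱽ-sym (*ᴹ-∙ P⁻¹ P v)) (≈ⱽ-trans (∙-congˡ P⁻¹*P≈Id v) (Id-∙ v))

P-P⁻¹ : ∀ {D} (v : V D) → P ∙ (P⁻¹ ∙ v) ≈ⱽ v
P-P⁻¹ v = ≈ⱽ-trans (≈ⱽ-sym (*ᴹ-∙ P P⁻¹ v)) (≈ⱽ-trans (∙-congˡ P*P⁻¹≈Id v) (Id-∙ v))

P-injective : ∀ {D} {v w : V D} → P ∙ v ≈ⱽ P ∙ w → v ≈ⱽ w
P-injective {v = v} {w} e = ≈ⱽ-trans (≈ⱽ-sym (P⁻¹-P v)) (≈ⱽ-trans (∙-congʳ P⁻¹ e) (P⁻¹-P w))

P-injective-0 : ∀ {D} {v : V D} → P ∙ v ≈ⱽ 0ⱽ → v ≈ⱽ 0ⱽ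
P-injective-0 e = P-injective (≈ⱽ-trans e (≈ⱽ-sym (∙-0 P)))

~-∘ : ∀ {D} {M M′ N N′ : Mat D} → M ~ M′ → N ~ N′ → ∀ v → P ∙ (M ∙ (N ∙ v)) ≈ⱽ M′ ∙ (N′ ∙ (P ∙ v))
~-∘ {M′ = M′} {N} M~ N~ v = ≈ⱽ-trans (M~ (N ∙ v)) (∙-congʳ M′ (N~ v))

~-unique : ∀ {D} {M N K : Mat D} → M ~ K → N ~ K → ∀ v → M ∙ v ≈ⱽ N ∙ v
~-unique M~K N~K v = P-injective (≈ⱽ-trans (M~K v) (≈ⱽ-sym (N~K v)))

-- By `kronecker-Δ` this conjugation and the next two reduce to the 2 × 2 identities P₁σx = σzP₁,
-- P₁σᵋ = σxP₁ and P₁σz = σᵋP₁.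
A~A* : ∀ {D} → A {D} ~ A*
A~A* v = ≈ⱽ-trans (∙-congʳ P (A-∙ v)) (≈ⱽ-trans (kronecker-Δ P₁ σx σz entries v) (≈ⱽ-sym (A*-∙ (P ∙ v))))
  where
  entries : ∀ a b → mul₂ P₁ σx a b ≈ᶜ mul₂ σz P₁ a b
  entries fzero        fzero        = pointwiseᶜ (λ _ → refl) (λ _ → refl)
  entries fzero        (fsuc fzero) = pointwiseᶜ (λ _ → refl) (λ _ → refl)
  entries (fsuc fzero) fzero        = pointwiseᶜ (λ _ → refl) (λ _ → refl)
  entries (fsuc fzero) (fsuc fzero) = pointwiseᶜ (λ _ → refl) (λ _ → refl)

Aᵋ~A : ∀ {D} → Aᵋ {D} ~ A
Aᵋ~A v = ≈ⱽ-trans (∙-congʳ P (Aᵋ-∙ v)) (≈ⱽ-trans (kronecker-Δ P₁ σᵋ σx entries v) (≈ⱽ-sym (A-∙ (P ∙ v))))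
  where
  entries : ∀ a b → mul₂ P₁ σᵋ a b ≈ᶜ mul₂ σx P₁ a b
  entries fzero        fzero        = pointwiseᶜ (λ _ → refl) (λ _ → refl)
  entries fzero        (fsuc fzero) = pointwiseᶜ (λ _ → refl) (λ _ → refl)
  entries (fsuc fzero) fzero        = pointwiseᶜ (λ _ → refl) (λ _ → refl)
  entries (fsuc fzero) (fsuc fzero) = pointwiseᶜ (λ _ → refl) (λ _ → refl)

A*~Aᵋ : ∀ {D} → A* {D} ~ Aᵋ
A*~Aᵋ v = ≈ⱽ-trans (∙-congʳ P (A*-∙ v)) (≈ⱽ-trans (kronecker-Δ P₁ σz σᵋ entries v) (≈ⱽ-sym (Aᵋ-∙ (P ∙ v))))
  where
  entries : ∀ a b → mul₂ P₁ σz a b ≈ᶜ mul₂ σᵋ P₁ a b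
  entries fzero        fzero        = pointwiseᶜ (λ _ → refl) (λ _ → refl)
  entries fzero        (fsuc fzero) = pointwiseᶜ (λ _ → refl) (λ _ → refl)
  entries (fsuc fzero) fzero        = pointwiseᶜ (λ _ → refl) (λ _ → refl)
  entries (fsuc fzero) (fsuc fzero) = pointwiseᶜ (λ _ → refl) (λ _ → refl)

Eᵋ~E : ∀ {D} k → Eᵋ {D} k ~ E k
Eᵋ~E k v = ≈ⱽ-trans (∙-congʳ P (≈ⱽ-trans (*ᴹ-∙ (P⁻¹ *ᴹ E k) P v) (*ᴹ-∙ P⁻¹ (E k) (P ∙ v))))
    (P-P⁻¹ (E k ∙ (P ∙ v)))

-- Idempotents as Lagrange polynomials.

fromℚ-inverse : ∀ a b .{{_ : ℚ.NonZero (a ℚ.- b)}} → fromℚ (ℚ.1/ (a ℚ.- b)) *ᶜ (fromℚ a -ᶜ fromℚ b) ≈ᶜ 1ᶜ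
fromℚ-inverse a b = pointwiseᶜ
  (λ _ → trans (real-part (ℚ.1/ (a ℚ.- b)) (a ℚ.- b)) (ℚ.*-inverseˡ (a ℚ.- b)))
  (λ _ → imaginary-part (ℚ.1/ (a ℚ.- b)) (a ℚ.- b))
  where
  module ℚs = ℚ.+-*-Solver
  real-part : ∀ p c → p ℚ.* c ℚ.+ ℚ.- (0ℚ ℚ.* (0ℚ ℚ.+ ℚ.- 0ℚ)) ≡ p ℚ.* c
  real-part = ℚs.solve 2 (λ p c → p ℚs.:* c ℚs.:+ ℚs.:-
      (ℚs.con 0ℚ ℚs.:* (ℚs.con 0ℚ ℚs.:+ ℚs.:- ℚs.con 0ℚ)) ℚs.:= p ℚs.:* c) refl
  imaginary-part : ∀ p c → p ℚ.* (0ℚ ℚ.+ ℚ.- 0ℚ) ℚ.+ 0ℚ ℚ.* c ≡ 0ℚ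
  imaginary-part = ℚs.solve 2 (λ p c → p ℚs.:*
      (ℚs.con 0ℚ ℚs.:+ ℚs.:- ℚs.con 0ℚ) ℚs.:+ ℚs.con 0ℚ ℚs.:* c ℚs.:= ℚs.con 0ℚ) refl

private
  -- The eigenvalue of `E-factor i j` on the eigenspace for `θ D n`; `lagrange` is the value at
  -- `θ D n` of the corresponding product of linear factors.
  factor : ℕ → ℕ → ℕ → ℕ → ℂ
  factor D i j n with i ℕ.≟ j
  ... | yes _  = 1ᶜ
  ... | no i≢j = fromℚ ((ℚ.1/ (θ D i ℚ.- θ D j)) {{θ-distinct D i≢j}}) *ᶜ (θᶜ D n -ᶜ θᶜ D j)

  lagrange : ℕ → ℕ → List ℕ → ℕ → ℂ
  lagrange D i js n = foldr _*ᶜ_ 1ᶜ (map (λ j → factor D i j n) js)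

  affine-∙ : ∀ {D} q t (M : Mat D) v → (q •ᴹ (M -ᴹ t •ᴹ Id)) ∙ v ≈ⱽ q •ⱽ (M ∙ v +ⱽ (-ᶜ t) •ⱽ v)
  affine-∙ q t M v = ≈ⱽ-trans (•ᴹ-∙ q (M -ᴹ t •ᴹ Id) v) (•ⱽ-congʳ q (≈ⱽ-trans (-ᴹ-∙ M (t •ᴹ Id) v)
    (+ⱽ-cong ≈ⱽ-refl λ y → ℂ-ring.trans (ℂ-ring.*-congˡ (≈ⱽ-trans (•ᴹ-∙ t Id v) (•ⱽ-congʳ t (Id-∙ v)) y))
      (solve 2 (λ t v → :- :1 :* (t :* v) := :- t :* v) ≈ᶜ-refl t (v y)))))

  affine-weigh : ∀ {D} q t (v : V D) → q •ⱽ (weigh (θᶜ D) v +ⱽ (-ᶜ t) •ⱽ v) ≈ⱽ weigh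
      (λ n → q *ᶜ (θᶜ D n -ᶜ t)) v
  affine-weigh {D} q t v y = solve 4 (λ q s t p → q :* (s :* p :+ :- t :* p) :=
      (q :* (s :- t)) :* p) ≈ᶜ-refl q (θᶜ D (∂ x₀ y)) t (v y)

  lagrange-i : ∀ D i js → lagrange D i js i ≈ᶜ 1ᶜ
  lagrange-i D i []       = ≈ᶜ-refl
  lagrange-i D i (j ∷ js) = ℂ-ring.trans (ℂ-ring.*-cong factor≈1 (lagrange-i D i js)) (*ᶜ-identityˡ 1ᶜ)
    where
    factor≈1 : factor D i j i ≈ᶜ 1ᶜ
    factor≈1 with i ℕ.≟ j
    ... | yes _  = ≈ᶜ-refl
    ... | no i≢j = fromℚ-inverse (θ D i) (θ D j) {{θ-distinct D i≢j}}

  lagrange-j : ∀ D {i n js} → n ≢ i → n ∈ˡ js → lagrange D i js n ≈ᶜ 0ᶜ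
  lagrange-j D {i} {n} n≢i (here refl) = ℂ-ring.trans (ℂ-ring.*-congʳ factor≈0) (ℂ-ring.zeroˡ _)
    where
    factor≈0 : factor D i n n ≈ᶜ 0ᶜ
    factor≈0 with i ℕ.≟ n
    ... | yes i≡n = contradiction (sym i≡n) n≢i
    ... | no _    = ℂ-ring.trans (ℂ-ring.*-congˡ (ℂ-ring.-‿inverseʳ (θᶜ D n))) (ℂ-ring.zeroʳ _)
  lagrange-j D n≢i (there n∈js) = ℂ-ring.trans (ℂ-ring.*-congˡ (lagrange-j D n≢i n∈js)) (ℂ-ring.zeroʳ _)

  -- As n ≤ D, the node `n` occurs in the list, and its factor is 0 unless n = i. The argument
  -- includes i > D, where the polynomial vanishes at every node.
  lagrange-upTo : ∀ D i n → n ℕ.≤ D → lagrange D i (upTo (suc D)) n ≈ᶜ [ n ≟ i ]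
  lagrange-upTo D i n n≤D with n ℕ.≟ i
  ... | yes refl = lagrange-i D n (upTo (suc D))
  ... | no n≢i   = lagrange-j D n≢i (∈-upTo⁺ (s≤s n≤D))

  E-factor-~ : ∀ {D} i j (v : V D) → P ∙ (E-factor i j ∙ v) ≈ⱽ weigh (factor D i j) (P ∙ v)
  E-factor-~ {D} i j v with i ℕ.≟ j
  ... | yes _  = λ y → ℂ-ring.trans (∙-congʳ P (Id-∙ v) y) (ℂ-ring.sym (*ᶜ-identityˡ _))
  ... | no i≢j = ≈ⱽ-trans (∙-congʳ P (affine-∙ q (θᶜ D j) A v)) (≈ⱽ-trans (∙-• P q _)
    (≈ⱽ-trans (•ⱽ-congʳ q (≈ⱽ-trans (∙-+ P (A ∙ v) _)
      (+ⱽ-cong (≈ⱽ-trans (A~A* v) (A*-weigh (P ∙ v))) (∙-• P (-ᶜ θᶜ D j) v))))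
    (affine-weigh q (θᶜ D j) (P ∙ v))))
    where q = fromℚ ((ℚ.1/ (θ D i ℚ.- θ D j)) {{θ-distinct D i≢j}})

-- `P` carries `A` to `A*`, hence a polynomial in `A` to the same polynomial in `A*`, which acts by
-- weighing.
E~E* : ∀ {D} k → E {D} k ~ E* k
E~E* {D} k v = ≈ⱽ-trans (product (upTo (suc D)) v)
  (≈ⱽ-trans (weigh-cong (lagrange-upTo D k) (≈ⱽ-refl {v = P ∙ v})) (≈ⱽ-sym (E*-∙ k (P ∙ v))))
  where
  product : ∀ js (v : V D) → P ∙ (foldr _*ᴹ_ Id (map (E-factor k) js) ∙ v) ≈ⱽ weigh (lagrange D k js) (P ∙ v)
  product [] v y   = ℂ-ring.trans (∙-congʳ P (Id-∙ v) y) (ℂ-ring.sym (*ᶜ-identityˡ _))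
  product (j ∷ js) v = ≈ⱽ-trans (∙-congʳ P (*ᴹ-∙ (E-factor k j) (foldr _*ᴹ_ Id (map (E-factor k) js)) v))
    (≈ⱽ-trans (E-factor-~ k j (foldr _*ᴹ_ Id (map (E-factor k) js) ∙ v))
    (≈ⱽ-trans (weigh-congʳ (factor D k j) (product js v))
        (weigh-weigh (factor D k j) (lagrange D k js) (P ∙ v))))

-- Action of the idempotents through `T`.

-- Agreement on all vectors is enough to preserve T-modules, and it avoids comparing entries of
-- `E* k` or `Eᵋ k` with those of a polynomial.
ActsAsT : ∀ {D} → (V D → V D) → Set
ActsAsT Φ = ∃ λ M → T M × (∀ v → M ∙ v ≈ⱽ Φ v)

-∈T : ∀ {D} {M N : Mat D} → T M → T N → T (M -ᴹ N)
-∈T {M = M} {N} M∈T N∈T = ≈∈T (λ y z → solve 2 (λ m n → m :+ :- :1 :* n := m :- n) ≈ᶜ-refl (M y z) (N y z))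
    (+∈T M∈T (•∈T (-ᶜ 1ᶜ) N∈T))

Aᵋ∈T : ∀ {D} → T {D} Aᵋ
Aᵋ∈T = •∈T _ (-∈T (*∈T A∈T A*∈T) (*∈T A*∈T A∈T))

E∈T : ∀ {D} k → T {D} (E k)
E∈T {D} k = product (upTo (suc D))
  where
  E-factor∈T : ∀ j → T {D} (E-factor k j)
  E-factor∈T j with k ℕ.≟ j
  ... | yes _ = Id∈T
  ... | no _  = •∈T _ (-∈T A∈T (•∈T _ Id∈T))
  product : ∀ js → T {D} (foldr _*ᴹ_ Id (map (E-factor k) js))
  product []       = Id∈T
  product (j ∷ js) = *∈T (E-factor∈T j) (product js)

E*-acts : ∀ {D} k → ActsAsT {D} (E* k ∙_)
E*-acts {D} k = let M , M∈T , h = product (upTo (suc D)) in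
  M , M∈T , λ v → ≈ⱽ-trans (h v) (≈ⱽ-trans (weigh-cong (lagrange-upTo D k) (≈ⱽ-refl {v = v}))
      (≈ⱽ-sym (E*-∙ k v)))
  where
  factor-acts : ∀ j → ActsAsT {D} (weigh (factor D k j))
  factor-acts j with k ℕ.≟ j
  ... | yes _  = Id , Id∈T , λ v y → ℂ-ring.trans (Id-∙ v y) (ℂ-ring.sym (*ᶜ-identityˡ _))
  ... | no k≢j = q •ᴹ (A* -ᴹ θᶜ D j •ᴹ Id) , •∈T q (-∈T A*∈T (•∈T (θᶜ D j) Id∈T)) , λ v →
    ≈ⱽ-trans (affine-∙ q (θᶜ D j) A* v) (≈ⱽ-trans (•ⱽ-congʳ q (+ⱽ-cong (A*-weigh v) ≈ⱽ-refl))
        (affine-weigh q (θᶜ D j) v))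
    where q = fromℚ ((ℚ.1/ (θ D k ℚ.- θ D j)) {{θ-distinct D k≢j}})
  product : ∀ js → ActsAsT {D} (weigh (lagrange D k js))
  product []       = Id , Id∈T , λ v y → ℂ-ring.trans (Id-∙ v y) (ℂ-ring.sym (*ᶜ-identityˡ _))
  product (j ∷ js) with factor-acts j | product js
  ... | M , M∈T , h | N , N∈T , g = M *ᴹ N , *∈T M∈T N∈T , λ v → ≈ⱽ-trans (*ᴹ-∙ M N v)
    (≈ⱽ-trans (h (N ∙ v)) (≈ⱽ-trans (weigh-congʳ (factor D k j) (g v))
        (weigh-weigh (factor D k j) (lagrange D k js) v)))

-- Conjugation sends the generators `A` and `A*` to `Aᵋ` and `A`, both in `T`, so it maps `T` into
-- itself. This lets `Eᵋ k`, a conjugate of `E k`, act through `T`.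
T-conjugate : ∀ {D} {M : Mat D} → T M → ∃ λ N → T N × N ~ M
T-conjugate A∈T  = Aᵋ , Aᵋ∈T , Aᵋ~A
T-conjugate A*∈T = A , A∈T , A~A*
T-conjugate Id∈T = Id , Id∈T , λ v → ≈ⱽ-trans (∙-congʳ P (Id-∙ v)) (≈ⱽ-sym (Id-∙ (P ∙ v)))
T-conjugate (+∈T {M} {N} M∈T N∈T) with T-conjugate M∈T | T-conjugate N∈T
... | M′ , M′∈T , M′~M | N′ , N′∈T , N′~N = M′ +ᴹ N′ , +∈T M′∈T N′∈T , λ v →
  ≈ⱽ-trans (∙-congʳ P (+ᴹ-∙ M′ N′ v)) (≈ⱽ-trans (∙-+ P (M′ ∙ v) (N′ ∙ v))
  (≈ⱽ-trans (+ⱽ-cong (M′~M v) (N′~N v)) (≈ⱽ-sym (+ᴹ-∙ M N (P ∙ v)))))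
T-conjugate (•∈T c {M} M∈T) with T-conjugate M∈T
... | M′ , M′∈T , M′~M = c •ᴹ M′ , •∈T c M′∈T , λ v →
  ≈ⱽ-trans (∙-congʳ P (•ᴹ-∙ c M′ v)) (≈ⱽ-trans (∙-• P c (M′ ∙ v))
  (≈ⱽ-trans (•ⱽ-congʳ c (M′~M v)) (≈ⱽ-sym (•ᴹ-∙ c M (P ∙ v)))))
T-conjugate (*∈T {M} {N} M∈T N∈T) with T-conjugate M∈T | T-conjugate N∈T
... | M′ , M′∈T , M′~M | N′ , N′∈T , N′~N = M′ *ᴹ N′ , *∈T M′∈T N′∈T , λ v →
  ≈ⱽ-trans (∙-congʳ P (*ᴹ-∙ M′ N′ v)) (≈ⱽ-trans (~-∘ {M = M′} {M} {N′} {N} M′~M N′~N v)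
      (≈ⱽ-sym (*ᴹ-∙ M N (P ∙ v))))
T-conjugate (≈∈T M≈N M∈T) with T-conjugate M∈T
... | M′ , M′∈T , M′~M = M′ , M′∈T , λ v → ≈ⱽ-trans (M′~M v) (∙-congˡ M≈N (P ∙ v))

E-acts : ∀ {D} k → ActsAsT {D} (E k ∙_)
E-acts k = E k , E∈T k , λ v → ≈ⱽ-refl {v = E k ∙ v}

Eᵋ-acts : ∀ {D} k → ActsAsT {D} (Eᵋ k ∙_)
Eᵋ-acts {D} k = let M , M∈T , M~E = T-conjugate {M = E k} (E∈T k) in
  M , M∈T , ~-unique {D} {M} {Eᵋ k} {E k} M~E (Eᵋ~E k)

-- Rotation of the ladder relations.

-- All fields are stable under simultaneous conjugation; the equations are checked after applying
-- `P`, which is injective.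
ladder-conjugate : ∀ {D} {Z X Y Z′ X′ Y′ : Mat D} {F F′ : ℕ → Mat D} →
  Z′ ~ Z → X′ ~ X → Y′ ~ Y → (∀ k → F′ k ~ F k) → Ladder Z X Y F → Ladder Z′ X′ Y′ F′
ladder-conjugate {D} {Z} {X} {Y} {Z′} {X′} {Y′} {F} {F′} Z~ X~ Y~ F~ ladder = record
  { eigenˡ = λ k v → P-injective (≈ⱽ-trans (~-∘ {M = Z′} {Z} {F′ k} {F k} Z~ (F~ k) v)
      (≈ⱽ-trans (L.eigenˡ k (P ∙ v)) (≈ⱽ-sym (scaled k v))))
  ; eigenʳ = λ k v → P-injective (≈ⱽ-trans (~-∘ {M = F′ k} {F k} {Z′} {Z} (F~ k) Z~ v)
      (≈ⱽ-trans (L.eigenʳ k (P ∙ v)) (≈ⱽ-sym (scaled k v))))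
  ; raise-suc = λ k v → P-injective (≈ⱽ-trans (combined 𝐢 (F′ (suc k) ∙ v))
      (≈ⱽ-trans (combination-cong 𝐢 (F~ (suc k) v))
      (≈ⱽ-trans (L.raise-suc k (P ∙ v)) (≈ⱽ-sym
          (≈ⱽ-trans (F~ k (raise X′ Y′ v)) (∙-congʳ (F k) (combined 𝐢 v)))))))
  ; raise-0 = λ v → P-injective-0 (≈ⱽ-trans (combined 𝐢 (F′ 0 ∙ v))
      (≈ⱽ-trans (combination-cong 𝐢 (F~ 0 v)) (L.raise-0 (P ∙ v))))
  ; lower-suc = λ k v → P-injective (≈ⱽ-trans (combined (-ᶜ 𝐢) (F′ k ∙ v))
      (≈ⱽ-trans (combination-cong (-ᶜ 𝐢) (F~ k v))
      (≈ⱽ-trans (L.lower-suc k (P ∙ v)) (≈ⱽ-sym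
          (≈ⱽ-trans (F~ (suc k) (lower X′ Y′ v)) (∙-congʳ (F (suc k)) (combined (-ᶜ 𝐢) v)))))))
  ; lower-0 = λ v → P-injective-0 (≈ⱽ-trans (F~ 0 (lower X′ Y′ v))
      (≈ⱽ-trans (∙-congʳ (F 0) (combined (-ᶜ 𝐢) v)) (L.lower-0 (P ∙ v))))
  ; idem = λ k v → P-injective (≈ⱽ-trans (~-∘ {M = F′ k} {F k} {F′ k} {F k} (F~ k) (F~ k) v)
      (≈ⱽ-trans (L.idem k (P ∙ v)) (≈ⱽ-sym (F~ k v))))
  ; orth = λ {j} {k} j≢k v → P-injective-0 (≈ⱽ-trans (~-∘ {M = F′ j} {F j} {F′ k} {F k} (F~ j) (F~ k) v)
      (L.orth j≢k (P ∙ v)))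
  ; vanish = λ {k} D<k v → P-injective-0 (≈ⱽ-trans (F~ k v) (L.vanish D<k (P ∙ v)))
  ; resolve = λ v h → P-injective-0 (L.resolve (P ∙ v) λ k → ≈ⱽ-trans (≈ⱽ-sym (F~ k v)) (∙-≈0 P (h k)))
  }
  where
  module L = Ladder ladder
  scaled : ∀ k v → P ∙ (θᶜ D k •ⱽ (F′ k ∙ v)) ≈ⱽ θᶜ D k •ⱽ (F k ∙ (P ∙ v))
  scaled k v = ≈ⱽ-trans (∙-• P (θᶜ D k) (F′ k ∙ v)) (•ⱽ-congʳ (θᶜ D k) (F~ k v))
  combined : ∀ c v → P ∙ (X′ ∙ v +ⱽ c •ⱽ (Y′ ∙ v)) ≈ⱽ X ∙ (P ∙ v) +ⱽ c •ⱽ (Y ∙ (P ∙ v))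
  combined c v = ≈ⱽ-trans (∙-+ P (X′ ∙ v) (c •ⱽ (Y′ ∙ v)))
      (+ⱽ-cong (X~ v) (≈ⱽ-trans (∙-• P c (Y′ ∙ v)) (•ⱽ-congʳ c (Y~ v))))
  combination-cong : ∀ c {v w} → v ≈ⱽ w → X ∙ v +ⱽ c •ⱽ (Y ∙ v) ≈ⱽ X ∙ w +ⱽ c •ⱽ (Y ∙ w)
  combination-cong c e = +ⱽ-cong (∙-congʳ X e) (•ⱽ-congʳ c (∙-congʳ Y e))

-- The triple (A*, Aᵋ, A) rotates to (A, A*, Aᵋ) here and to (Aᵋ, A, A*) in `ladderᵋ`, so the
-- explicit computation is done only once, for `A*`.
ladder : ∀ {D} → Ladder {D} A A* Aᵋ E
ladder = ladder-conjugate A~A* A*~Aᵋ Aᵋ~A E~E* ladder*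

ladderᵋ : ∀ {D} → Ladder {D} Aᵋ A A* Eᵋ
ladderᵋ = ladder-conjugate Aᵋ~A A~A* A*~Aᵋ Eᵋ~E ladder

-- Spans, submodules and linear combinations.

θ-gap-cancel : ∀ {D i j} → i ≢ j → {u : V D} → (𝐢 *ᶜ (θᶜ D i -ᶜ θᶜ D j)) •ⱽ u ≈ⱽ 0ⱽ → u ≈ⱽ 0ⱽ
θ-gap-cancel {D} {i} {j} i≢j {u} e y = begin
  u y                                ≈⟨ *ᶜ-identityˡ (u y) ⟨
  1ᶜ *ᶜ u y                          ≈⟨ ℂ-ring.*-congʳ (fromℚ-inverse (θ D i) (θ D j) {{θ-distinct D i≢j}}) ⟨
  (q *ᶜ g) *ᶜ u y                    ≈⟨ solve 3
      (λ q g u → (q :* g) :* u := (:- :𝐢 :* q) :* ((:𝐢 :* g) :* u)) ≈ᶜ-refl q g (u y) ⟩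
  (-ᶜ 𝐢 *ᶜ q) *ᶜ ((𝐢 *ᶜ g) *ᶜ u y)   ≈⟨ ℂ-ring.*-congˡ (e y) ⟩
  (-ᶜ 𝐢 *ᶜ q) *ᶜ 0ᶜ                  ≈⟨ ℂ-ring.zeroʳ _ ⟩
  0ᶜ                                 ∎
  where
  q = fromℚ ((ℚ.1/ (θ D i ℚ.- θ D j)) {{θ-distinct D i≢j}})
  g = θᶜ D i -ᶜ θᶜ D j

module _ {D : ℕ} (X Y : Mat D) where
  raise-lower-X : ∀ u → X ∙ u ≈ⱽ fromℚ ½ •ⱽ (raise X Y u +ⱽ lower X Y u)
  raise-lower-X u y = solve 2 (λ a b → a := :½ :* ((a :+ :𝐢 :* b) :+ (a :+ :- :𝐢 :* b))) ≈ᶜ-refl ((X ∙ u) y)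
      ((Y ∙ u) y)

  raise-lower-Y : ∀ u → Y ∙ u ≈ⱽ (-ᶜ (fromℚ ½ *ᶜ 𝐢)) •ⱽ (raise X Y u +ⱽ (-ᶜ 1ᶜ) •ⱽ lower X Y u)
  raise-lower-Y u y = solve 2 (λ a b → b := :- (:½ :* :𝐢) :*
      ((a :+ :𝐢 :* b) :+ :- :1 :* (a :+ :- :𝐢 :* b))) ≈ᶜ-refl ((X ∙ u) y) ((Y ∙ u) y)

-- The inductive form needs no coefficients. Its elimination `Span⊆`, applied to a preimage under a
-- matrix, reduces statements about the image to the generators.
data Span {D} (w : ℕ → V D) : Pred (V D) 0ℓ where
  gen  : ∀ k → w k ∈ Span w
  zero : 0ⱽ ∈ Span w
  add  : ∀ {u v} → u ∈ Span w → v ∈ Span w → u +ⱽ v ∈ Span w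
  mul  : ∀ c {u} → u ∈ Span w → c •ⱽ u ∈ Span w
  resp : ∀ {u v} → u ≈ⱽ v → u ∈ Span w → v ∈ Span w

Span-isSubspace : ∀ {D} (w : ℕ → V D) → IsSubspace (Span w)
Span-isSubspace w = record { ≈-closed = resp ; 0-closed = zero ; +-closed = add ; •-closed = mul }

Span⊆ : ∀ {D} {w : ℕ → V D} {W : Pred (V D) 0ℓ} → IsSubspace W → (∀ k → w k ∈ W) → Span w ⊆ W
Span⊆ S w∈W (gen k)    = w∈W k
Span⊆ S w∈W zero       = IsSubspace.0-closed S
Span⊆ S w∈W (add p q)  = IsSubspace.+-closed S (Span⊆ S w∈W p) (Span⊆ S w∈W q)
Span⊆ S w∈W (mul c p)  = IsSubspace.•-closed S c (Span⊆ S w∈W p)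
Span⊆ S w∈W (resp e p) = IsSubspace.≈-closed S e (Span⊆ S w∈W p)

preimage-isSubspace : ∀ {D} (M : Mat D) {W : Pred (V D) 0ℓ} → IsSubspace W → IsSubspace (λ u → M ∙ u ∈ W)
preimage-isSubspace M S = record
  { ≈-closed = λ e p → ≈-closed (∙-congʳ M e) p
  ; 0-closed = ≈-closed (≈ⱽ-sym (∙-0 M)) 0-closed
  ; +-closed = λ {u} {v} p q → ≈-closed (≈ⱽ-sym (∙-+ M u v)) (+-closed p q)
  ; •-closed = λ c {u} p → ≈-closed (≈ⱽ-sym (∙-• M c u)) (•-closed c p)
  }
  where open IsSubspace S

T-closed : ∀ {D} {W : Pred (V D) 0ℓ} → IsSubspace W →
  (∀ {u} → u ∈ W → A ∙ u ∈ W) → (∀ {u} → u ∈ W → A* ∙ u ∈ W) →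
  ∀ B → T B → ∀ {u} → u ∈ W → B ∙ u ∈ W
T-closed {W = W} S A-closed A*-closed = go
  where
  open IsSubspace S
  go : ∀ B → T B → ∀ {u} → u ∈ W → B ∙ u ∈ W
  go _ A∈T           p = A-closed p
  go _ A*∈T          p = A*-closed p
  go _ Id∈T          {u} p = ≈-closed (≈ⱽ-sym (Id-∙ u)) p
  go _ (+∈T {M} {N} s t) {u} p = ≈-closed (≈ⱽ-sym (+ᴹ-∙ M N u)) (+-closed (go M s p) (go N t p))
  go _ (•∈T c {M} s) {u} p = ≈-closed (≈ⱽ-sym (•ᴹ-∙ c M u)) (•-closed c (go M s p))
  go _ (*∈T {M} {N} s t) {u} p = ≈-closed (≈ⱽ-sym (*ᴹ-∙ M N u)) (go M s (go N t p))
  go _ (≈∈T {M} e s) {u} p = ≈-closed (∙-congˡ e u) (go M s p)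

ActsAsT-closed : ∀ {D} {W : Pred (V D) 0ℓ} → IsTModule W → ∀ {Φ} → ActsAsT Φ → ∀ {u} → u ∈ W → Φ u ∈ W
ActsAsT-closed (S , closed) (M , M∈T , h) {u} p = IsSubspace.≈-closed S (h u) (closed M M∈T p)

-- The hypothesis on `u` names no nonzero coordinate. But if `c` were nonzero it would cancel from
-- every coordinate and make `u` zero, so stability gives the claim.
•ⱽ-cancel : ∀ {D c} {u : V D} → ¬ u ≈ⱽ 0ⱽ → c •ⱽ u ≈ⱽ 0ⱽ → c ≈ᶜ 0ᶜ
•ⱽ-cancel u≉0 cu≈0 = ≈0-stable λ c≉0 → u≉0 λ y → *ᶜ-cancelˡ c≉0 (cu≈0 y)

≈ⱽ0-stable : ∀ {D} {u : V D} → ¬ ¬ u ≈ⱽ 0ⱽ → u ≈ⱽ 0ⱽ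
≈ⱽ0-stable ¬¬e y = ≈0-stable λ ¬ey → ¬¬e λ e → ¬ey (e y)

sum-0 : ∀ {n} {g : Fin n → ℂ} → (∀ i → g i ≈ᶜ 0ᶜ) → sum g ≈ᶜ 0ᶜ
sum-0 {zero}  h = ≈ᶜ-refl
sum-0 {suc n} h = ℂ-ring.trans (ℂ-ring.+-cong (h fzero) (sum-0 (h ∘ fsuc))) (+ᶜ-identityˡ 0ᶜ)

sum-single : ∀ {n} (g : Fin n → ℂ) i → (∀ j → j ≢ i → g j ≈ᶜ 0ᶜ) → sum g ≈ᶜ g i
sum-single g fzero    h = ℂ-ring.trans (ℂ-ring.+-congˡ (sum-0 λ j → h (fsuc j) λ ())) (+ᶜ-identityʳ _)
sum-single g (fsuc i) h = ℂ-ring.trans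
  (ℂ-ring.+-cong (h fzero λ ()) (sum-single (g ∘ fsuc) i λ j j≢i → h (fsuc j) (j≢i ∘ Fin.suc-injective)))
      (+ᶜ-identityˡ _)

-- The index `m` may lie outside the range of summation, provided `g` vanishes there; this serves
-- the last column of the matrix, which has no row below the diagonal.
sum-toℕ : ∀ n (g : ℕ → ℂ) m → (n ℕ.≤ m → g m ≈ᶜ 0ᶜ) →
  sum {n} (λ i → if ⌊ toℕ i ℕ.≟ m ⌋ then g (toℕ i) else 0ᶜ) ≈ᶜ g m
sum-toℕ zero    g m       h = ℂ-ring.sym (h z≤n)
sum-toℕ (suc n) g zero    h = ℂ-ring.trans (ℂ-ring.+-congˡ (sum-0 {n} λ i → ≈ᶜ-refl)) (+ᶜ-identityʳ _)
sum-toℕ (suc n) g (suc m) h = ℂ-ring.trans (+ᶜ-identityˡ _) (ℂ-ring.trans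
  (sum-cong-≋ {n} λ i → ℂ-ring.reflexive (if-⇔ (suc (toℕ i) ℕ.≟ suc m) (toℕ i ℕ.≟ m) ℕ.suc-injective
      (cong suc)))
  (sum-toℕ n (g ∘ suc) m (h ∘ s≤s)))

∙-lincomb : ∀ {D n} (M : Mat D) c (v : Fin n → V D) → M ∙ lincomb c v ≈ⱽ lincomb c (λ i → M ∙ v i)
∙-lincomb {n = zero}  M c v = ∙-0 M
∙-lincomb {n = suc n} M c v = ≈ⱽ-trans (∙-+ M (c fzero •ⱽ v fzero) (lincomb (c ∘ fsuc) (v ∘ fsuc)))
  (+ⱽ-cong (∙-• M (c fzero) (v fzero)) (∙-lincomb M (c ∘ fsuc) (v ∘ fsuc)))

lincombs-isSubspace : ∀ {D n} (v : Fin n → V D) → IsSubspace (λ u → ∃ λ c → u ≈ⱽ lincomb c v)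
lincombs-isSubspace v = record
  { ≈-closed = λ e (c , h) → c , ≈ⱽ-trans (≈ⱽ-sym e) h
  ; 0-closed = (λ _ → 0ᶜ) , λ y → ℂ-ring.sym (sum-0 λ i → ℂ-ring.zeroˡ (v i y))
  ; +-closed = λ (b , g) (c , h) → (λ i → b i +ᶜ c i) , λ y → ℂ-ring.trans (ℂ-ring.+-cong (g y) (h y))
      (ℂ-ring.trans (ℂ-ring.sym (∑-distrib-+ (λ i → b i *ᶜ v i y) (λ i → c i *ᶜ v i y)))
        (sum-cong-≋ λ i → ℂ-ring.sym (ℂ-ring.distribʳ (v i y) (b i) (c i))))
  ; •-closed = λ b (c , h) → (λ i → b *ᶜ c i) , λ y → ℂ-ring.trans (ℂ-ring.*-congˡ (h y))
      (ℂ-ring.trans (*-distribˡ-sum b (λ i → c i *ᶜ v i y))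
          (sum-cong-≋ λ i → ℂ-ring.sym (*ᶜ-assoc b (c i) (v i y))))
  }

-- hi is the contribution of row j − 1, which is absent for j = 0.
tridiagonal-column : ∀ n (j : Fin (suc n)) (g : ℕ → ℂ) →
  (suc n ℕ.≤ suc (toℕ j) → g (suc (toℕ j)) ≈ᶜ 0ᶜ) → ∀ hi →
  (toℕ j ≡ 0 → hi ≈ᶜ 0ᶜ) →
  (∀ j₀ → toℕ j ≡ suc j₀ → hi ≈ᶜ (𝐢 *ᶜ fromℕ (n ∸ j₀)) *ᶜ g j₀) →
  sum {suc n} (λ i → tridiagonal n i j *ᶜ g (toℕ i)) ≈ᶜ
  (-ᶜ (𝐢 *ᶜ fromℕ (suc (toℕ j)))) *ᶜ g (suc (toℕ j)) +ᶜ hi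
tridiagonal-column n j g g-end hi hi-0 hi-suc = begin
  sum {suc n} (λ i → tridiagonal n i j *ᶜ g (toℕ i))
    ≈⟨ sum-cong-≋ {suc n} split ⟩
  sum {suc n} (λ i → below i +ᶜ above i)
    ≈⟨ ∑-distrib-+ {suc n} below above ⟩
  sum {suc n} below +ᶜ sum {suc n} above
    ≈⟨ ℂ-ring.+-cong (sum-toℕ (suc n) lo (suc (toℕ j)) λ n≤ → ℂ-ring.trans (ℂ-ring.*-congˡ (g-end n≤))
        (ℂ-ring.zeroʳ _)) (above-sum (toℕ j) refl) ⟩
  lo (suc (toℕ j)) +ᶜ hi ∎
  where
  lo up : ℕ → ℂ
  lo m = (-ᶜ (𝐢 *ᶜ fromℕ m)) *ᶜ g m
  up m = (𝐢 *ᶜ fromℕ (n ∸ m)) *ᶜ g m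
  below above : Fin (suc n) → ℂ
  below i = if ⌊ toℕ i ℕ.≟ suc (toℕ j) ⌋ then lo (toℕ i) else 0ᶜ
  above i = if ⌊ suc (toℕ i) ℕ.≟ toℕ j ⌋ then up (toℕ i) else 0ᶜ
  split : ∀ i → tridiagonal n i j *ᶜ g (toℕ i) ≈ᶜ below i +ᶜ above i
  split i with toℕ i ℕ.≟ suc (toℕ j) | suc (toℕ i) ℕ.≟ toℕ j
  ... | yes p | yes q = contradiction (ℕ.≤-reflexive (trans (cong suc (sym p)) q))
      (ℕ.<⇒≱ (ℕ.m≤n⇒m≤1+n ℕ.≤-refl))
  ... | yes _ | no _  = ℂ-ring.sym (+ᶜ-identityʳ _)
  ... | no _  | yes _ = ℂ-ring.sym (+ᶜ-identityˡ _)
  ... | no _  | no _  = ℂ-ring.trans (ℂ-ring.zeroˡ _) (ℂ-ring.sym (+ᶜ-identityˡ 0ᶜ))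
  above-sum : ∀ m → toℕ j ≡ m → sum {suc n} above ≈ᶜ hi
  above-sum zero     j≡0 = ℂ-ring.trans (sum-0 {suc n} vanishes) (ℂ-ring.sym (hi-0 j≡0))
    where
    vanishes : ∀ i → above i ≈ᶜ 0ᶜ
    vanishes i with suc (toℕ i) ℕ.≟ toℕ j
    ... | yes q = contradiction (trans q j≡0) λ ()
    ... | no _  = ≈ᶜ-refl
  above-sum (suc j₀) j≡suc = ℂ-ring.trans
    (sum-cong-≋ {suc n} λ i → ℂ-ring.reflexive (if-⇔ (suc (toℕ i) ℕ.≟ toℕ j) (toℕ i ℕ.≟ j₀) {up (toℕ i)} {0ᶜ}
      (λ q → ℕ.suc-injective (trans q j≡suc)) (λ q → trans (cong suc q) (sym j≡suc))))
    (ℂ-ring.trans (sum-toℕ (suc n) up j₀ λ n<j₀ → contradiction (Fin.toℕ<n j)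
        (ℕ.<⇒≱ (s≤s (ℕ.≤-trans n<j₀ (ℕ.≤-trans (ℕ.n≤1+n j₀) (ℕ.≤-reflexive (sym j≡suc)))))))
      (ℂ-ring.sym (hi-suc j₀ j≡suc)))

-- The module generated by a highest weight vector.

module HighestWeight
  {D r s : ℕ} (D≡r+s : D ≡ r ℕ.+ s)
  {Z X Y : Mat D} {F : ℕ → Mat D} (ladder : Ladder Z X Y F)
  {v : V D} (v≉0 : ¬ v ≈ⱽ 0ⱽ) (Yv : Y ∙ v ≈ⱽ θᶜ D r •ⱽ v) (killed : raise Z X v ≈ⱽ 0ⱽ)
  where

  open Ladder ladder

  w : ℕ → V D
  w k = F k ∙ v

  Xv : X ∙ v ≈ⱽ 𝐢 •ⱽ (Z ∙ v)
  Xv y = begin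
    (X ∙ v) y ≈⟨ solve 2 (λ x z → x := :𝐢 :* z :+ :- :𝐢 :* (z :+ :𝐢 :* x)) ≈ᶜ-refl _ _ ⟩
    𝐢 *ᶜ (Z ∙ v) y +ᶜ -ᶜ 𝐢 *ᶜ raise Z X v y ≈⟨ ℂ-ring.+-congˡ (ℂ-ring.*-congˡ (killed y)) ⟩
    𝐢 *ᶜ (Z ∙ v) y +ᶜ -ᶜ 𝐢 *ᶜ 0ᶜ ≈⟨ solve 1 (λ z → :𝐢 :* z :+ :- :𝐢 :* :0 := :𝐢 :* z) ≈ᶜ-refl _ ⟩
    𝐢 *ᶜ (Z ∙ v) y ∎

  -- `Xv` exchanges `X` for 𝐢 times `Z`, and `F k` replaces `Z` by its eigenvalue. The values 𝐢 and
  -- -𝐢 of `c` yield the two recursions.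
  project : ∀ c k → F k ∙ (X ∙ v +ⱽ c •ⱽ (Y ∙ v)) ≈ⱽ (𝐢 *ᶜ θᶜ D k +ᶜ c *ᶜ θᶜ D r) •ⱽ w k
  project c k y = begin
    (F k ∙ (X ∙ v +ⱽ c •ⱽ (Y ∙ v))) y
      ≈⟨ ∙-congʳ (F k) (+ⱽ-cong Xv (•ⱽ-congʳ c Yv)) y ⟩
    (F k ∙ (𝐢 •ⱽ (Z ∙ v) +ⱽ c •ⱽ (θᶜ D r •ⱽ v))) y
      ≈⟨ ∙-+ (F k) (𝐢 •ⱽ (Z ∙ v)) (c •ⱽ (θᶜ D r •ⱽ v)) y ⟩
    (F k ∙ (𝐢 •ⱽ (Z ∙ v))) y +ᶜ (F k ∙ (c •ⱽ (θᶜ D r •ⱽ v))) y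
      ≈⟨ ℂ-ring.+-cong
           (≈ⱽ-trans (∙-• (F k) 𝐢 (Z ∙ v)) (•ⱽ-congʳ 𝐢 (eigenʳ k v)) y)
           (≈ⱽ-trans (∙-• (F k) c (θᶜ D r •ⱽ v)) (•ⱽ-congʳ c (∙-• (F k) (θᶜ D r) v)) y) ⟩
    𝐢 *ᶜ (θᶜ D k *ᶜ w k y) +ᶜ c *ᶜ (θᶜ D r *ᶜ w k y)
      ≈⟨ solve 4 (λ c s t w → :𝐢 :* (s :* w) :+ c :* (t :* w) := (:𝐢 :* s :+ c :* t) :* w) ≈ᶜ-refl c (θᶜ D k)
          (θᶜ D r) (w k y) ⟩
    (𝐢 *ᶜ θᶜ D k +ᶜ c *ᶜ θᶜ D r) *ᶜ w k y ∎

  θr≈-θs : θᶜ D r ≈ᶜ -ᶜ θᶜ D s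
  θr≈-θs = subst (λ D → θᶜ D r ≈ᶜ -ᶜ θᶜ D s) (sym D≡r+s) (θ-antisymmetric r s)

  raise-w : ∀ k → raise X Y (w (suc k)) ≈ⱽ (𝐢 *ᶜ (θᶜ D k -ᶜ θᶜ D s)) •ⱽ w k
  raise-w k = ≈ⱽ-trans (raise-suc k v) (≈ⱽ-trans (project 𝐢 k)
      (•ⱽ-congˡ (ℂ-ring.trans (ℂ-ring.+-congˡ (ℂ-ring.*-congˡ θr≈-θs))
    (solve 2 (λ a b → :𝐢 :* a :+ :𝐢 :* :- b := :𝐢 :* (a :- b)) ≈ᶜ-refl _ _))))

  lowered : ∀ k → F k ∙ lower X Y v ≈ⱽ (𝐢 *ᶜ (θᶜ D k -ᶜ θᶜ D r)) •ⱽ w k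
  lowered k = ≈ⱽ-trans (project (-ᶜ 𝐢) k) (•ⱽ-congˡ
    (solve 2 (λ a b → :𝐢 :* a :+ :- :𝐢 :* b := :𝐢 :* (a :- b)) ≈ᶜ-refl _ _))

  lower-w : ∀ k → lower X Y (w k) ≈ⱽ (𝐢 *ᶜ (θᶜ D (suc k) -ᶜ θᶜ D r)) •ⱽ w (suc k)
  lower-w k = ≈ⱽ-trans (lower-suc k v) (lowered (suc k))

  combination-0 : ∀ c {u} → u ≈ⱽ 0ⱽ → X ∙ u +ⱽ c •ⱽ (Y ∙ u) ≈ⱽ 0ⱽ
  combination-0 c e = ≈ⱽ-trans (+ⱽ-cong (∙-≈0 X e) (≈ⱽ-trans (•ⱽ-congʳ c (∙-≈0 Y e)) (•ⱽ-0 c)))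
      (λ y → +ᶜ-identityˡ 0ᶜ)

  -- The coefficient in `raise-w` vanishes only at k = s, and that in `lower-w` only at k + 1 = r.
  -- So zeros spread downwards except onto index `s`, and upwards except onto index `r`.
  zero-down : ∀ {k} → k ≢ s → w (suc k) ≈ⱽ 0ⱽ → w k ≈ⱽ 0ⱽ
  zero-down {k} k≢s e = θ-gap-cancel {D} k≢s (≈ⱽ-trans (≈ⱽ-sym (raise-w k)) (combination-0 𝐢 e))

  zero-up : ∀ {k} → suc k ≢ r → w k ≈ⱽ 0ⱽ → w (suc k) ≈ⱽ 0ⱽ
  zero-up {k} k≢r e = θ-gap-cancel {D} k≢r (≈ⱽ-trans (≈ⱽ-sym (lower-w k)) (combination-0 (-ᶜ 𝐢) e))

  w-below : ∀ {k} → k ℕ.< r → w k ≈ⱽ 0ⱽ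
  -- The base case uses that lowering leaves no component of index 0, with θ_0 - θ_r nonzero because
  -- 0 < r.
  w-below {zero}  0<r = θ-gap-cancel {D} (ℕ.<⇒≢ 0<r) (≈ⱽ-trans (≈ⱽ-sym (lowered 0)) (lower-0 v))
  w-below {suc k} k<r = zero-up (ℕ.<⇒≢ k<r) (w-below (ℕ.<-trans (ℕ.n<1+n k) k<r))

  w-above : ∀ {k} → s ℕ.< k → w k ≈ⱽ 0ⱽ
  -- The descent starts beyond `D`, where `F` vanishes; `D` steps upwards from k > 0 suffice to get
  -- there.
  w-above {k} s<k = go D s<k (ℕ.m<n+m D (ℕ.≤-<-trans z≤n s<k))
    where
    go : ∀ n {k} → s ℕ.< k → D ℕ.< k ℕ.+ n → w k ≈ⱽ 0ⱽ
    go zero    {k} s<k D<k = vanish (subst (D ℕ.<_) (ℕ.+-identityʳ k) D<k) v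
    go (suc n) {k} s<k D<k = zero-down (ℕ.<⇒≢ s<k ∘ sym)
      (go n (ℕ.<-trans s<k (ℕ.n<1+n k)) (subst (D ℕ.<_) (ℕ.+-suc k n) D<k))

  -- Otherwise every index is below `r` or above `s`, all components of `v` vanish and `v` is 0.
  r≤s : r ℕ.≤ s
  r≤s with r ℕ.≤? s
  ... | yes r≤s = r≤s
  ... | no r≰s  = contradiction (resolve v w≈0) v≉0
    where
    w≈0 : ∀ k → w k ≈ⱽ 0ⱽ
    w≈0 k with k ℕ.<? r
    ... | yes k<r = w-below k<r
    ... | no k≮r  = w-above (ℕ.<-≤-trans (ℕ.≰⇒> r≰s) (ℕ.≮⇒≥ k≮r))

  -- A zero between `r` and `s` would spread to all indices: going up from it never enters `r`, and
  -- going down never enters `s`.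
  w≉0 : ∀ {k} → r ℕ.≤ k → k ℕ.≤ s → ¬ w k ≈ⱽ 0ⱽ
  w≉0 {k} r≤k k≤s wk≈0 = v≉0 (resolve v everywhere)
    where
    upwards : ∀ n → w (n ℕ.+ k) ≈ⱽ 0ⱽ
    upwards zero    = wk≈0
    upwards (suc n) = zero-up (ℕ.<⇒≢ (s≤s (ℕ.≤-trans r≤k (ℕ.m≤n+m k n))) ∘ sym) (upwards n)
    downwards : ∀ n {j} → n ℕ.+ j ≡ k → w j ≈ⱽ 0ⱽ
    downwards zero    refl = wk≈0
    downwards (suc n) {j} e = zero-down (ℕ.<⇒≢
        (ℕ.<-≤-trans (s≤s (ℕ.m≤n+m j n)) (ℕ.≤-trans (ℕ.≤-reflexive e) k≤s)))
      (downwards n (trans (ℕ.+-suc n j) e))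
    everywhere : ∀ j → w j ≈ⱽ 0ⱽ
    everywhere j with ℕ.≤-total k j
    ... | inj₁ k≤j = subst (λ i → w i ≈ⱽ 0ⱽ) (ℕ.m∸n+n≡m k≤j) (upwards (j ∸ k))
    ... | inj₂ j≤k = downwards (k ∸ j) (ℕ.m∸n+n≡m j≤k)

  raise-Span : ∀ k → raise X Y (w k) ∈ Span w
  raise-Span zero    = resp (≈ⱽ-sym (raise-0 v)) zero
  raise-Span (suc k) = resp (≈ⱽ-sym (raise-w k)) (mul _ (gen k))

  lower-Span : ∀ k → lower X Y (w k) ∈ Span w
  lower-Span k = resp (≈ⱽ-sym (lower-w k)) (mul _ (gen (suc k)))

  Span-closed : ∀ M → (∀ k → M ∙ w k ∈ Span w) → ∀ {u} → u ∈ Span w → M ∙ u ∈ Span w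
  Span-closed M = Span⊆ (preimage-isSubspace M (Span-isSubspace w))

  X-closed : ∀ {u} → u ∈ Span w → X ∙ u ∈ Span w
  X-closed = Span-closed X λ k → resp (≈ⱽ-sym (raise-lower-X X Y (w k)))
      (mul _ (add (raise-Span k) (lower-Span k)))

  Y-closed : ∀ {u} → u ∈ Span w → Y ∙ u ∈ Span w
  Y-closed = Span-closed Y λ k → resp (≈ⱽ-sym (raise-lower-Y X Y (w k)))
      (mul _ (add (raise-Span k) (mul _ (lower-Span k))))

  Z-closed : ∀ {u} → u ∈ Span w → Z ∙ u ∈ Span w
  Z-closed = Span-closed Z λ k → resp (≈ⱽ-sym (eigenˡ k v)) (mul _ (gen k))

  module InModule
    {W : Pred (V D) 0ℓ} (W-irreducible : IsIrreducible W) (v∈W : v ∈ W)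
    (F-acts : ∀ k → ActsAsT (F k ∙_))
    -- States that both generators of `T` are among `X`, `Y`, `Z`, in a form that transfers any
    -- property of matrices.
    (A,A*∈XYZ : ∀ {C : Mat D → Set} → C X → C Y → C Z → C A × C A*)
    where

    n : ℕ
    n = s ∸ r

    basis : Fin (suc n) → V D
    basis i = w (r ℕ.+ toℕ i)

    r+n≡s : r ℕ.+ n ≡ s
    r+n≡s = ℕ.m+[n∸m]≡n r≤s

    in-range : ∀ (i : Fin (suc n)) → r ℕ.+ toℕ i ℕ.≤ s
    in-range i = ℕ.≤-trans (ℕ.+-monoʳ-≤ r (Fin.toℕ≤pred[n] i)) (ℕ.≤-reflexive r+n≡s)

    basis≉0 : ∀ i → ¬ basis i ≈ⱽ 0ⱽ
    basis≉0 i = w≉0 (ℕ.m≤m+n r (toℕ i)) (in-range i)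

    w∈W : ∀ k → w k ∈ W
    w∈W k = ActsAsT-closed (proj₁ W-irreducible) (F-acts k) v∈W

    W⊆Span : W ⊆ Span w
    W⊆Span = proj₂ (proj₂ W-irreducible) (Span w)
      (Span-isSubspace w , T-closed (Span-isSubspace w) (proj₁ A,A*-closed) (proj₂ A,A*-closed))
      (Span⊆ (proj₁ (proj₁ W-irreducible)) w∈W)
      (w r , gen r , w≉0 ℕ.≤-refl r≤s)
      where
      A,A*-closed = A,A*∈XYZ {λ M → ∀ {u} → u ∈ Span w → M ∙ u ∈ Span w} X-closed Y-closed Z-closed

    -- On the spanning vectors `F k` gives 0 or `w k`. Below `r` this feeds `highest-weight` for the
    -- next rotation; for `E*` both cases enter the computation of the diameter.
    F-vanishes : ∀ {k} → k ℕ.< r ⊎ s ℕ.< k → ∀ {u} → u ∈ W → F k ∙ u ≈ⱽ 0ⱽ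
    F-vanishes {k} k∉ u∈W = Span⊆ (preimage-isSubspace (F k) 0-isSubspace) on-w (W⊆Span u∈W)
      where
      0-isSubspace : IsSubspace {D} (_≈ⱽ 0ⱽ)
      0-isSubspace = record
        { ≈-closed = λ e p → ≈ⱽ-trans (≈ⱽ-sym e) p
        ; 0-closed = ≈ⱽ-refl
        ; +-closed = λ p q → ≈ⱽ-trans (+ⱽ-cong p q) (λ y → +ᶜ-identityˡ 0ᶜ)
        ; •-closed = λ c p → ≈ⱽ-trans (•ⱽ-congʳ c p) (•ⱽ-0 c)
        }
      wk≈0 : k ℕ.< r ⊎ s ℕ.< k → w k ≈ⱽ 0ⱽ
      wk≈0 (inj₁ k<r) = w-below k<r
      wk≈0 (inj₂ s<k) = w-above s<k
      on-w : ∀ j → F k ∙ w j ≈ⱽ 0ⱽ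
      on-w j with k ℕ.≟ j
      ... | yes refl = ≈ⱽ-trans (idem k v) (wk≈0 k∉)
      ... | no k≢j   = orth k≢j v

    -- `F` of index r + i annihilates every basis vector but the i-th and so reads off one
    -- coefficient; independence follows since that vector is nonzero.
    coefficient : ∀ c i → F (r ℕ.+ toℕ i) ∙ lincomb c basis ≈ⱽ c i •ⱽ basis i
    coefficient c i y = ℂ-ring.trans (∙-lincomb (F (r ℕ.+ toℕ i)) c basis y)
      (ℂ-ring.trans (sum-single (λ j → c j *ᶜ (F (r ℕ.+ toℕ i) ∙ basis j) y) i λ j j≢i →
        ℂ-ring.trans (ℂ-ring.*-congˡ (orth (λ e → j≢i (Fin.toℕ-injective (sym (ℕ.+-cancelˡ-≡ r _ _ e)))) v y))
            (ℂ-ring.zeroʳ (c j)))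
      (ℂ-ring.*-congˡ (idem (r ℕ.+ toℕ i) v y)))

    w-lincomb : ∀ k → ∃ λ c → w k ≈ⱽ lincomb c basis
    w-lincomb k with r ℕ.≤? k | k ℕ.≤? s
    ... | no r≰k  | _       = (λ _ → 0ᶜ) , ≈ⱽ-trans (w-below (ℕ.≰⇒> r≰k)) λ y → ℂ-ring.sym
        (sum-0 λ i → ℂ-ring.zeroˡ (basis i y))
    ... | yes _   | no k≰s  = (λ _ → 0ᶜ) , ≈ⱽ-trans (w-above (ℕ.≰⇒> k≰s)) λ y → ℂ-ring.sym
        (sum-0 λ i → ℂ-ring.zeroˡ (basis i y))
    ... | yes r≤k | yes k≤s = δᵢ , λ y → ℂ-ring.sym (ℂ-ring.trans
        (sum-single (λ j → δᵢ j *ᶜ basis j y) i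
            (λ j j≢i → ℂ-ring.trans (ℂ-ring.*-congʳ ([n≟k]≈0 (j≢i ∘ Fin.toℕ-injective))) (ℂ-ring.zeroˡ _)))
        (ℂ-ring.trans (ℂ-ring.*-congʳ ([k≟k] (toℕ i))) (ℂ-ring.trans (*ᶜ-identityˡ _)
          (ℂ-ring.reflexive (cong (λ m → w m y)
              (trans (cong (r ℕ.+_) (Fin.toℕ-fromℕ< bound)) (ℕ.m+[n∸m]≡n r≤k)))))))
      where
      bound : k ∸ r ℕ.< suc n
      bound = s≤s (ℕ.∸-monoˡ-≤ r k≤s)
      i : Fin (suc n)
      i = fromℕ< bound
      δᵢ : Fin (suc n) → ℂ
      δᵢ j = [ toℕ j ≟ toℕ i ]

    basis-isBasis : IsBasis W basis
    basis-isBasis = record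
      { members     = λ i → w∈W (r ℕ.+ toℕ i)
      ; independent = λ c e i → •ⱽ-cancel (basis≉0 i)
          (≈ⱽ-trans (≈ⱽ-sym (coefficient c i)) (∙-≈0 (F (r ℕ.+ toℕ i)) e))
      ; spanning    = Span⊆ (lincombs-isSubspace basis) w-lincomb ∘ W⊆Span
      }

    -- `X` is half the sum of `raise` and `lower`. In column j, lowering has the gap θ_{r+j+1} - θ_r
    -- = -2(j+1) and gives the entry below the diagonal; raising has the gap θ_{r+j-1} - θ_s =
    -- 2(n-j+1) and gives the entry above it.
    X-tridiagonal : ∀ j → X ∙ basis j ≈ⱽ lincomb (λ i → tridiagonal n i j) basis
    X-tridiagonal j y = begin
      (X ∙ basis j) y
        ≈⟨ raise-lower-X X Y (basis j) y ⟩
      fromℚ ½ *ᶜ (raise X Y (basis j) y +ᶜ lower X Y (basis j) y)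
        ≈⟨ ℂ-ring.*-congˡ (ℂ-ring.+-congˡ (subst
            (λ m → lower X Y (basis j) y ≈ᶜ (𝐢 *ᶜ (θᶜ D m -ᶜ θᶜ D r)) *ᶜ w m y) (sym (ℕ.+-suc r (toℕ j)))
            (lower-w (r ℕ.+ toℕ j) y))) ⟩
      fromℚ ½ *ᶜ (raise X Y (basis j) y +ᶜ (𝐢 *ᶜ (θᶜ D (r ℕ.+ suc (toℕ j)) -ᶜ θᶜ D r)) *ᶜ g (suc (toℕ j)))
        ≈⟨ ℂ-ring.*-congˡ (ℂ-ring.+-congˡ (ℂ-ring.*-congʳ
            (ℂ-ring.*-congˡ (ℂ-ring.+-congˡ (ℂ-ring.-‿cong (θ-+ D r (suc (toℕ j)))))))) ⟩
      fromℚ ½ *ᶜ (raise X Y (basis j) y +ᶜ (𝐢 *ᶜ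
          (θᶜ D (r ℕ.+ suc (toℕ j)) -ᶜ (θᶜ D (r ℕ.+ suc (toℕ j)) +ᶜ (c +ᶜ c)))) *ᶜ g (suc (toℕ j)))
        ≈⟨ solve 4 (λ p t c g → :½ :* (p :+ (:𝐢 :* (t :- (t :+ (c :+ c)))) :* g) :=
            (:- (:𝐢 :* c)) :* g :+ :½ :* p) ≈ᶜ-refl _ _ c _ ⟩
      (-ᶜ (𝐢 *ᶜ c)) *ᶜ g (suc (toℕ j)) +ᶜ fromℚ ½ *ᶜ raise X Y (basis j) y
        ≈⟨ tridiagonal-column n j g
             -- In the last column the missing row would carry `w` at s + 1, which is 0.
             (λ n<j → w-above (ℕ.≤-trans (s≤s (ℕ.≤-reflexive (sym r+n≡s)))
                 (ℕ.≤-trans (ℕ.≤-reflexive (sym (ℕ.+-suc r n))) (ℕ.+-monoʳ-≤ r n<j))) y)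
             (fromℚ ½ *ᶜ raise X Y (basis j) y)
             -- In the first column raising gives a multiple of `w` at r - 1, which is 0, or
             -- vanishes by `raise-0` if r = 0.
             (λ j≡0 → ℂ-ring.trans (ℂ-ring.*-congˡ
                 (top (r ℕ.+ toℕ j) (trans (cong (r ℕ.+_) j≡0) (ℕ.+-identityʳ r)))) (ℂ-ring.zeroʳ _))
             upper ⟨
      lincomb (λ i → tridiagonal n i j) basis y ∎
      where
      c = fromℕ (suc (toℕ j))
      g : ℕ → ℂ
      g m = w (r ℕ.+ m) y
      top : ∀ k → k ≡ r → raise X Y (w k) y ≈ᶜ 0ᶜ
      top zero    _     = raise-0 v y
      top (suc k) k+1≡r = ℂ-ring.trans (raise-w k y)
          (ℂ-ring.trans (ℂ-ring.*-congˡ (w-below (ℕ.≤-reflexive k+1≡r) y)) (ℂ-ring.zeroʳ _))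
      upper : ∀ j₀ → toℕ j ≡ suc j₀ → fromℚ ½ *ᶜ raise X Y (basis j) y ≈ᶜ (𝐢 *ᶜ fromℕ (n ∸ j₀)) *ᶜ g j₀
      upper j₀ j≡suc = begin
        fromℚ ½ *ᶜ raise X Y (basis j) y
          ≈⟨ ℂ-ring.reflexive (cong (λ m → fromℚ ½ *ᶜ raise X Y (w m) y)
              (trans (cong (r ℕ.+_) j≡suc) (ℕ.+-suc r j₀))) ⟩
        fromℚ ½ *ᶜ raise X Y (w (suc (r ℕ.+ j₀))) y
          ≈⟨ ℂ-ring.*-congˡ (raise-w (r ℕ.+ j₀) y) ⟩
        fromℚ ½ *ᶜ ((𝐢 *ᶜ (θᶜ D (r ℕ.+ j₀) -ᶜ θᶜ D s)) *ᶜ g j₀)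
          ≈⟨ ℂ-ring.*-congˡ (ℂ-ring.*-congʳ (ℂ-ring.*-congˡ (ℂ-ring.+-congʳ gap-θ))) ⟩
        fromℚ ½ *ᶜ ((𝐢 *ᶜ ((θᶜ D s +ᶜ (e +ᶜ e)) -ᶜ θᶜ D s)) *ᶜ g j₀)
          ≈⟨ solve 3 (λ t e g → :½ :* ((:𝐢 :* ((t :+ (e :+ e)) :- t)) :* g) := (:𝐢 :* e) :* g) ≈ᶜ-refl _ e _ ⟩
        (𝐢 *ᶜ e) *ᶜ g j₀ ∎
        where
        e = fromℕ (n ∸ j₀)
        j₀≤n : j₀ ℕ.≤ n
        j₀≤n = ℕ.≤-trans (ℕ.n≤1+n j₀) (ℕ.≤-trans (ℕ.≤-reflexive (sym j≡suc)) (Fin.toℕ≤pred[n] j))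
        gap-θ : θᶜ D (r ℕ.+ j₀) ≈ᶜ θᶜ D s +ᶜ (e +ᶜ e)
        gap-θ = subst (λ m → θᶜ D (r ℕ.+ j₀) ≈ᶜ θᶜ D m +ᶜ (e +ᶜ e))
          (trans (ℕ.+-assoc r j₀ (n ∸ j₀)) (trans (cong (r ℕ.+_) (ℕ.m+[n∸m]≡n j₀≤n)) r+n≡s))
              (θ-+ D (r ℕ.+ j₀) (n ∸ j₀))

    represents : Represents (tridiagonal n) X W basis
    represents = basis-isBasis , X-tridiagonal

-- Highest weight vectors in `W` and the diameter.

raise-closed : ∀ {D} {W : Pred (V D) 0ℓ} → IsTModule W → ∀ {Z X : Mat D} → T Z → T X → ∀ {u} → u ∈ W →
    raise Z X u ∈ W
raise-closed (S , closed) Z∈T X∈T u∈W = IsSubspace.+-closed S (closed _ Z∈T u∈W)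
    (IsSubspace.•-closed S 𝐢 (closed _ X∈T u∈W))

-- Raising moves the component of index `r` to index r - 1 within the same module, where `G`
-- vanishes, or kills it when r = 0. The ladder is the rotation (Y, Z, X) of the triple (Z, X, Y) of
-- `HighestWeight`, so its `raise Z X` is the operator in `killed`.
highest-weight : ∀ {D} {W : Pred (V D) 0ℓ} → IsTModule W →
  ∀ {Y Z X : Mat D} {G} → Ladder Y Z X G → T Z → T X → (∀ k → ActsAsT (G k ∙_)) →
  ∀ {r} → (∀ {k} → k ℕ.< r → ∀ {w} → w ∈ W → G k ∙ w ≈ⱽ 0ⱽ) →
  ∀ {v} → v ∈ G r ⟨ W ⟩ → v ∈ W × Y ∙ v ≈ⱽ θᶜ D r •ⱽ v × raise Z X v ≈ⱽ 0ⱽ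
highest-weight {D} {W} W-module {Y} {Z} {X} {G} ladder Z∈T X∈T G-acts {r} G-vanishes {v} (w , w∈W , v≈Gw) =
    IsSubspace.≈-closed (proj₁ W-module) (≈ⱽ-sym v≈Gw) (ActsAsT-closed W-module (G-acts r) w∈W)
  , ≈ⱽ-trans (∙-congʳ Y v≈Gw) (≈ⱽ-trans (eigenˡ r w) (•ⱽ-congʳ (θᶜ D r) (≈ⱽ-sym v≈Gw)))
  , ≈ⱽ-trans (+ⱽ-cong (∙-congʳ Z v≈Gw) (•ⱽ-congʳ 𝐢 (∙-congʳ X v≈Gw))) (kills r ℕ.≤-refl)
  where
  open Ladder ladder
  kills : ∀ k → k ℕ.≤ r → raise Z X (G k ∙ w) ≈ⱽ 0ⱽ
  kills zero    _   = raise-0 w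
  kills (suc k) k<r = ≈ⱽ-trans (raise-suc k w) (G-vanishes k<r (raise-closed W-module Z∈T X∈T w∈W))

-- The half-open form lets the recursion drop the first element by lowering both ends with `pred`;
-- truncated subtraction gives 0 for empty intervals.
∣interval∣ : ∀ {n} (S : Subset n) a b → b ℕ.≤ n → (∀ i → i ∈ˢ S ⇔ (a ℕ.≤ toℕ i × toℕ i ℕ.< b)) → ∣ S ∣ ≡ b ∸ a
∣interval∣ []       a b z≤n _ = sym (ℕ.0∸n≡0 a)
∣interval∣ (x ∷ S) a b b≤n h = go x a b b≤n h
  where
  open Equivalence
  drop : ∀ {x a b} → (∀ i → i ∈ˢ (x ∷ S) ⇔ (a ℕ.≤ toℕ i × toℕ i ℕ.< b)) →
         ∀ i → i ∈ˢ S ⇔ (ℕ.pred a ℕ.≤ toℕ i × toℕ i ℕ.< ℕ.pred b)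
  drop {a = a} {b} h i = mk⇔
    (λ i∈S → let a≤ , <b = to (h (fsuc i)) (there i∈S) in ℕ.pred-mono-≤ a≤ , ℕ.pred-mono-≤ <b)
    (λ (a≤ , <b) → unthere (from (h (fsuc i)) (unpred a≤ , unpred< b <b)))
    where
    unthere : ∀ {x} → fsuc i ∈ˢ (x ∷ S) → i ∈ˢ S
    unthere (there i∈S) = i∈S
    unpred : ∀ {a m} → ℕ.pred a ℕ.≤ m → a ℕ.≤ suc m
    unpred {zero}  _ = z≤n
    unpred {suc a} p = s≤s p
    unpred< : ∀ b {m} → m ℕ.< ℕ.pred b → suc m ℕ.< b
    unpred< (suc b) p = s≤s p
  go : ∀ x a b → b ℕ.≤ _ → (∀ i → i ∈ˢ (x ∷ S) ⇔ (a ℕ.≤ toℕ i × toℕ i ℕ.< b)) → ∣ x ∷ S ∣ ≡ b ∸ a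
  go inside  zero    (suc b) b≤n h = cong suc (∣interval∣ S 0 b (ℕ.s≤s⁻¹ b≤n) (drop h))
  go inside  zero    zero    b≤n h = contradiction (proj₂ (to (h fzero) here)) λ ()
  go inside  (suc a) b       b≤n h = contradiction (proj₁ (to (h fzero) here)) λ ()
  go outside zero    (suc b) b≤n h = contradiction (from (h fzero) (z≤n , s≤s z≤n)) λ ()
  go outside (suc a) (suc b) b≤n h = ∣interval∣ S a b (ℕ.s≤s⁻¹ b≤n) (drop h)
  go outside zero    zero    b≤n h = ∣interval∣ S 0 0 z≤n (drop h)
  go outside (suc a) zero    b≤n h = trans (∣interval∣ S a 0 z≤n (drop h)) (ℕ.0∸n≡0 a)

theorem10p3 : ∀ (D : ℕ) .{{_ : NonZero D}} (W : Pred (V D) 0ℓ) → IsIrreducible W →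
    ∀ (r d : ℕ) → IsEndpoint W r → IsDiameter W d →
    ∀ (u u* uᵋ : V D) →
    u ∈ E r ⟨ W ⟩ → u* ∈ E* r ⟨ W ⟩ → uᵋ ∈ Eᵋ r ⟨ W ⟩ →
    ¬ u ≈ⱽ 0ⱽ → ¬ u* ≈ⱽ 0ⱽ → ¬ uᵋ ≈ⱽ 0ⱽ →
    Represents (tridiagonal d) A W (λ i → Eᵋ (r + toℕ i) ∙ u*)
    × Represents (tridiagonal d) A* W (λ i → E (r + toℕ i) ∙ uᵋ)
    × Represents (tridiagonal d) Aᵋ W (λ i → E* (r + toℕ i) ∙ u)
theorem10p3 D W irreducible r d (r≤D , _ , minimal) (S , S⇔ , ∣S∣≡) u u* uᵋ u∈ u*∈ uᵋ∈ u≉0 u*≉0 uᵋ≉0 =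
  -- All three parts are first obtained with s - r in place of `d`; the diameter is computed
  -- afterwards, from the third rotation.
  subst Claim (sym d≡s∸r) (I.represents , II.represents , III.represents)
  where
  Claim : ℕ → Set
  Claim d =
    Represents (tridiagonal d) A W (λ i → Eᵋ (r + toℕ i) ∙ u*)
    × Represents (tridiagonal d) A* W (λ i → E (r + toℕ i) ∙ uᵋ)
    × Represents (tridiagonal d) Aᵋ W (λ i → E* (r + toℕ i) ∙ u)

  s : ℕ
  s = D ∸ r

  D≡r+s : D ≡ r + s
  D≡r+s = sym (ℕ.m+[n∸m]≡n r≤D)

  W-module : IsTModule W
  W-module = proj₁ irreducible

  E*-vanishes : ∀ {k} → k ℕ.< r → ∀ {w} → w ∈ W → E* k ∙ w ≈ⱽ 0ⱽ
  -- Minimality of `r` only refutes that the vector is nonzero; stability of equality with 0 does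
  -- the rest.
  E*-vanishes {k} k<r {w} w∈W = ≈ⱽ0-stable λ E*w≉0 → ℕ.<⇒≱ k<r
    (minimal k (ℕ.≤-trans (ℕ.<⇒≤ k<r) r≤D) (E* k ∙ w , (w , w∈W , ≈ⱽ-refl) , E*w≉0))

  u*-highest : u* ∈ W × A* ∙ u* ≈ⱽ θᶜ D r •ⱽ u* × raise Aᵋ A u* ≈ⱽ 0ⱽ
  u*-highest = highest-weight W-module ladder* Aᵋ∈T A∈T E*-acts E*-vanishes u*∈

  -- The triple (Z, X, Y) is (Aᵋ, A, A*) in `I`, (A, A*, Aᵋ) in `II` and (A*, Aᵋ, A) in `III`, so
  -- that `X` is the matrix to be represented.
  module I where
    open HighestWeight {D} {r} {s} D≡r+s ladderᵋ u*≉0 (proj₁ (proj₂ u*-highest))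
        (proj₂ (proj₂ u*-highest)) public
    open InModule irreducible (proj₁ u*-highest) Eᵋ-acts (λ A-ok A*-ok _ → A-ok , A*-ok) public

  uᵋ-highest : uᵋ ∈ W × Aᵋ ∙ uᵋ ≈ⱽ θᶜ D r •ⱽ uᵋ × raise A A* uᵋ ≈ⱽ 0ⱽ
  uᵋ-highest = highest-weight W-module ladderᵋ A∈T A*∈T Eᵋ-acts (λ k<r → I.F-vanishes (inj₁ k<r)) uᵋ∈

  module II where
    open HighestWeight {D} {r} {s} D≡r+s ladder uᵋ≉0 (proj₁ (proj₂ uᵋ-highest))
        (proj₂ (proj₂ uᵋ-highest)) public
    open InModule irreducible (proj₁ uᵋ-highest) E-acts (λ A*-ok _ A-ok → A-ok , A*-ok) public

  u-highest : u ∈ W × A ∙ u ≈ⱽ θᶜ D r •ⱽ u × raise A* Aᵋ u ≈ⱽ 0ⱽ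
  u-highest = highest-weight W-module ladder A*∈T Aᵋ∈T E-acts (λ k<r → II.F-vanishes (inj₁ k<r)) u∈

  module III where
    open HighestWeight {D} {r} {s} D≡r+s ladder* u≉0 (proj₁ (proj₂ u-highest))
        (proj₂ (proj₂ u-highest)) public
    open InModule irreducible (proj₁ u-highest) E*-acts (λ _ A-ok A*-ok → A-ok , A*-ok) public

  nonzero⇒in-range : ∀ k → IsNonzero (E* k ⟨ W ⟩) → r ℕ.≤ k × k ℕ.< suc s
  nonzero⇒in-range k (v , (w , w∈W , v≈E*w) , v≉0) =
      ℕ.≮⇒≥ (λ k<r → v≉0 (≈ⱽ-trans v≈E*w (III.F-vanishes (inj₁ k<r) w∈W)))
    , s≤s (ℕ.≮⇒≥ (λ s<k → v≉0 (≈ⱽ-trans v≈E*w (III.F-vanishes (inj₂ s<k) w∈W))))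

  in-range⇒nonzero : ∀ k → r ℕ.≤ k × k ℕ.< suc s → IsNonzero (E* k ⟨ W ⟩)
  in-range⇒nonzero k (r≤k , s≤s k≤s) = E* k ∙ u , (u , proj₁ u-highest , ≈ⱽ-refl) , III.w≉0 r≤k k≤s

  d≡s∸r : d ≡ s ∸ r
  d≡s∸r = ℕ.suc-injective (trans (sym ∣S∣≡) (trans
    (∣interval∣ S r (suc s) (s≤s (ℕ.m∸n≤m D r)) λ i → mk⇔
      (λ i∈S → nonzero⇒in-range (toℕ i) (Equivalence.to (S⇔ i) i∈S))
      (λ i-in-range → Equivalence.from (S⇔ i) (in-range⇒nonzero (toℕ i) i-in-range)))
    -- Only r ≤ s lets the successor pass out of the truncated suc s ∸ r.
    (ℕ.+-∸-assoc 1 III.r≤s)))
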